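{- For all $k\geq 1$, $$\sum_{n\geq 0} I^e_{12\cdots k}(n)\,x^n=\sum_{j=0}^{k-1}\left(x^j\Bigl(1+x^2R^e_{k-1-j}(x^2)\,F_{k-j}(x)\Bigr)\prod_{i=k-j}^{k}R_i(-x^2)\right),$$ where $F_m(x)=\dfrac{1}{x\,U_m\!\left(\frac{1}{2x}\right)}\sum_{j=0}^{m-1}U_j\!\left(\frac{1}{2x}\right)$.
   Context: For a pattern $\tau$, $I^e_\tau(n)$ is the number of even involutions $\pi\in\mathfrak{S}_n$ (i.e. $\pi=\pi^{ -1}$ with an even number of inversions, an inversion being a pair $i<j$ with $\pi_i>\pi_j$) that avoid both $132$ and $\tau$ ($\pi$ avoids $\tau\in\mathfrak{S}_k$ if no subsequence $\pi_{i_1}\cdots\pi_{i_k}$, $i_1<\dots<i_k$, is order-isomorphic to $\tau$); $I^e_\tau(0)=1$ (empty involution). $12\cdots k$ denotes the identity pattern of length $k$. $U_r$ is the Chebyshev polynomial of the second kind: $U_r(\cos\theta)=\sin((r+1)\theta)/\sin\theta$, equivalently $U_0=1$, $U_1(t)=2t$, $U_r(t)=2tU_{r-1}(t)-U_{r-2}(t)$, and $U_{ -1}=0$. For $k\geq0$, $R_k(x)=\dfrac{U_{k-1}\left(\frac{1}{2\sqrt{x}}\right)}{\sqrt{x}\,U_k\left(\frac{1}{2\sqrt{x}}\right)}$, a rational function of $x$ (so $R_0=0$, $R_1=1$, $R_2=1/(1-x)$, and $R_k=1/(1-xR_{k-1})$). $R^e_k(x)=\tfrac12(R_k(x)+R_k(-x))$.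 Both sides are regarded as power series in $x$. -}

module Defs where

open import Data.Bool using (Bool; true; false; _∧_; not; if_then_else_)
open import Data.Nat using (ℕ; zero; suc; _∸_; _<ᵇ_; _≡ᵇ_; _%_)
import Data.Nat as N
open import Data.Fin using (Fin; toℕ)
open import Data.Integer using (ℤ; +_; -_; _+_; _*_)
open import Data.Bool.ListAction using (all; any)
open import Data.List using (List; []; _∷_; [_]; _++_; map; length; concatMap; allFin; upTo; zip; foldr)
open import Data.Vec using (Vec; lookup; toList)
import Data.Vec as V
open import Data.Product using (_,_; proj₁; proj₂)
open import Function using (_∘_)

allVecs : (m n : ℕ) → List (Vec (Fin n) m)
allVecs zero n = [ V.[] ]
allVecs (suc m) n = concatMap (λ i → map (i V.∷_) (allVecs m n)) (allFin n)

-- w ∘ w = id ; an involution of {0..n-1} (automatically a permutation)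
isInvolution : {n : ℕ} → Vec (Fin n) n → Bool
isInvolution {n} w = all (λ i → toℕ (lookup w (lookup w i)) ≡ᵇ toℕ i) (allFin n)

oneLine : {n : ℕ} → Vec (Fin n) n → List ℕ
oneLine w = toList (V.map toℕ w)

inversions : List ℕ → ℕ
inversions [] = 0
inversions (a ∷ l) = length (Data.List.filterᵇ (λ b → b <ᵇ a) l) N.+ inversions l

isEven : ℕ → Bool
isEven m = (m % 2) ≡ᵇ 0

subseqs : List ℕ → List (List ℕ)
subseqs [] = [ [] ]
subseqs (x ∷ xs) = map (x ∷_) (subseqs xs) ++ subseqs xs

_==_ : Bool → Bool → Bool
true == b = b
false == b = not b

orderIso : List ℕ → List ℕ → Bool
orderIso s t = (length s ≡ᵇ length t) ∧
  all (λ p → all (λ q → (proj₁ p <ᵇ proj₁ q) == (proj₂ p <ᵇ proj₂ q)) (zip s t)) (zip s t)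

contains : List ℕ → List ℕ → Bool
contains π τ = any (orderIso τ) (subseqs π)

countᵇ : {A : Set} → (A → Bool) → List A → ℕ
countᵇ p [] = 0
countᵇ p (x ∷ xs) = (if p x then 1 else 0) N.+ countᵇ p xs

pat132 : List ℕ
pat132 = 0 ∷ 2 ∷ 1 ∷ []

-- identity pattern 12⋯k (written 0-based as 0,1,…,k-1)
idPat : ℕ → List ℕ
idPat k = upTo k

Ie : List ℕ → ℕ → ℕ
Ie τ n = countᵇ good (allVecs n n)
  where
  good : Vec (Fin n) n → Bool
  good w = isInvolution w ∧ isEven (inversions (oneLine w))
           ∧ not (contains (oneLine w) pat132) ∧ not (contains (oneLine w) τ)

Series : Set
Series = ℕ → ℤ

sumℤ : List ℤ → ℤ
sumℤ = foldr _+_ (+ 0)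

zeroS : Series
zeroS _ = + 0

oneS : Series
oneS zero = + 1
oneS (suc _) = + 0

X : Series
X 1 = + 1
X _ = + 0

addS : Series → Series → Series
addS f g n = f n + g n

subS : Series → Series → Series
subS f g n = f n + - g n

mulS : Series → Series → Series
mulS f g n = sumℤ (map (λ i → f i * g (n ∸ i)) (upTo (suc n)))

-- coefficients b_n, b_{n-1}, …, b_0 of 1/f, assuming f 0 = 1
invVec : Series → (n : ℕ) → Vec ℤ (suc n)
invVec f zero = + 1 V.∷ V.[]
invVec f (suc n) =
  - sumℤ (Data.List.zipWith _*_ (map (f ∘ suc) (upTo (suc n))) (toList (invVec f n)))
  V.∷ invVec f n

inv1 : Series → Series
inv1 f n = V.head (invVec f n)

shiftS : ℕ → Series → Series
shiftS zero f = f
shiftS (suc j) f zero = + 0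
shiftS (suc j) f (suc n) = shiftS j f n

negArg : Series → Series
negArg f n = if isEven n then f n else - f n

-- f(x²)
dil : Series → Series
dil f zero = f zero
dil f (suc zero) = + 0
dil f (suc (suc n)) = dil (f ∘ suc) n

evenPart : Series → Series
evenPart f n = if isEven n then f n else + 0

sumOver : List ℕ → (ℕ → Series) → Series
sumOver l t = foldr (λ i s → addS (t i) s) zeroS l

prodOver : List ℕ → (ℕ → Series) → Series
prodOver l t = foldr (λ i s → mulS (t i) s) oneS l

-- Chebyshev polynomials, rescaled.
-- Q (r+1) = x^{r/2} U_r(1/(2√x)) (a polynomial in x), Q 0 = x^{-1/2}U_{-1} = 0.
-- From U_r = 2t U_{r-1} - U_{r-2}:  Q (r+2) = Q (r+1) - x Q r.

Q : ℕ → Series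
Q zero = zeroS
Q (suc zero) = oneS
Q (suc (suc r)) = subS (Q (suc r)) (mulS X (Q r))

-- R_k(x) = U_{k-1}(1/(2√x)) / (√x U_k(1/(2√x))) = Q k / Q (k+1)
R : ℕ → Series
R k = mulS (Q k) (inv1 (Q (suc k)))

Re : ℕ → Series
Re k = evenPart (R k)

-- U_j(1/(2x)) = x^{-j} Q(j+1)(x²), hence
-- F_m(x) = (1/(x U_m(1/(2x)))) Σ_{j<m} U_j(1/(2x))
--        = (Σ_{j<m} x^{m-1-j} Q(j+1)(x²)) / Q(m+1)(x²)
F : ℕ → Series
F m = mulS (sumOver (upTo m) (λ j → shiftS (m ∸ 1 ∸ j) (dil (Q (suc j)))))
           (inv1 (dil (Q (suc m))))

atNegSq : Series → Series
atNegSq f = dil (negArg f)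

genFun : ℕ → Series
genFun k n = + Ie (idPat k) n

rhs : ℕ → Series
rhs k = sumOver (upTo k) term
  where
  term : ℕ → Series
  term j = shiftS j
    (mulS (addS oneS (shiftS 2 (mulS (dil (Re (k ∸ 1 ∸ j))) (F (k ∸ j)))))
          (prodOver (Data.List.map (λ t → (k ∸ j) N.+ t) (upTo (suc j)))
                    (λ i → atNegSq (R i))))

-- Under the standard bijection between binary trees and 132-avoiding permutations,
-- inverting a permutation is a tree operation, inversions and the longest increasing
-- subsequence become tree statistics, and a self-inverse tree is either node a leaf
-- with a self-inverse, or a bracket a ⋯ (inverse a) around a smaller self-inverse tree.
-- Trees whose increasing subsequences are shorter than k are counted by R_k, since
-- C_{k+1} = 1 + x C_k C_{k+1}. Splitting self-inverse trees by the parity of their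
-- inversions into E_k and O_k, the series T = E + O and P = E - O satisfy
-- T_{k+1} = R_{k+1}(x²) (1 + x T_k) and P_{k+1} = R_{k+1}(-x²) (1 + x P_k).
-- Unrolling gives P_k = Σ_j x^j Π_{i=k-j}^{k} R_i(-x²) and T_m = F_m, and
-- T_k - P_k unrolls to Σ_j x^{j+2} (R_{k-1-j}(x²) + R_{k-1-j}(-x²)) T_{k-j} Π_{i=k-j}^{k} R_i(-x²),
-- so E = (T + P)/2 is the stated sum.

module Submission where

open import Defs
open import Data.Nat using (ℕ; _≤_)
open import Relation.Binary.PropositionalEquality using (_≡_)


module Parity where

  open import Defs using (isEven; _==_)
  open import Data.Nat using (ℕ; zero; suc; _+_; _*_; _%_; _≡ᵇ_)
  import Data.Nat.Properties as ℕ
  open import Data.Nat.DivMod using ([m+n]%n≡m%n)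
  open import Data.Nat.Tactic.RingSolver using (solve-∀)
  open import Data.Bool using (Bool; true; false; not)
  import Data.Bool.Properties as Bool
  open import Relation.Binary.PropositionalEquality

  isEven-suc : ∀ n → isEven (suc n) ≡ not (isEven n)
  isEven-suc zero = refl
  isEven-suc (suc n) = begin
    isEven (suc (suc n))  ≡⟨ cong (_≡ᵇ 0) (trans (cong (_% 2) (ℕ.+-comm 2 n)) ([m+n]%n≡m%n n 2)) ⟩
    isEven n              ≡⟨ sym (Bool.not-involutive (isEven n)) ⟩
    not (not (isEven n))  ≡⟨ cong not (sym (isEven-suc n)) ⟩
    not (isEven (suc n))  ∎
    where open ≡-Reasoning

  ==-true : ∀ x → (x == true) ≡ x
  ==-true true = refl
  ==-true false = refl

  ==-refl : ∀ x → (x == x) ≡ true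
  ==-refl true = refl
  ==-refl false = refl

  isEven-+ : ∀ m n → isEven (m + n) ≡ (isEven m == isEven n)
  isEven-+ zero n = refl
  isEven-+ (suc m) n = begin
    isEven (suc (m + n))            ≡⟨ isEven-suc (m + n) ⟩
    not (isEven (m + n))            ≡⟨ cong not (isEven-+ m n) ⟩
    not (isEven m == isEven n)      ≡⟨ not-== (isEven m) (isEven n) ⟩
    (not (isEven m) == isEven n)    ≡⟨ cong (_== isEven n) (sym (isEven-suc m)) ⟩
    (isEven (suc m) == isEven n)    ∎
    where
    open ≡-Reasoning
    not-== : ∀ x y → not (x == y) ≡ (not x == y)
    not-== true y = refl
    not-== false y = Bool.not-involutive y

  isEven-double : ∀ m → isEven (m + m) ≡ true
  isEven-double m = trans (isEven-+ m m) (==-refl (isEven m))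

  isEven-square : ∀ m → isEven (m * m) ≡ isEven m
  isEven-square zero = refl
  isEven-square (suc m) = begin
    isEven (suc m * suc m)                    ≡⟨ cong isEven (expand m) ⟩
    isEven (suc (m * m + (m + m)))            ≡⟨ isEven-suc (m * m + (m + m)) ⟩
    not (isEven (m * m + (m + m)))            ≡⟨ cong not (isEven-+ (m * m) (m + m)) ⟩
    not (isEven (m * m) == isEven (m + m))    ≡⟨ cong (λ b → not (isEven (m * m) == b)) (isEven-double m) ⟩
    not (isEven (m * m) == true)              ≡⟨ cong not (trans (==-true (isEven (m * m))) (isEven-square m)) ⟩
    not (isEven m)                            ≡⟨ sym (isEven-suc m) ⟩
    isEven (suc m)                            ∎
    where
    open ≡-Reasoning
    expand : ∀ m → suc m * suc m ≡ suc (m * m + (m + m))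
    expand = solve-∀


module PowerSeries where

  open import Defs
  open Parity using (isEven-suc)
  open import Data.Nat using (ℕ; zero; suc; _∸_)
  open import Data.Integer as ℤ using (ℤ; +_; -[1+_]; -_; _+_; _*_)
  import Data.Integer.Properties as ℤ
  open import Data.Integer.Tactic.RingSolver using (solve-∀)
  open import Data.Bool using (true; false; if_then_else_)
  open import Data.List using (List; []; _∷_; _++_; _∷ʳ_; map; upTo; zipWith)
  open import Data.List.Membership.Propositional using (_∈_)
  open import Data.List.Relation.Unary.Any using (here; there)
  import Data.List.Properties as List
  import Data.Vec as Vec
  open import Data.Product using (_×_; _,_; proj₁; proj₂)
  open import Data.Maybe using (Maybe; just; nothing)
  open import Function using (_∘_; id)
  open import Relation.Nullary using (yes; no)
  open import Relation.Binary.PropositionalEquality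
  open import Relation.Binary.Structures using (IsEquivalence)
  open import Relation.Binary.Bundles using (Setoid)
  open import Algebra.Bundles using (CommutativeRing; RawRing)
  open import Algebra.Morphism.Structures using (IsRingHomomorphism)
  open import Algebra.Structures using (IsCommutativeRing)
  open import Algebra.Solver.Ring.AlmostCommutativeRing
    using (AlmostCommutativeRing; fromCommutativeRing; _-Raw-AlmostCommutative⟶_)

  -- Coefficientwise equality, wrapped in a record so that both series can be inferred from it.
  infix 4 _≈_
  record _≈_ (f g : Series) : Set where
    constructor coeffwise
    field coeff : ∀ n → f n ≡ g n
  open _≈_ public

  ≈-refl : ∀ {f} → f ≈ f
  ≈-refl = coeffwise λ _ → refl

  ≈-sym : ∀ {f g} → f ≈ g → g ≈ f
  ≈-sym p = coeffwise λ n → sym (coeff p n)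

  ≈-trans : ∀ {f g h} → f ≈ g → g ≈ h → f ≈ h
  ≈-trans p q = coeffwise λ n → trans (coeff p n) (coeff q n)

  ≈-isEquivalence : IsEquivalence _≈_
  ≈-isEquivalence = record { refl = ≈-refl ; sym = ≈-sym ; trans = ≈-trans }

  ≈-setoid : Setoid _ _
  ≈-setoid = record { isEquivalence = ≈-isEquivalence }

  infixl 6 _⊕_
  infixl 7 _⊗_
  infix 8 ⊖_

  _⊕_ : Series → Series → Series
  _⊕_ = addS

  _⊗_ : Series → Series → Series
  _⊗_ = mulS

  ⊖_ : Series → Series
  (⊖ f) n = - f n

  _·_ : ℤ → Series → Series
  (c · f) n = c * f n

  ⊕-cong : ∀ {f f' g g'} → f ≈ f' → g ≈ g' → f ⊕ g ≈ f' ⊕ g'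
  ⊕-cong p q = coeffwise λ n → cong₂ _+_ (coeff p n) (coeff q n)

  ⊕-congˡ : ∀ f {g g'} → g ≈ g' → f ⊕ g ≈ f ⊕ g'
  ⊕-congˡ f = ⊕-cong (≈-refl {f})

  ⊖-cong : ∀ {f f'} → f ≈ f' → ⊖ f ≈ ⊖ f'
  ⊖-cong p = coeffwise λ n → cong -_ (coeff p n)

  tail : Series → Series
  tail f = f ∘ suc

  ⊗-suc : ∀ f g n → (f ⊗ g) (suc n) ≡ f 0 * g (suc n) + (tail f ⊗ g) n
  ⊗-suc f g n = cong (λ l → f 0 * g (suc n) + sumℤ l)
    (trans (List.map-applyUpTo suc (λ i → f i * g (suc n ∸ i)) (suc n))
           (sym (List.map-applyUpTo id (λ i → f (suc i) * g (n ∸ i)) (suc n))))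

  ⊗-zero : ∀ f g → (f ⊗ g) 0 ≡ f 0 * g 0
  ⊗-zero f g = ℤ.+-identityʳ (f 0 * g 0)

  ⊗-tail : ∀ f g → tail (f ⊗ g) ≈ f 0 · tail g ⊕ tail f ⊗ g
  ⊗-tail f g = coeffwise (⊗-suc f g)

  ⊗-congʳ : ∀ {f f'} g → f ≈ f' → f ⊗ g ≈ f' ⊗ g
  ⊗-congʳ g p = coeffwise (go p)
    where
    go : ∀ {f f'} → f ≈ f' → ∀ n → (f ⊗ g) n ≡ (f' ⊗ g) n
    go p zero = cong (λ a → a * g 0 + + 0) (coeff p 0)
    go {f} {f'} p (suc n) = begin
      (f ⊗ g) (suc n)                  ≡⟨ ⊗-suc f g n ⟩
      f 0 * g (suc n) + (tail f ⊗ g) n   ≡⟨ cong₂ (λ a b → a * g (suc n) + b) (coeff p 0) (go (coeffwise (coeff p ∘ suc)) n) ⟩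
      f' 0 * g (suc n) + (tail f' ⊗ g) n ≡⟨ sym (⊗-suc f' g n) ⟩
      (f' ⊗ g) (suc n)                 ∎
      where open ≡-Reasoning

  ⊗-zeroˡ : ∀ g → zeroS ⊗ g ≈ zeroS
  ⊗-zeroˡ g = coeffwise go
    where
    go : ∀ n → (zeroS ⊗ g) n ≡ + 0
    go zero = refl
    go (suc n) = trans (⊗-suc zeroS g n) (cong₂ _+_ (ℤ.*-zeroˡ (g (suc n))) (go n))

  ⊗-identityˡ : ∀ g → oneS ⊗ g ≈ g
  ⊗-identityˡ g = coeffwise go
    where
    go : ∀ n → (oneS ⊗ g) n ≡ g n
    go zero = trans (⊗-zero oneS g) (ℤ.*-identityˡ (g 0))
    go (suc n) = begin
      (oneS ⊗ g) (suc n)                 ≡⟨ ⊗-suc oneS g n ⟩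
      + 1 * g (suc n) + (zeroS ⊗ g) n    ≡⟨ cong₂ _+_ (ℤ.*-identityˡ (g (suc n))) (coeff (⊗-zeroˡ g) n) ⟩
      g (suc n) + + 0                    ≡⟨ ℤ.+-identityʳ (g (suc n)) ⟩
      g (suc n)                          ∎
      where open ≡-Reasoning

  -- Commutativity at n+1 needs it at n-1 for the tails of both factors, hence the pair.
  ⊗-comm : ∀ f g → f ⊗ g ≈ g ⊗ f
  ⊗-comm f g = coeffwise λ n → proj₁ (go n f g)
    where
    swap-heads : ∀ a b c d e → a * b + (c * d + e) ≡ c * d + (a * b + e)
    swap-heads = solve-∀
    go : ∀ n f g → (f ⊗ g) n ≡ (g ⊗ f) n × (f ⊗ g) (suc n) ≡ (g ⊗ f) (suc n)
    go zero f g = step0 , step1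
      where
      step0 : (f ⊗ g) 0 ≡ (g ⊗ f) 0
      step0 = cong (_+ + 0) (ℤ.*-comm (f 0) (g 0))
      step1 : (f ⊗ g) 1 ≡ (g ⊗ f) 1
      step1 = begin
        (f ⊗ g) 1                      ≡⟨ ⊗-suc f g 0 ⟩
        f 0 * g 1 + (f 1 * g 0 + + 0)  ≡⟨ cong₂ (λ a b → a + (b + + 0)) (ℤ.*-comm (f 0) (g 1)) (ℤ.*-comm (f 1) (g 0)) ⟩
        g 1 * f 0 + (g 0 * f 1 + + 0)  ≡⟨ swap-heads (g 1) (f 0) (g 0) (f 1) (+ 0) ⟩
        g 0 * f 1 + (g 1 * f 0 + + 0)  ≡⟨ sym (⊗-suc g f 0) ⟩
        (g ⊗ f) 1                      ∎
        where open ≡-Reasoning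
    go (suc n) f g = proj₂ (go n f g) , (begin
      (f ⊗ g) (suc (suc n))                                    ≡⟨ ⊗-suc f g (suc n) ⟩
      f 0 * g (n+2) + (tail f ⊗ g) (suc n)                      ≡⟨ cong (λ z → f 0 * g (n+2) + z) (proj₂ (go n (tail f) g)) ⟩
      f 0 * g (n+2) + (g ⊗ tail f) (suc n)                      ≡⟨ cong (λ z → f 0 * g (n+2) + z) (⊗-suc g (tail f) n) ⟩
      f 0 * g (n+2) + (g 0 * f (n+2) + (tail g ⊗ tail f) n)     ≡⟨ cong (λ z → f 0 * g (n+2) + (g 0 * f (n+2) + z)) (proj₁ (go n (tail g) (tail f))) ⟩
      f 0 * g (n+2) + (g 0 * f (n+2) + (tail f ⊗ tail g) n)     ≡⟨ swap-heads (f 0) (g (n+2)) (g 0) (f (n+2)) _ ⟩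
      g 0 * f (n+2) + (f 0 * g (n+2) + (tail f ⊗ tail g) n)     ≡⟨ cong (λ z → g 0 * f (n+2) + z) (sym (⊗-suc f (tail g) n)) ⟩
      g 0 * f (n+2) + (f ⊗ tail g) (suc n)                      ≡⟨ cong (λ z → g 0 * f (n+2) + z) (sym (proj₂ (go n (tail g) f))) ⟩
      g 0 * f (n+2) + (tail g ⊗ f) (suc n)                      ≡⟨ sym (⊗-suc g f (suc n)) ⟩
      (g ⊗ f) (suc (suc n))                                    ∎)
      where
      open ≡-Reasoning
      n+2 = suc (suc n)

  ⊗-congˡ : ∀ f {g g'} → g ≈ g' → f ⊗ g ≈ f ⊗ g'
  ⊗-congˡ f {g} {g'} q = ≈-trans (⊗-comm f g) (≈-trans (⊗-congʳ f q) (⊗-comm g' f))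

  ⊗-cong : ∀ {f f' g g'} → f ≈ f' → g ≈ g' → f ⊗ g ≈ f' ⊗ g'
  ⊗-cong {f} {f'} {g} {g'} p q = ≈-trans (⊗-congʳ g p) (⊗-congˡ f' q)

  ⊗-distribʳ : ∀ f g h → (f ⊕ g) ⊗ h ≈ f ⊗ h ⊕ g ⊗ h
  ⊗-distribʳ f g h = coeffwise (go f g)
    where
    regroup : ∀ a b c d e → (a + b) * c + (d + e) ≡ (a * c + d) + (b * c + e)
    regroup = solve-∀
    go : ∀ f g n → ((f ⊕ g) ⊗ h) n ≡ (f ⊗ h ⊕ g ⊗ h) n
    go f g zero = regroup (f 0) (g 0) (h 0) (+ 0) (+ 0)
    go f g (suc n) = begin
      ((f ⊕ g) ⊗ h) (suc n)                                  ≡⟨ ⊗-suc (f ⊕ g) h n ⟩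
      (f 0 + g 0) * h (suc n) + ((tail f ⊕ tail g) ⊗ h) n     ≡⟨ cong (λ z → (f 0 + g 0) * h (suc n) + z) (go (tail f) (tail g) n) ⟩
      (f 0 + g 0) * h (suc n) + ((tail f ⊗ h) n + (tail g ⊗ h) n) ≡⟨ regroup (f 0) (g 0) (h (suc n)) _ _ ⟩
      (f 0 * h (suc n) + (tail f ⊗ h) n) + (g 0 * h (suc n) + (tail g ⊗ h) n) ≡⟨ sym (cong₂ _+_ (⊗-suc f h n) (⊗-suc g h n)) ⟩
      (f ⊗ h ⊕ g ⊗ h) (suc n)                                ∎
      where open ≡-Reasoning

  ⊗-distribˡ : ∀ f g h → f ⊗ (g ⊕ h) ≈ f ⊗ g ⊕ f ⊗ h
  ⊗-distribˡ f g h =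
    ≈-trans (⊗-comm f (g ⊕ h)) (≈-trans (⊗-distribʳ g h f) (⊕-cong (⊗-comm g f) (⊗-comm h f)))

  ⊗-scaleˡ : ∀ c f g → (c · f) ⊗ g ≈ c · (f ⊗ g)
  ⊗-scaleˡ c f g = coeffwise (go f)
    where
    factor : ∀ c a b d → (c * a) * b + c * d ≡ c * (a * b + d)
    factor = solve-∀
    factor₀ : ∀ c a b → (c * a) * b + + 0 ≡ c * (a * b + + 0)
    factor₀ = solve-∀
    go : ∀ f n → ((c · f) ⊗ g) n ≡ (c · (f ⊗ g)) n
    go f zero = factor₀ c (f 0) (g 0)
    go f (suc n) = begin
      ((c · f) ⊗ g) (suc n)                     ≡⟨ ⊗-suc (c · f) g n ⟩
      c * f 0 * g (suc n) + ((c · tail f) ⊗ g) n ≡⟨ cong (λ z → c * f 0 * g (suc n) + z) (go (tail f) n) ⟩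
      c * f 0 * g (suc n) + c * (tail f ⊗ g) n  ≡⟨ factor c (f 0) (g (suc n)) _ ⟩
      c * (f 0 * g (suc n) + (tail f ⊗ g) n)    ≡⟨ cong (c *_) (sym (⊗-suc f g n)) ⟩
      (c · (f ⊗ g)) (suc n)                     ∎
      where open ≡-Reasoning

  ⊗-assoc : ∀ f g h → (f ⊗ g) ⊗ h ≈ f ⊗ (g ⊗ h)
  ⊗-assoc f g h = coeffwise (go f)
    where
    regroup₀ : ∀ a b c → (a * b + + 0) * c + + 0 ≡ a * (b * c + + 0) + + 0
    regroup₀ = solve-∀
    regroup : ∀ a b c d e → (a * b + + 0) * c + (a * d + e) ≡ a * (b * c + d) + e
    regroup = solve-∀
    go : ∀ f n → ((f ⊗ g) ⊗ h) n ≡ (f ⊗ (g ⊗ h)) n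
    go f zero = regroup₀ (f 0) (g 0) (h 0)
    go f (suc n) = begin
      ((f ⊗ g) ⊗ h) (suc n)                                        ≡⟨ ⊗-suc (f ⊗ g) h n ⟩
      (f ⊗ g) 0 * h (suc n) + (tail (f ⊗ g) ⊗ h) n                   ≡⟨ cong (λ z → (f ⊗ g) 0 * h (suc n) + z) tail-step ⟩
      (f ⊗ g) 0 * h (suc n) + (f 0 * (tail g ⊗ h) n + (f' ⊗ (g ⊗ h)) n) ≡⟨ regroup (f 0) (g 0) (h (suc n)) _ _ ⟩
      f 0 * (g 0 * h (suc n) + (tail g ⊗ h) n) + (f' ⊗ (g ⊗ h)) n    ≡⟨ cong (λ z → f 0 * z + (f' ⊗ (g ⊗ h)) n) (sym (⊗-suc g h n)) ⟩
      f 0 * (g ⊗ h) (suc n) + (f' ⊗ (g ⊗ h)) n                      ≡⟨ sym (⊗-suc f (g ⊗ h) n) ⟩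
      (f ⊗ (g ⊗ h)) (suc n)                                        ∎
      where
      open ≡-Reasoning
      f' = tail f
      tail-step : (tail (f ⊗ g) ⊗ h) n ≡ f 0 * (tail g ⊗ h) n + (f' ⊗ (g ⊗ h)) n
      tail-step = begin
        (tail (f ⊗ g) ⊗ h) n                       ≡⟨ coeff (⊗-congʳ h (⊗-tail f g)) n ⟩
        ((f 0 · tail g ⊕ f' ⊗ g) ⊗ h) n            ≡⟨ coeff (⊗-distribʳ (f 0 · tail g) (f' ⊗ g) h) n ⟩
        ((f 0 · tail g) ⊗ h) n + ((f' ⊗ g) ⊗ h) n  ≡⟨ cong₂ _+_ (coeff (⊗-scaleˡ (f 0) (tail g) h) n) (go f' n) ⟩
        f 0 * (tail g ⊗ h) n + (f' ⊗ (g ⊗ h)) n    ∎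

  seriesIsCommutativeRing : IsCommutativeRing _≈_ _⊕_ _⊗_ ⊖_ zeroS oneS
  seriesIsCommutativeRing = record
    { isRing = record
      { +-isAbelianGroup = record
        { isGroup = record
          { isMonoid = record
            { isSemigroup = record
              { isMagma = record { isEquivalence = ≈-isEquivalence ; ∙-cong = ⊕-cong }
              ; assoc = λ f g h → coeffwise λ n → ℤ.+-assoc (f n) (g n) (h n) }
            ; identity = (λ f → coeffwise λ n → ℤ.+-identityˡ (f n))
                       , (λ f → coeffwise λ n → ℤ.+-identityʳ (f n)) }
          ; inverse = (λ f → coeffwise λ n → ℤ.+-inverseˡ (f n))
                    , (λ f → coeffwise λ n → ℤ.+-inverseʳ (f n))
          ; ⁻¹-cong = ⊖-cong }
        ; comm = λ f g → coeffwise λ n → ℤ.+-comm (f n) (g n) }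
      ; *-cong = ⊗-cong
      ; *-assoc = ⊗-assoc
      ; *-identity = ⊗-identityˡ , λ f → ≈-trans (⊗-comm f oneS) (⊗-identityˡ f)
      ; distrib = ⊗-distribˡ , λ h f g → ⊗-distribʳ f g h }
    ; *-comm = ⊗-comm }

  seriesRing : CommutativeRing _ _
  seriesRing = record { isCommutativeRing = seriesIsCommutativeRing }

  ⊗-negˡ : ∀ f g → ⊖ f ⊗ g ≈ ⊖ (f ⊗ g)
  ⊗-negˡ f g = ≈-sym (-‿distribˡ-* f g)
    where open import Algebra.Properties.Ring (CommutativeRing.ring seriesRing) using (-‿distribˡ-*)

  -- Integer constants, with the constant 1 sent to oneS itself so that the solver's
  -- normal forms mention oneS rather than an extensionally equal copy.
  constant : ℤ → Series
  constant (+ 1) = oneS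
  constant c = λ { zero → c ; (suc _) → + 0 }

  constant-zero : ∀ c → constant c 0 ≡ c
  constant-zero (+ 0) = refl
  constant-zero (+ 1) = refl
  constant-zero (+ suc (suc k)) = refl
  constant-zero -[1+ k ] = refl

  constant-suc : ∀ c n → constant c (suc n) ≡ + 0
  constant-suc (+ 0) n = refl
  constant-suc (+ 1) n = refl
  constant-suc (+ suc (suc k)) n = refl
  constant-suc -[1+ k ] n = refl

  constant-+ : ∀ a b → constant (a + b) ≈ constant a ⊕ constant b
  constant-+ a b = coeffwise λ
    { zero → trans (constant-zero (a + b)) (sym (cong₂ _+_ (constant-zero a) (constant-zero b)))
    ; (suc n) → trans (constant-suc (a + b) n) (sym (cong₂ _+_ (constant-suc a n) (constant-suc b n))) }

  constant-neg : ∀ a → constant (- a) ≈ ⊖ constant a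
  constant-neg a = coeffwise λ
    { zero → trans (constant-zero (- a)) (sym (cong -_ (constant-zero a)))
    ; (suc n) → trans (constant-suc (- a) n) (sym (cong -_ (constant-suc a n))) }

  constant-* : ∀ a b → constant (a * b) ≈ constant a ⊗ constant b
  constant-* a b = coeffwise λ
    { zero → trans (constant-zero (a * b))
                   (sym (trans (⊗-zero (constant a) (constant b)) (cong₂ _*_ (constant-zero a) (constant-zero b))))
    ; (suc n) → trans (constant-suc (a * b) n) (sym (begin
        (constant a ⊗ constant b) (suc n)                                  ≡⟨ ⊗-suc (constant a) (constant b) n ⟩
        constant a 0 * constant b (suc n) + (tail (constant a) ⊗ constant b) n
          ≡⟨ cong₂ _+_ (trans (cong (constant a 0 *_) (constant-suc b n)) (ℤ.*-zeroʳ (constant a 0)))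
                       (coeff (⊗-congʳ (constant b) (coeffwise (constant-suc a))) n) ⟩
        + 0 + (zeroS ⊗ constant b) n                                       ≡⟨ ℤ.+-identityˡ _ ⟩
        (zeroS ⊗ constant b) n                                             ≡⟨ coeff (⊗-zeroˡ (constant b)) n ⟩
        + 0                                                                ∎)) }
    where open ≡-Reasoning

  constant-0 : constant (+ 0) ≈ zeroS
  constant-0 = coeffwise λ { zero → refl ; (suc n) → refl }

  constantMorphism : ℤ.+-*-rawRing -Raw-AlmostCommutative⟶ fromCommutativeRing seriesRing
  constantMorphism = record
    { ⟦_⟧ = constant ; +-homo = constant-+ ; *-homo = constant-* ; -‿homo = constant-neg
    ; 0-homo = constant-0 ; 1-homo = ≈-refl }

  constant-≟ : ∀ a b → Maybe (constant a ≈ constant b)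
  constant-≟ a b with a ℤ.≟ b
  ... | yes refl = just ≈-refl
  ... | no _ = nothing

  open import Algebra.Solver.Ring ℤ.+-*-rawRing (fromCommutativeRing seriesRing) constantMorphism constant-≟ public
    using (solve; _:=_; _:+_; _:*_; :-_; _:-_; con)

  ⊗-identityʳ : ∀ f → f ⊗ oneS ≈ f
  ⊗-identityʳ f = ≈-trans (⊗-comm f oneS) (⊗-identityˡ f)

  inv1-suc : ∀ f n → inv1 f (suc n) ≡ - (tail f ⊗ inv1 f) n
  inv1-suc f n = cong (λ l → - sumℤ l)
    (trans (cong (zipWith _*_ (map (f ∘ suc) (upTo (suc n)))) (invVec-toList n))
           (zipWith-diagonal (upTo (suc n))))
    where
    invVec-toList : ∀ n → Vec.toList (invVec f n) ≡ map (λ i → inv1 f (n ∸ i)) (upTo (suc n))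
    invVec-toList zero = refl
    invVec-toList (suc n) = cong (inv1 f (suc n) ∷_)
      (trans (invVec-toList n)
      (trans (List.map-applyUpTo id (λ i → inv1 f (n ∸ i)) (suc n))
             (sym (List.map-applyUpTo suc (λ i → inv1 f (suc n ∸ i)) (suc n)))))
    zipWith-diagonal : ∀ l → zipWith _*_ (map (f ∘ suc) l) (map (λ i → inv1 f (n ∸ i)) l)
                             ≡ map (λ i → f (suc i) * inv1 f (n ∸ i)) l
    zipWith-diagonal [] = refl
    zipWith-diagonal (i ∷ l) = cong (f (suc i) * inv1 f (n ∸ i) ∷_) (zipWith-diagonal l)

  inv1-inverseʳ : ∀ f → f 0 ≡ + 1 → f ⊗ inv1 f ≈ oneS
  inv1-inverseʳ f f0≡1 = coeffwise λ
    { zero → cong (λ z → z * + 1 + + 0) f0≡1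
    ; (suc n) → trans (⊗-suc f (inv1 f) n)
        (trans (cong₂ (λ a b → a * b + (tail f ⊗ inv1 f) n) f0≡1 (inv1-suc f n))
               (cancel ((tail f ⊗ inv1 f) n))) }
    where
    cancel : ∀ m → + 1 * (- m) + m ≡ + 0
    cancel = solve-∀

  inv1-unique : ∀ f g → f 0 ≡ + 1 → g ⊗ f ≈ oneS → g ≈ inv1 f
  inv1-unique f g f0≡1 gf≈1 = begin
    g                    ≈⟨ ≈-sym (⊗-identityʳ g) ⟩
    g ⊗ oneS             ≈⟨ ⊗-congˡ g (≈-sym (inv1-inverseʳ f f0≡1)) ⟩
    g ⊗ (f ⊗ inv1 f)     ≈⟨ ≈-sym (⊗-assoc g f (inv1 f)) ⟩
    (g ⊗ f) ⊗ inv1 f     ≈⟨ ⊗-congʳ (inv1 f) gf≈1 ⟩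
    oneS ⊗ inv1 f        ≈⟨ ⊗-identityˡ (inv1 f) ⟩
    inv1 f               ∎
    where open import Relation.Binary.Reasoning.Setoid ≈-setoid

  X⊗-zero : ∀ g → (X ⊗ g) 0 ≡ + 0
  X⊗-zero g = cong (_+ + 0) (ℤ.*-zeroˡ (g 0))

  tail-X : tail X ≈ oneS
  tail-X = coeffwise λ { zero → refl ; (suc n) → refl }

  X⊗-suc : ∀ g n → (X ⊗ g) (suc n) ≡ g n
  X⊗-suc g n = begin
    (X ⊗ g) (suc n)                ≡⟨ ⊗-suc X g n ⟩
    + 0 * g (suc n) + (tail X ⊗ g) n ≡⟨ cong₂ _+_ (ℤ.*-zeroˡ (g (suc n))) (coeff (⊗-congʳ g tail-X) n) ⟩
    + 0 + (oneS ⊗ g) n             ≡⟨ ℤ.+-identityˡ _ ⟩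
    (oneS ⊗ g) n                   ≡⟨ coeff (⊗-identityˡ g) n ⟩
    g n                            ∎
    where open ≡-Reasoning

  infix 9 X^_
  X^_ : ℕ → Series
  X^ zero = oneS
  X^ suc j = X ⊗ X^ j

  shiftS-suc : ∀ j f → shiftS (suc j) f ≈ X ⊗ shiftS j f
  shiftS-suc j f = coeffwise λ { zero → sym (X⊗-zero (shiftS j f)) ; (suc n) → sym (X⊗-suc (shiftS j f) n) }

  shiftS≈X^⊗ : ∀ j f → shiftS j f ≈ X^ j ⊗ f
  shiftS≈X^⊗ zero f = ≈-sym (⊗-identityˡ f)
  shiftS≈X^⊗ (suc j) f = ≈-trans (shiftS-suc j f) (≈-trans (⊗-congˡ X (shiftS≈X^⊗ j f)) (≈-sym (⊗-assoc X (X^ j) f)))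

  dil-cong : ∀ {f g} → f ≈ g → dil f ≈ dil g
  dil-cong p = coeffwise (go p)
    where
    go : ∀ {f g} → f ≈ g → ∀ n → dil f n ≡ dil g n
    go p zero = coeff p 0
    go p (suc zero) = refl
    go p (suc (suc n)) = go (coeffwise (coeff p ∘ suc)) n

  dil-⊕ : ∀ f g → dil (f ⊕ g) ≈ dil f ⊕ dil g
  dil-⊕ f g = coeffwise (go f g)
    where
    go : ∀ f g n → dil (f ⊕ g) n ≡ (dil f ⊕ dil g) n
    go f g zero = refl
    go f g (suc zero) = refl
    go f g (suc (suc n)) = go (tail f) (tail g) n

  dil-⊖ : ∀ f → dil (⊖ f) ≈ ⊖ dil f
  dil-⊖ f = coeffwise (go f)
    where
    go : ∀ f n → dil (⊖ f) n ≡ (⊖ dil f) n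
    go f zero = refl
    go f (suc zero) = refl
    go f (suc (suc n)) = go (tail f) n

  dil-· : ∀ c f → dil (c · f) ≈ c · dil f
  dil-· c f = coeffwise (go f)
    where
    go : ∀ f n → dil (c · f) n ≡ (c · dil f) n
    go f zero = refl
    go f (suc zero) = sym (ℤ.*-zeroʳ c)
    go f (suc (suc n)) = go (tail f) n

  dil-zeroS : dil zeroS ≈ zeroS
  dil-zeroS = coeffwise go
    where
    go : ∀ n → dil zeroS n ≡ + 0
    go zero = refl
    go (suc zero) = refl
    go (suc (suc n)) = go n

  dil-oneS : dil oneS ≈ oneS
  dil-oneS = coeffwise λ { zero → refl ; (suc zero) → refl ; (suc (suc n)) → coeff dil-zeroS n }

  dil⊗-suc-suc : ∀ f h n → (dil f ⊗ h) (suc (suc n)) ≡ f 0 * h (suc (suc n)) + (dil (tail f) ⊗ h) n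
  dil⊗-suc-suc f h n = begin
    (dil f ⊗ h) (suc (suc n))                                           ≡⟨ ⊗-suc (dil f) h (suc n) ⟩
    f 0 * h (suc (suc n)) + (tail (dil f) ⊗ h) (suc n)                    ≡⟨ cong (λ z → f 0 * h (suc (suc n)) + z) (⊗-suc (tail (dil f)) h n) ⟩
    f 0 * h (suc (suc n)) + (+ 0 * h (suc n) + (dil (tail f) ⊗ h) n)      ≡⟨ cong (λ z → f 0 * h (suc (suc n)) + (z + (dil (tail f) ⊗ h) n)) (ℤ.*-zeroˡ (h (suc n))) ⟩
    f 0 * h (suc (suc n)) + (+ 0 + (dil (tail f) ⊗ h) n)                  ≡⟨ cong (λ z → f 0 * h (suc (suc n)) + z) (ℤ.+-identityˡ _) ⟩
    f 0 * h (suc (suc n)) + (dil (tail f) ⊗ h) n                          ∎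
    where open ≡-Reasoning

  dil-⊗ : ∀ f g → dil (f ⊗ g) ≈ dil f ⊗ dil g
  dil-⊗ f g = coeffwise (go f)
    where
    go : ∀ f n → dil (f ⊗ g) n ≡ (dil f ⊗ dil g) n
    go f zero = refl
    go f (suc zero) = sym (begin
      (dil f ⊗ dil g) 1                        ≡⟨ ⊗-suc (dil f) (dil g) 0 ⟩
      f 0 * + 0 + (+ 0 * g 0 + + 0)            ≡⟨ cong₂ (λ a b → a + (b + + 0)) (ℤ.*-zeroʳ (f 0)) (ℤ.*-zeroˡ (g 0)) ⟩
      + 0                                      ∎)
      where open ≡-Reasoning
    go f (suc (suc n)) = begin
      dil (tail (f ⊗ g)) n                          ≡⟨ coeff (dil-cong (⊗-tail f g)) n ⟩
      dil (f 0 · tail g ⊕ tail f ⊗ g) n             ≡⟨ coeff (dil-⊕ (f 0 · tail g) (tail f ⊗ g)) n ⟩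
      dil (f 0 · tail g) n + dil (tail f ⊗ g) n     ≡⟨ cong₂ _+_ (coeff (dil-· (f 0) (tail g)) n) (go (tail f) n) ⟩
      f 0 * dil g (suc (suc n)) + (dil (tail f) ⊗ dil g) n ≡⟨ sym (dil⊗-suc-suc f (dil g) n) ⟩
      (dil f ⊗ dil g) (suc (suc n))                 ∎
      where open ≡-Reasoning

  dil-X : dil X ≈ X ⊗ X
  dil-X = coeffwise λ
    { zero → refl
    ; (suc zero) → refl
    ; (suc (suc n)) → trans (coeff (≈-trans (dil-cong tail-X) dil-oneS) n)
                            (sym (trans (X⊗-suc X (suc n)) (coeff tail-X n))) }

  negArg-suc : ∀ f n → negArg f (suc n) ≡ - negArg (tail f) n
  negArg-suc f n with isEven n | isEven-suc n
  ... | true  | e = cong (λ b → if b then f (suc n) else - f (suc n)) e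
  ... | false | e = trans (cong (λ b → if b then f (suc n) else - f (suc n)) e) (sym (ℤ.neg-involutive (f (suc n))))

  negArg-cong : ∀ {f g} → f ≈ g → negArg f ≈ negArg g
  negArg-cong p = coeffwise λ n → cong₂ (λ a b → if isEven n then a else - b) (coeff p n) (coeff p n)

  negArg-⊕ : ∀ f g → negArg (f ⊕ g) ≈ negArg f ⊕ negArg g
  negArg-⊕ f g = coeffwise λ n → go n (isEven n)
    where
    go : ∀ n b → (if b then f n + g n else - (f n + g n)) ≡ (if b then f n else - f n) + (if b then g n else - g n)
    go n true = refl
    go n false = ℤ.neg-distrib-+ (f n) (g n)

  negArg-⊖ : ∀ f → negArg (⊖ f) ≈ ⊖ negArg f
  negArg-⊖ f = coeffwise λ n → go n (isEven n)
    where
    go : ∀ n b → (if b then - f n else - - f n) ≡ - (if b then f n else - f n)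
    go n true = refl
    go n false = refl

  negArg-· : ∀ c f → negArg (c · f) ≈ c · negArg f
  negArg-· c f = coeffwise λ n → go n (isEven n)
    where
    go : ∀ n b → (if b then c * f n else - (c * f n)) ≡ c * (if b then f n else - f n)
    go n true = refl
    go n false = ℤ.neg-distribʳ-* c (f n)

  negArg-⊗ : ∀ f g → negArg (f ⊗ g) ≈ negArg f ⊗ negArg g
  negArg-⊗ f g = coeffwise (go f)
    where
    push-neg : ∀ a b m → - (a * b + m) ≡ a * (- b) + (- m)
    push-neg = solve-∀
    go : ∀ f n → negArg (f ⊗ g) n ≡ (negArg f ⊗ negArg g) n
    go f zero = refl
    go f (suc n) = begin
      negArg (f ⊗ g) (suc n)                                      ≡⟨ negArg-suc (f ⊗ g) n ⟩
      - negArg (tail (f ⊗ g)) n                                    ≡⟨ cong -_ (coeff (negArg-cong (⊗-tail f g)) n) ⟩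
      - negArg (f 0 · tail g ⊕ tail f ⊗ g) n                       ≡⟨ cong -_ (coeff (negArg-⊕ (f 0 · tail g) (tail f ⊗ g)) n) ⟩
      - (negArg (f 0 · tail g) n + negArg (tail f ⊗ g) n)          ≡⟨ cong -_ (cong₂ _+_ (coeff (negArg-· (f 0) (tail g)) n) (go (tail f) n)) ⟩
      - (f 0 * negArg (tail g) n + (negArg (tail f) ⊗ negArg g) n) ≡⟨ push-neg (f 0) _ _ ⟩
      f 0 * (- negArg (tail g) n) + - (negArg (tail f) ⊗ negArg g) n
        ≡⟨ cong₂ _+_ (cong (f 0 *_) (sym (negArg-suc g n))) (sym (coeff (⊗-tail-neg) n)) ⟩
      negArg f 0 * negArg g (suc n) + (tail (negArg f) ⊗ negArg g) n ≡⟨ sym (⊗-suc (negArg f) (negArg g) n) ⟩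
      (negArg f ⊗ negArg g) (suc n)                                ∎
      where
      open ≡-Reasoning
      ⊗-tail-neg : tail (negArg f) ⊗ negArg g ≈ ⊖ (negArg (tail f) ⊗ negArg g)
      ⊗-tail-neg = ≈-trans (⊗-congʳ (negArg g) (coeffwise (negArg-suc f)))
                           (⊗-negˡ (negArg (tail f)) (negArg g))

  negArg-zeroS : negArg zeroS ≈ zeroS
  negArg-zeroS = coeffwise λ n → go (isEven n)
    where
    go : ∀ b → (if b then + 0 else - + 0) ≡ + 0
    go true = refl
    go false = refl

  negArg-oneS : negArg oneS ≈ oneS
  negArg-oneS = coeffwise λ
    { zero → refl
    ; (suc n) → trans (negArg-suc oneS n) (cong -_ (coeff (≈-trans (negArg-cong tail-oneS) negArg-zeroS) n)) }
    where
    tail-oneS : tail oneS ≈ zeroS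
    tail-oneS = coeffwise λ _ → refl

  negArg-X : negArg X ≈ ⊖ X
  negArg-X = coeffwise λ
    { zero → refl
    ; (suc n) → trans (negArg-suc X n) (cong -_ (trans (coeff (≈-trans (negArg-cong tail-X) negArg-oneS) n) (sym (coeff tail-X n)))) }

  evenPart-double : ∀ f → evenPart f ⊕ evenPart f ≈ f ⊕ negArg f
  evenPart-double f = coeffwise λ n → go n (isEven n)
    where
    go : ∀ n b → (if b then f n else + 0) + (if b then f n else + 0) ≡ f n + (if b then f n else - f n)
    go n true = refl
    go n false = sym (ℤ.+-inverseʳ (f n))

  sumOver-cong : ∀ (l : List ℕ) {t t' : ℕ → Series} → (∀ {j} → j ∈ l → t j ≈ t' j) → sumOver l t ≈ sumOver l t'
  sumOver-cong [] p = ≈-refl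
  sumOver-cong (j ∷ l) p = ⊕-cong (p (here refl)) (sumOver-cong l (p ∘ there))

  sumOver-++ : ∀ (l l' : List ℕ) (t : ℕ → Series) → sumOver (l ++ l') t ≈ sumOver l t ⊕ sumOver l' t
  sumOver-++ [] l' t = coeffwise λ n → sym (ℤ.+-identityˡ _)
  sumOver-++ (j ∷ l) l' t = coeffwise λ n →
    trans (cong (_+_ (t j n)) (coeff (sumOver-++ l l' t) n)) (sym (ℤ.+-assoc (t j n) _ _))

  sumOver-⊕ : ∀ (l : List ℕ) (t t' : ℕ → Series) → sumOver l (λ j → t j ⊕ t' j) ≈ sumOver l t ⊕ sumOver l t'
  sumOver-⊕ [] t t' = coeffwise λ _ → refl
  sumOver-⊕ (j ∷ l) t t' = ≈-trans (⊕-congˡ (t j ⊕ t' j) (sumOver-⊕ l t t')) (interchange (t j) (t' j) (sumOver l t) (sumOver l t'))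
    where
    interchange : ∀ a b c d → (a ⊕ b) ⊕ (c ⊕ d) ≈ (a ⊕ c) ⊕ (b ⊕ d)
    interchange = solve 4 (λ a b c d → (a :+ b) :+ (c :+ d) := (a :+ c) :+ (b :+ d)) ≈-refl

  sumOver-⊗ˡ : ∀ (l : List ℕ) (f : Series) (t : ℕ → Series) → sumOver l (λ j → f ⊗ t j) ≈ f ⊗ sumOver l t
  sumOver-⊗ˡ [] f t = ≈-sym (≈-trans (⊗-comm f zeroS) (⊗-zeroˡ f))
  sumOver-⊗ˡ (j ∷ l) f t = ≈-trans (⊕-congˡ (f ⊗ t j) (sumOver-⊗ˡ l f t)) (≈-sym (⊗-distribˡ f (t j) (sumOver l t)))

  sumOver-upTo-suc : ∀ n (t : ℕ → Series) → sumOver (upTo (suc n)) t ≈ t 0 ⊕ sumOver (upTo n) (t ∘ suc)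
  sumOver-upTo-suc n t = coeffwise λ m →
    trans (cong (λ l → (t 0 ⊕ sumOver l t) m) (sym (List.map-upTo suc n)))
          (cong (λ s → t 0 m + s m) (sumOver-map (upTo n)))
    where
    sumOver-map : ∀ l → sumOver (map suc l) t ≡ sumOver l (t ∘ suc)
    sumOver-map [] = refl
    sumOver-map (j ∷ l) = cong (t (suc j) ⊕_) (sumOver-map l)

  prodOver-∷ʳ : ∀ (l : List ℕ) j (t : ℕ → Series) → prodOver (l ∷ʳ j) t ≈ prodOver l t ⊗ t j
  prodOver-∷ʳ [] j t = ≈-trans (⊗-identityʳ (t j)) (≈-sym (⊗-identityˡ (t j)))
  prodOver-∷ʳ (i ∷ l) j t = ≈-trans (⊗-congˡ (t i) (prodOver-∷ʳ l j t)) (≈-sym (⊗-assoc (t i) (prodOver l t) (t j)))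

  seriesRawRing : RawRing _ _
  seriesRawRing = CommutativeRing.rawRing seriesRing

  dil-isRingHomomorphism : IsRingHomomorphism seriesRawRing seriesRawRing dil
  dil-isRingHomomorphism = record
    { isSemiringHomomorphism = record
      { isNearSemiringHomomorphism = record
        { +-isMonoidHomomorphism = record
          { isMagmaHomomorphism = record { isRelHomomorphism = record { cong = dil-cong } ; homo = dil-⊕ }
          ; ε-homo = dil-zeroS }
        ; *-homo = dil-⊗ }
      ; 1#-homo = dil-oneS }
    ; -‿homo = dil-⊖ }

  negArg-isRingHomomorphism : IsRingHomomorphism seriesRawRing seriesRawRing negArg
  negArg-isRingHomomorphism = record
    { isSemiringHomomorphism = record
      { isNearSemiringHomomorphism = record
        { +-isMonoidHomomorphism = record
          { isMagmaHomomorphism = record { isRelHomomorphism = record { cong = negArg-cong } ; homo = negArg-⊕ }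
          ; ε-homo = negArg-zeroS }
        ; *-homo = negArg-⊗ }
      ; 1#-homo = negArg-oneS }
    ; -‿homo = negArg-⊖ }

  atNegSq-isRingHomomorphism : IsRingHomomorphism seriesRawRing seriesRawRing atNegSq
  atNegSq-isRingHomomorphism = Composition.isRingHomomorphism ≈-trans negArg-isRingHomomorphism dil-isRingHomomorphism
    where import Algebra.Morphism.Construct.Composition as Composition

  atNegSq-X : atNegSq X ≈ ⊖ (X ⊗ X)
  atNegSq-X = ≈-trans (dil-cong negArg-X) (≈-trans (dil-⊖ X) (⊖-cong dil-X))


module BinaryTrees where

  open import Data.Nat using (ℕ; zero; suc; _+_; _*_; _<_; s≤s)
  import Data.Nat.Properties as ℕ
  open import Data.Nat.Tactic.RingSolver using (solve-∀)
  open import Data.Bool using (Bool; true; false; _∧_)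
  import Data.Bool.Properties as Bool
  open import Data.List using (List; []; _∷_; map; _++_; length)
  import Data.List.Properties as List
  open import Data.List.Membership.Propositional using (_∈_)
  open import Data.List.Membership.Propositional.Properties using (∈-++⁻; ∈-map⁻)
  open import Data.List.Relation.Unary.Any using (here; there)
  open import Data.Product using (_,_)
  open import Data.Sum using (inj₁; inj₂)
  open import Relation.Binary.PropositionalEquality

  data Tree : Set where
    leaf : Tree
    node : Tree → Tree → Tree

  size : Tree → ℕ
  size leaf = 0
  size (node a b) = suc (size a + size b)

  -- The standard bijection from binary trees to 132-avoiding permutations.
  word : Tree → List ℕ
  word leaf = []
  word (node a b) = map (size b +_) (word a) ++ (size a + size b) ∷ word b

  skewSum : Tree → Tree → Tree
  skewSum leaf t = t
  skewSum (node a b) t = node a (skewSum b t)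

  inverse : Tree → Tree
  inverse leaf = leaf
  inverse (node a b) = skewSum (inverse b) (node (inverse a) leaf)

  -- Whether every increasing subsequence of the word is shorter than k.
  lisBelow : ℕ → Tree → Bool
  lisBelow zero t = false
  lisBelow (suc k) leaf = true
  lisBelow (suc k) (node a b) = lisBelow k a ∧ lisBelow (suc k) b

  inversionsᵗ : Tree → ℕ
  inversionsᵗ leaf = 0
  inversionsᵗ (node a b) = inversionsᵗ a + inversionsᵗ b + suc (size a) * size b

  size-skewSum : ∀ s t → size (skewSum s t) ≡ size s + size t
  size-skewSum leaf t = refl
  size-skewSum (node a b) t =
    cong suc (trans (cong (size a +_) (size-skewSum b t)) (sym (ℕ.+-assoc (size a) (size b) (size t))))

  skewSum-assoc : ∀ r s t → skewSum (skewSum r s) t ≡ skewSum r (skewSum s t)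
  skewSum-assoc leaf s t = refl
  skewSum-assoc (node a b) s t = cong (node a) (skewSum-assoc b s t)

  skewSum-identityʳ : ∀ t → skewSum t leaf ≡ t
  skewSum-identityʳ leaf = refl
  skewSum-identityʳ (node a b) = cong (node a) (skewSum-identityʳ b)

  size-inverse : ∀ t → size (inverse t) ≡ size t
  size-inverse leaf = refl
  size-inverse (node a b) = begin
    size (skewSum (inverse b) (node (inverse a) leaf)) ≡⟨ size-skewSum (inverse b) (node (inverse a) leaf) ⟩
    size (inverse b) + suc (size (inverse a) + 0)     ≡⟨ cong₂ (λ x y → x + suc (y + 0)) (size-inverse b) (size-inverse a) ⟩
    size b + suc (size a + 0)                         ≡⟨ rearrange (size a) (size b) ⟩
    suc (size a + size b)                             ∎
    where
    open ≡-Reasoning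
    rearrange : ∀ x y → y + suc (x + 0) ≡ suc (x + y)
    rearrange = solve-∀

  inverse-skewSum : ∀ s t → inverse (skewSum s t) ≡ skewSum (inverse t) (inverse s)
  inverse-skewSum leaf t = sym (skewSum-identityʳ (inverse t))
  inverse-skewSum (node a b) t =
    trans (cong (λ z → skewSum z (node (inverse a) leaf)) (inverse-skewSum b t))
          (skewSum-assoc (inverse t) (inverse b) (node (inverse a) leaf))

  inverse-involutive : ∀ t → inverse (inverse t) ≡ t
  inverse-involutive leaf = refl
  inverse-involutive (node a b) =
    trans (inverse-skewSum (inverse b) (node (inverse a) leaf))
          (cong₂ (λ x y → skewSum (node x leaf) y) (inverse-involutive a) (inverse-involutive b))

  lisBelow-skewSum : ∀ k s t → lisBelow k (skewSum s t) ≡ lisBelow k s ∧ lisBelow k t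
  lisBelow-skewSum zero s t = refl
  lisBelow-skewSum (suc k) leaf t = refl
  lisBelow-skewSum (suc k) (node a b) t =
    trans (cong (lisBelow k a ∧_) (lisBelow-skewSum (suc k) b t)) (sym (Bool.∧-assoc (lisBelow k a) _ _))

  lisBelow-inverse : ∀ k t → lisBelow k (inverse t) ≡ lisBelow k t
  lisBelow-inverse zero t = refl
  lisBelow-inverse (suc k) leaf = refl
  lisBelow-inverse (suc k) (node a b) = begin
    lisBelow (suc k) (skewSum (inverse b) (node (inverse a) leaf))   ≡⟨ lisBelow-skewSum (suc k) (inverse b) _ ⟩
    lisBelow (suc k) (inverse b) ∧ (lisBelow k (inverse a) ∧ true)   ≡⟨ cong₂ (λ x y → x ∧ (y ∧ true)) (lisBelow-inverse (suc k) b) (lisBelow-inverse k a) ⟩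
    lisBelow (suc k) b ∧ (lisBelow k a ∧ true)                       ≡⟨ cong (lisBelow (suc k) b ∧_) (Bool.∧-identityʳ (lisBelow k a)) ⟩
    lisBelow (suc k) b ∧ lisBelow k a                                ≡⟨ Bool.∧-comm (lisBelow (suc k) b) (lisBelow k a) ⟩
    lisBelow k a ∧ lisBelow (suc k) b                                ∎
    where open ≡-Reasoning

  inversionsᵗ-skewSum : ∀ s t → inversionsᵗ (skewSum s t) ≡ inversionsᵗ s + inversionsᵗ t + size s * size t
  inversionsᵗ-skewSum leaf t = sym (ℕ.+-identityʳ (inversionsᵗ t))
  inversionsᵗ-skewSum (node a b) t =
    trans (cong₂ (λ x y → inversionsᵗ a + x + suc (size a) * y) (inversionsᵗ-skewSum b t) (size-skewSum b t))
          (rearrange (inversionsᵗ a) (inversionsᵗ b) (inversionsᵗ t) (size a) (size b) (size t))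
    where
    rearrange : ∀ A B T sa sb st → A + (B + T + sb * st) + (1 + sa) * (sb + st) ≡ A + B + (1 + sa) * sb + T + (1 + (sa + sb)) * st
    rearrange = solve-∀

  inversionsᵗ-inverse : ∀ t → inversionsᵗ (inverse t) ≡ inversionsᵗ t
  inversionsᵗ-inverse leaf = refl
  inversionsᵗ-inverse (node a b) = begin
    inversionsᵗ (skewSum (inverse b) (node (inverse a) leaf))
      ≡⟨ inversionsᵗ-skewSum (inverse b) (node (inverse a) leaf) ⟩
    inversionsᵗ (inverse b) + (inversionsᵗ (inverse a) + 0 + suc (size (inverse a)) * 0) + size (inverse b) * suc (size (inverse a) + 0)
      ≡⟨ cong₂ (λ x y → x + (y + 0 + suc (size (inverse a)) * 0) + size (inverse b) * suc (size (inverse a) + 0)) (inversionsᵗ-inverse b) (inversionsᵗ-inverse a) ⟩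
    inversionsᵗ b + (inversionsᵗ a + 0 + suc (size (inverse a)) * 0) + size (inverse b) * suc (size (inverse a) + 0)
      ≡⟨ cong₂ (λ x y → inversionsᵗ b + (inversionsᵗ a + 0 + suc x * 0) + y * suc (x + 0)) (size-inverse a) (size-inverse b) ⟩
    inversionsᵗ b + (inversionsᵗ a + 0 + suc (size a) * 0) + size b * suc (size a + 0)
      ≡⟨ rearrange (inversionsᵗ a) (inversionsᵗ b) (size a) (size b) ⟩
    inversionsᵗ a + inversionsᵗ b + suc (size a) * size b ∎
    where
    open ≡-Reasoning
    rearrange : ∀ A B sa sb → B + (A + 0 + (1 + sa) * 0) + sb * (1 + (sa + 0)) ≡ A + B + (1 + sa) * sb
    rearrange = solve-∀

  length-word : ∀ t → length (word t) ≡ size t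
  length-word leaf = refl
  length-word (node a b) = begin
    length (map (size b +_) (word a) ++ (size a + size b) ∷ word b) ≡⟨ List.length-++ (map (size b +_) (word a)) ⟩
    length (map (size b +_) (word a)) + suc (length (word b))       ≡⟨ cong₂ (λ x y → x + suc y) (trans (List.length-map (size b +_) (word a)) (length-word a)) (length-word b) ⟩
    size a + suc (size b)                                           ≡⟨ ℕ.+-suc (size a) (size b) ⟩
    suc (size a + size b)                                           ∎
    where open ≡-Reasoning

  word-skewSum : ∀ s t → word (skewSum s t) ≡ map (size t +_) (word s) ++ word t
  word-skewSum leaf t = refl
  word-skewSum (node a b) t = begin
    map (size (skewSum b t) +_) (word a) ++ (size a + size (skewSum b t)) ∷ word (skewSum b t)
      ≡⟨ cong₂ (λ x y → map (x +_) (word a) ++ (size a + x) ∷ y) (size-skewSum b t) (word-skewSum b t) ⟩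
    map (size b + size t +_) (word a) ++ (size a + (size b + size t)) ∷ (map (size t +_) (word b) ++ word t)
      ≡⟨ cong₂ (λ x y → x ++ y ∷ (map (size t +_) (word b) ++ word t)) shift-left shift-max ⟩
    map (size t +_) (map (size b +_) (word a)) ++ (size t + (size a + size b)) ∷ (map (size t +_) (word b) ++ word t)
      ≡⟨ sym (List.++-assoc (map (size t +_) (map (size b +_) (word a))) ((size t + (size a + size b)) ∷ map (size t +_) (word b)) (word t)) ⟩
    (map (size t +_) (map (size b +_) (word a)) ++ map (size t +_) ((size a + size b) ∷ word b)) ++ word t
      ≡⟨ cong (_++ word t) (sym (List.map-++ (size t +_) (map (size b +_) (word a)) ((size a + size b) ∷ word b))) ⟩
    map (size t +_) (word (node a b)) ++ word t ∎
    where
    open ≡-Reasoning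
    shift-left : map (size b + size t +_) (word a) ≡ map (size t +_) (map (size b +_) (word a))
    shift-left = trans (List.map-cong (λ x → trans (cong (_+ x) (ℕ.+-comm (size b) (size t))) (ℕ.+-assoc (size t) (size b) x)) (word a))
                       (List.map-∘ (word a))
    shift-max : size a + (size b + size t) ≡ size t + (size a + size b)
    shift-max = trans (sym (ℕ.+-assoc (size a) (size b) (size t))) (ℕ.+-comm (size a + size b) (size t))

  word-bound : ∀ t {x} → x ∈ word t → x < size t
  word-bound (node a b) {x} x∈ with ∈-++⁻ (map (size b +_) (word a)) x∈
  ... | inj₁ x∈left with ∈-map⁻ (size b +_) x∈left
  ...   | y , y∈ , refl = s≤s (ℕ.≤-trans (ℕ.+-monoʳ-≤ (size b) (ℕ.<⇒≤ (word-bound a y∈))) (ℕ.≤-reflexive (ℕ.+-comm (size b) (size a))))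
  word-bound (node a b) x∈ | inj₂ (here refl) = ℕ.≤-refl
  word-bound (node a b) x∈ | inj₂ (there x∈right) = s≤s (ℕ.≤-trans (ℕ.<⇒≤ (word-bound b x∈right)) (ℕ.m≤n+m (size b) (size a)))


module Counting where

  open import Defs using (countᵇ)
  open import Data.Nat using (ℕ; suc; _+_; _*_; _≤_; z≤n; s≤s)
  import Data.Nat.Properties as ℕ
  open import Data.Bool using (Bool; true; false; _∧_; if_then_else_; T?)
  open import Data.List using (List; []; _∷_; map; _++_; length; filterᵇ; concatMap; cartesianProductWith)
  open import Data.Nat.ListAction using (sum)
  import Data.List.Properties as List
  open import Data.List.Membership.Propositional using (_∈_; lose)
  open import Data.List.Membership.Propositional.Properties using (∈-∃++; ∈-map⁺; ∈-map⁻)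
  open import Data.List.Relation.Unary.Any using (here; there)
  open import Data.List.Relation.Unary.All using (All; []; _∷_)
  import Data.List.Relation.Unary.All.Properties as All
  open import Data.List.Relation.Unary.Unique.Propositional using (Unique; []; _∷_)
  import Data.List.Relation.Unary.Unique.Propositional.Properties as Unique
  open import Data.Product using (_×_; _,_; ∃; map₁)
  open import Function using (_∘_; id)
  open import Relation.Binary.PropositionalEquality

  private
    variable
      A B C : Set

  countᵇ-++ : ∀ (p : A → Bool) xs ys → countᵇ p (xs ++ ys) ≡ countᵇ p xs + countᵇ p ys
  countᵇ-++ p [] ys = refl
  countᵇ-++ p (x ∷ xs) ys =
    trans (cong ((if p x then 1 else 0) +_) (countᵇ-++ p xs ys)) (sym (ℕ.+-assoc (if p x then 1 else 0) _ _))

  countᵇ-map : ∀ (p : B → Bool) (f : A → B) xs → countᵇ p (map f xs) ≡ countᵇ (p ∘ f) xs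
  countᵇ-map p f [] = refl
  countᵇ-map p f (x ∷ xs) = cong ((if p (f x) then 1 else 0) +_) (countᵇ-map p f xs)

  countᵇ-concatMap : ∀ (p : B → Bool) (g : A → List B) xs → countᵇ p (concatMap g xs) ≡ sum (map (countᵇ p ∘ g) xs)
  countᵇ-concatMap p g [] = refl
  countᵇ-concatMap p g (x ∷ xs) = trans (countᵇ-++ p (g x) (concatMap g xs)) (cong (countᵇ p (g x) +_) (countᵇ-concatMap p g xs))

  countᵇ-cong : ∀ {p q : A → Bool} xs → (∀ {x} → x ∈ xs → p x ≡ q x) → countᵇ p xs ≡ countᵇ q xs
  countᵇ-cong [] eq = refl
  countᵇ-cong (x ∷ xs) eq = cong₂ (λ b r → (if b then 1 else 0) + r) (eq (here refl)) (countᵇ-cong xs (eq ∘ there))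

  countᵇ-none : ∀ (p : A → Bool) xs → (∀ {x} → x ∈ xs → p x ≡ false) → countᵇ p xs ≡ 0
  countᵇ-none p [] none = refl
  countᵇ-none p (x ∷ xs) none rewrite none (here refl) = countᵇ-none p xs (none ∘ there)

  countᵇ-cartesianProductWith : ∀ (f : A → B → C) {r : C → Bool} {p : A → Bool} {q : B → Bool} xs ys →
    (∀ {x y} → x ∈ xs → y ∈ ys → r (f x y) ≡ p x ∧ q y) →
    countᵇ r (cartesianProductWith f xs ys) ≡ countᵇ p xs * countᵇ q ys
  countᵇ-cartesianProductWith f [] ys split = refl
  countᵇ-cartesianProductWith f {r} {p} {q} (x ∷ xs) ys split = begin
    countᵇ r (map (f x) ys ++ cartesianProductWith f xs ys)
      ≡⟨ countᵇ-++ r (map (f x) ys) (cartesianProductWith f xs ys) ⟩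
    countᵇ r (map (f x) ys) + countᵇ r (cartesianProductWith f xs ys)
      ≡⟨ cong₂ _+_ (trans (countᵇ-map r (f x) ys) (countᵇ-cong ys (split (here refl))))
                   (countᵇ-cartesianProductWith f xs ys (split ∘ there)) ⟩
    countᵇ (λ y → p x ∧ q y) ys + countᵇ p xs * countᵇ q ys
      ≡⟨ row (p x) ⟩
    ((if p x then 1 else 0) + countᵇ p xs) * countᵇ q ys ∎
    where
    open ≡-Reasoning
    row : ∀ b → countᵇ (λ y → b ∧ q y) ys + countᵇ p xs * countᵇ q ys ≡ ((if b then 1 else 0) + countᵇ p xs) * countᵇ q ys
    row true = refl
    row false = cong (_+ countᵇ p xs * countᵇ q ys) (countᵇ-none (λ _ → false) ys (λ _ → refl))

  countᵇ≡length-filterᵇ : ∀ (p : A → Bool) xs → countᵇ p xs ≡ length (filterᵇ p xs)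
  countᵇ≡length-filterᵇ p [] = refl
  countᵇ≡length-filterᵇ p (x ∷ xs) with p x
  ... | true = cong suc (countᵇ≡length-filterᵇ p xs)
  ... | false = countᵇ≡length-filterᵇ p xs

  ∈-filterᵇ⁻ : ∀ (p : A → Bool) {x} xs → x ∈ filterᵇ p xs → x ∈ xs × p x ≡ true
  ∈-filterᵇ⁻ p (y ∷ xs) x∈ with p y in py
  ∈-filterᵇ⁻ p (y ∷ xs) (here refl) | true = here refl , py
  ∈-filterᵇ⁻ p (y ∷ xs) (there x∈) | true = map₁ there (∈-filterᵇ⁻ p xs x∈)
  ∈-filterᵇ⁻ p (y ∷ xs) x∈ | false = map₁ there (∈-filterᵇ⁻ p xs x∈)

  ∈-filterᵇ⁺ : ∀ (p : A → Bool) {x} xs → x ∈ xs → p x ≡ true → x ∈ filterᵇ p xs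
  ∈-filterᵇ⁺ p (y ∷ xs) (here refl) px rewrite px = here refl
  ∈-filterᵇ⁺ p (y ∷ xs) (there x∈) px with p y
  ... | true = there (∈-filterᵇ⁺ p xs x∈ px)
  ... | false = ∈-filterᵇ⁺ p xs x∈ px

  Unique⇒length≤ : ∀ (xs ys : List A) → Unique xs → (∀ {x} → x ∈ xs → x ∈ ys) → length xs ≤ length ys
  Unique⇒length≤ [] ys _ _ = z≤n
  Unique⇒length≤ (x ∷ xs) ys (x∉xs ∷ xs!) xs⊆ys with ∈-∃++ (xs⊆ys (here refl))
  ... | ys₁ , ys₂ , refl = ℕ.≤-trans (s≤s (Unique⇒length≤ xs (ys₁ ++ ys₂) xs! (λ y∈ → drop-x ys₁ (xs⊆ys (there y∈)) (distinct y∈))))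
                                    (ℕ.≤-reflexive length-drop)
    where
    length-drop : suc (length (ys₁ ++ ys₂)) ≡ length (ys₁ ++ x ∷ ys₂)
    length-drop = trans (cong suc (List.length-++ ys₁)) (trans (sym (ℕ.+-suc (length ys₁) (length ys₂))) (sym (List.length-++ ys₁)))
    distinct : ∀ {y} → y ∈ xs → y ≢ x
    distinct y∈ y≡x = All.All¬⇒¬Any x∉xs (lose y∈ (sym y≡x))
    drop-x : ∀ {y} zs → y ∈ zs ++ x ∷ ys₂ → y ≢ x → y ∈ zs ++ ys₂
    drop-x [] (here refl) y≢x = ⊥-elim (y≢x refl)
      where open import Data.Empty using (⊥-elim)
    drop-x [] (there y∈) y≢x = y∈
    drop-x (z ∷ zs) (here refl) y≢x = here refl
    drop-x (z ∷ zs) (there y∈) y≢x = there (drop-x zs y∈ y≢x)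

  Unique-map⁺ : ∀ (f : A → B) {xs} → (∀ {x y} → x ∈ xs → y ∈ xs → f x ≡ f y → x ≡ y) → Unique xs → Unique (map f xs)
  Unique-map⁺ f _ [] = []
  Unique-map⁺ f inj (x∉xs ∷ xs!) = All.map⁺ (fx∉ x∉xs (λ y∈ → inj (here refl) (there y∈))) ∷ Unique-map⁺ f (λ x∈ y∈ → inj (there x∈) (there y∈)) xs!
    where
    fx∉ : ∀ {x zs} → All (x ≢_) zs → (∀ {y} → y ∈ zs → f x ≡ f y → x ≡ y) → All (λ y → f x ≢ f y) zs
    fx∉ [] _ = []
    fx∉ (x≢z ∷ x≢zs) inj = (λ e → x≢z (inj (here refl) e)) ∷ fx∉ x≢zs (inj ∘ there)

  countᵇ-bijection : ∀ {p : A → Bool} {q : B → Bool} (f : A → B) xs ys → Unique xs → Unique ys →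
    (∀ {x y} → f x ≡ f y → x ≡ y) →
    (∀ {x} → x ∈ xs → p x ≡ true → f x ∈ ys × q (f x) ≡ true) →
    (∀ {y} → y ∈ ys → q y ≡ true → ∃ λ x → x ∈ xs × p x ≡ true × f x ≡ y) →
    countᵇ p xs ≡ countᵇ q ys
  countᵇ-bijection {p = p} {q} f xs ys xs! ys! f-injective into onto =
    trans (countᵇ≡length-filterᵇ p xs) (trans (ℕ.≤-antisym (subst (_≤ length ys′) (List.length-map f xs′) ≤ys′) (subst (length ys′ ≤_) (List.length-map f xs′) ys′≤))
          (sym (countᵇ≡length-filterᵇ q ys)))
    where
    xs′ = filterᵇ p xs
    ys′ = filterᵇ q ys
    ≤ys′ : length (map f xs′) ≤ length ys′
    ≤ys′ = Unique⇒length≤ (map f xs′) ys′ (Unique.map⁺ f-injective (Unique.filter⁺ (T? ∘ p) xs!)) λ z∈ →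
      let (x , x∈ , z≡fx) = ∈-map⁻ f z∈
          (x∈xs , px) = ∈-filterᵇ⁻ p xs x∈
          (fx∈ys , qfx) = into x∈xs px
      in subst (_∈ ys′) (sym z≡fx) (∈-filterᵇ⁺ q ys fx∈ys qfx)
    ys′≤ : length ys′ ≤ length (map f xs′)
    ys′≤ = Unique⇒length≤ ys′ (map f xs′) (Unique.filter⁺ (T? ∘ q) ys!) λ y∈ →
      let (y∈ys , qy) = ∈-filterᵇ⁻ q ys y∈
          (x , x∈xs , px , fx≡y) = onto y∈ys qy
      in subst (_∈ map f xs′) fx≡y (∈-map⁺ f (∈-filterᵇ⁺ p xs x∈xs px))

  countᵇ-sameElements : ∀ (p : A → Bool) xs ys → Unique xs → Unique ys →
    (∀ {x} → x ∈ xs → x ∈ ys) → (∀ {y} → y ∈ ys → y ∈ xs) → countᵇ p xs ≡ countᵇ p ys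
  countᵇ-sameElements p xs ys xs! ys! xs⊆ys ys⊆xs =
    countᵇ-bijection id xs ys xs! ys! id (λ x∈ px → xs⊆ys x∈ , px) (λ y∈ qy → _ , ys⊆xs y∈ , qy , refl)


module TreeEnumeration where

  open BinaryTrees
  open import Data.Nat using (ℕ; zero; suc; _+_; _∸_; _<_; _≤_; s≤s)
  import Data.Nat.Properties as ℕ
  open import Data.Nat.Tactic.RingSolver using (solve-∀)
  open import Data.List using (List; []; _∷_; [_]; map; _++_; concatMap; upTo; cartesianProductWith)
  import Data.List.Properties as List
  open import Data.List.Membership.Propositional using (_∈_; find; lose)
  open import Data.List.Membership.Propositional.Properties
    using (∈-++⁻; ∈-++⁺ˡ; ∈-++⁺ʳ; ∈-map⁻; ∈-map⁺; ∈-concatMap⁻; ∈-concatMap⁺; ∈-upTo⁻; ∈-upTo⁺; ∈-cartesianProductWith⁻; ∈-cartesianProductWith⁺)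
  open import Data.List.Relation.Unary.Any using (here)
  import Data.List.Relation.Unary.All as All
  import Data.List.Relation.Unary.All.Properties as All
  open import Data.List.Relation.Unary.AllPairs using (AllPairs)
  import Data.List.Relation.Unary.AllPairs.Properties as AllPairs
  open import Data.List.Relation.Unary.Unique.Propositional using (Unique; []; _∷_)
  import Data.List.Relation.Unary.Unique.Propositional.Properties as Unique
  open import Data.List.Relation.Binary.Disjoint.Propositional using (Disjoint)
  open import Data.Empty using (⊥-elim)
  open import Data.Product using (_×_; _,_; proj₂; ∃; ∃₂)
  open import Data.Sum using (_⊎_; inj₁; inj₂)
  open import Function using (id)
  open import Relation.Binary.PropositionalEquality hiding ([_])

  node-injective : ∀ {a b c d} → node a b ≡ node c d → a ≡ c × b ≡ d
  node-injective refl = refl , refl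

  -- Trees of size n; the fuel f ≥ n only makes the recursion structural.
  trees : (f n : ℕ) → List Tree
  trees _ zero = [ leaf ]
  trees zero (suc n) = []
  trees (suc f) (suc n) = concatMap (λ i → cartesianProductWith node (trees f i) (trees f (n ∸ i))) (upTo (suc n))

  ∈-trees⁻ : ∀ f n {t} → t ∈ trees f n → size t ≡ n
  ∈-trees⁻ f zero (here refl) = refl
  ∈-trees⁻ (suc f) (suc n) t∈ with find (∈-concatMap⁻ (λ i → cartesianProductWith node (trees f i) (trees f (n ∸ i))) {xs = upTo (suc n)} t∈)
  ... | i , i∈ , t∈′ with ∈-cartesianProductWith⁻ node (trees f i) (trees f (n ∸ i)) t∈′
  ...   | a , b , a∈ , b∈ , refl =
    cong suc (trans (cong₂ _+_ (∈-trees⁻ f i a∈) (∈-trees⁻ f (n ∸ i) b∈)) (ℕ.m+[n∸m]≡n (ℕ.≤-pred (∈-upTo⁻ i∈))))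

  ∈-trees⁺ : ∀ f t → size t ≤ f → t ∈ trees f (size t)
  ∈-trees⁺ f leaf _ = here refl
  ∈-trees⁺ (suc f) (node a b) (s≤s |a|+|b|≤f) =
    ∈-concatMap⁺ (λ i → cartesianProductWith node (trees f i) (trees f (size a + size b ∸ i))) (lose (∈-upTo⁺ (s≤s (ℕ.m≤m+n (size a) (size b))))
      (∈-cartesianProductWith⁺ node (∈-trees⁺ f a (ℕ.≤-trans (ℕ.m≤m+n (size a) (size b)) |a|+|b|≤f))
        (subst (λ z → b ∈ trees f z) (sym (ℕ.m+n∸m≡n (size a) (size b)))
               (∈-trees⁺ f b (ℕ.≤-trans (ℕ.m≤n+m (size b) (size a)) |a|+|b|≤f)))))

  trees-unique : ∀ f n → Unique (trees f n)
  trees-unique f zero = All.[] ∷ []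
  trees-unique zero (suc n) = []
  trees-unique (suc f) (suc n) = Unique.concat⁺ (All.map⁺ (All.applyUpTo⁺₂ id (suc n) (λ i → block-unique i)))
    (subst (AllPairs Disjoint) (sym (List.map-upTo block (suc n))) (AllPairs.applyUpTo⁺₁ block (suc n) blocks-disjoint))
    where
    block : ℕ → List Tree
    block i = cartesianProductWith node (trees f i) (trees f (n ∸ i))
    block-unique : ∀ i → Unique (block i)
    block-unique i = Unique.cartesianProductWith⁺ node node-injective (trees-unique f i) (trees-unique f (n ∸ i))
    blocks-disjoint : ∀ {i j} → i < j → j < suc n → Disjoint (block i) (block j)
    blocks-disjoint {i} {j} i<j _ (t∈i , t∈j)
      with ∈-cartesianProductWith⁻ node (trees f i) (trees f (n ∸ i)) t∈i
         | ∈-cartesianProductWith⁻ node (trees f j) (trees f (n ∸ j)) t∈j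
    ... | a , _ , a∈i , _ , refl | a′ , _ , a′∈j , _ , eq with node-injective eq
    ...   | refl , refl = ℕ.<-irrefl (trans (sym (∈-trees⁻ f i a∈i)) (∈-trees⁻ f j a′∈j)) i<j

  -- A self-inverse tree is either node a leaf with a self-inverse, or bracket a g with g self-inverse.
  bracket : Tree → Tree → Tree
  bracket a g = node a (skewSum g (node (inverse a) leaf))

  inverse-bracket : ∀ a g → inverse g ≡ g → inverse (bracket a g) ≡ bracket a g
  inverse-bracket a g g-selfInverse = begin
    skewSum (inverse (skewSum g (node (inverse a) leaf))) (node (inverse a) leaf)
      ≡⟨ cong (λ z → skewSum z (node (inverse a) leaf)) (inverse-skewSum g (node (inverse a) leaf)) ⟩
    skewSum (skewSum (node (inverse (inverse a)) leaf) (inverse g)) (node (inverse a) leaf)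
      ≡⟨ cong₂ (λ x y → skewSum (skewSum (node x leaf) y) (node (inverse a) leaf)) (inverse-involutive a) g-selfInverse ⟩
    bracket a g ∎
    where open ≡-Reasoning

  size-bracket : ∀ a g → size (bracket a g) ≡ suc (suc (size a + size a + size g))
  size-bracket a g = cong suc (trans
    (cong (size a +_) (trans (size-skewSum g (node (inverse a) leaf)) (cong (λ z → size g + suc (z + 0)) (size-inverse a))))
    (rearrange (size a) (size g)))
    where
    rearrange : ∀ x y → x + (y + suc (x + 0)) ≡ suc (x + x + y)
    rearrange = solve-∀

  selfInverse-shape : ∀ a b → inverse (node a b) ≡ node a b →
    (b ≡ leaf × inverse a ≡ a) ⊎ (∃ λ g → b ≡ skewSum g (node (inverse a) leaf) × inverse g ≡ g)
  selfInverse-shape a b eq with inverse b in inverse-b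
  ... | leaf with node-injective eq
  ...   | a-selfInverse , refl = inj₁ (refl , a-selfInverse)
  selfInverse-shape a b eq | node x y with node-injective eq
  ... | refl , refl = inj₂ (y , refl , sym (proj₂ (node-injective y≡inverse-y)))
    where
    y≡inverse-y : node x y ≡ node x (inverse y)
    y≡inverse-y = trans (sym inverse-b)
      (trans (inverse-skewSum y (node (inverse x) leaf)) (cong (λ z → skewSum (node z leaf) (inverse y)) (inverse-involutive x)))

  skewSum-cancelʳ : ∀ g g′ s → skewSum g s ≡ skewSum g′ s → g ≡ g′
  skewSum-cancelʳ leaf leaf s eq = refl
  skewSum-cancelʳ leaf (node x y) s eq = ⊥-elim (too-big x y s eq)
    where
    too-big : ∀ x y s → s ≢ node x (skewSum y s)
    too-big x y s eq = ℕ.<-irrefl (trans (cong size eq) (cong (λ z → suc (size x + z)) (size-skewSum y s)))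
      (s≤s (ℕ.≤-trans (ℕ.m≤n+m (size s) (size y)) (ℕ.m≤n+m (size y + size s) (size x))))
  skewSum-cancelʳ (node x y) leaf s eq = ⊥-elim (too-big x y s (sym eq))
    where
    too-big : ∀ x y s → s ≢ node x (skewSum y s)
    too-big x y s eq = ℕ.<-irrefl (trans (cong size eq) (cong (λ z → suc (size x + z)) (size-skewSum y s)))
      (s≤s (ℕ.≤-trans (ℕ.m≤n+m (size s) (size y)) (ℕ.m≤n+m (size y + size s) (size x))))
  skewSum-cancelʳ (node x y) (node x′ y′) s eq with node-injective eq
  ... | refl , eq′ = cong (node x) (skewSum-cancelʳ y y′ s eq′)

  bracket-injective : ∀ {a g a′ g′} → bracket a g ≡ bracket a′ g′ → a ≡ a′ × g ≡ g′
  bracket-injective {a} {g} {a′} {g′} eq with node-injective eq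
  ... | refl , eq′ = refl , skewSum-cancelʳ g g′ (node (inverse a) leaf) eq′

  -- Self-inverse trees of size n. The list bracketsFrom f p m holds the trees
  -- bracket a g of size 2 + 2p + m with size a ≥ p, listed by increasing size a.
  involutions : (f n : ℕ) → List Tree
  bracketsFrom : (f p m : ℕ) → List Tree
  bracketBlock : (f p m : ℕ) → List Tree

  bracketBlock f p m = cartesianProductWith bracket (trees p p) (involutions f m)

  involutions _ zero = [ leaf ]
  involutions zero (suc n) = []
  involutions (suc f) (suc zero) = map (λ a → node a leaf) (involutions f zero)
  involutions (suc f) (suc (suc n)) = map (λ a → node a leaf) (involutions f (suc n)) ++ bracketsFrom f 0 n

  bracketsFrom f p zero = bracketBlock f p zero
  bracketsFrom f p (suc zero) = bracketBlock f p (suc zero)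
  bracketsFrom f p (suc (suc m)) = bracketBlock f p (suc (suc m)) ++ bracketsFrom f (suc p) m

  IsBracketFrom : ℕ → ℕ → Tree → Set
  IsBracketFrom p m t = size t ≡ suc (suc (p + p + m)) × inverse t ≡ t × (∃₂ λ a g → t ≡ bracket a g × p ≤ size a)

  ∈-involutions⁻ : ∀ f n {t} → t ∈ involutions f n → size t ≡ n × inverse t ≡ t
  ∈-bracketsFrom⁻ : ∀ f p m {t} → t ∈ bracketsFrom f p m → IsBracketFrom p m t
  ∈-bracketBlock⁻ : ∀ f p m {t} → t ∈ bracketBlock f p m → IsBracketFrom p m t

  ∈-bracketBlock⁻ f p m t∈ with ∈-cartesianProductWith⁻ bracket (trees p p) (involutions f m) t∈
  ... | a , g , a∈ , g∈ , refl with ∈-trees⁻ p p a∈ | ∈-involutions⁻ f m g∈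
  ...   | refl | refl , g-selfInverse = size-bracket a g , inverse-bracket a g g-selfInverse , (a , g , refl , ℕ.≤-refl)

  ∈-involutions⁻ f zero (here refl) = refl , refl
  ∈-involutions⁻ (suc f) (suc zero) t∈ with ∈-map⁻ (λ a → node a leaf) t∈
  ... | a , a∈ , refl with ∈-involutions⁻ f zero a∈
  ...   | size-a , a-selfInverse = cong (λ z → suc (z + 0)) size-a , cong (λ z → node z leaf) a-selfInverse
  ∈-involutions⁻ (suc f) (suc (suc n)) t∈ with ∈-++⁻ (map (λ a → node a leaf) (involutions f (suc n))) t∈
  ... | inj₁ t∈₁ with ∈-map⁻ (λ a → node a leaf) t∈₁
  ...   | a , a∈ , refl with ∈-involutions⁻ f (suc n) a∈
  ...     | size-a , a-selfInverse = trans (cong suc (ℕ.+-identityʳ (size a))) (cong suc size-a) , cong (λ z → node z leaf) a-selfInverse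
  ∈-involutions⁻ (suc f) (suc (suc n)) t∈ | inj₂ t∈₂ with ∈-bracketsFrom⁻ f 0 n t∈₂
  ... | size-t , t-selfInverse , _ = size-t , t-selfInverse

  ∈-bracketsFrom⁻ f p zero t∈ = ∈-bracketBlock⁻ f p zero t∈
  ∈-bracketsFrom⁻ f p (suc zero) t∈ = ∈-bracketBlock⁻ f p (suc zero) t∈
  ∈-bracketsFrom⁻ f p (suc (suc m)) t∈ with ∈-++⁻ (bracketBlock f p (suc (suc m))) t∈
  ... | inj₁ t∈₁ = ∈-bracketBlock⁻ f p (suc (suc m)) t∈₁
  ... | inj₂ t∈₂ with ∈-bracketsFrom⁻ f (suc p) m t∈₂
  ...   | size-t , t-selfInverse , (a , g , t≡ , p<a) =
    trans size-t (cong (λ z → suc (suc z)) (rearrange p m)) , t-selfInverse , (a , g , t≡ , ℕ.≤-trans (ℕ.n≤1+n p) p<a)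
    where
    rearrange : ∀ p m → suc p + suc p + m ≡ p + p + suc (suc m)
    rearrange = solve-∀

  ∈-bracketsFrom⁺ : ∀ f j p m {a g} → size a ≡ p + j → g ∈ involutions f m → bracket a g ∈ bracketsFrom f p (j + j + m)
  ∈-bracketsFrom⁺ f zero p m {a} {g} size-a g∈ = head-block m block-member
    where
    block-member : bracket a g ∈ bracketBlock f p m
    block-member = ∈-cartesianProductWith⁺ bracket
      (subst (λ z → a ∈ trees p z) (trans size-a (ℕ.+-identityʳ p)) (∈-trees⁺ p a (ℕ.≤-reflexive (trans size-a (ℕ.+-identityʳ p))))) g∈
    head-block : ∀ m {t} → t ∈ bracketBlock f p m → t ∈ bracketsFrom f p m
    head-block zero t∈ = t∈
    head-block (suc zero) t∈ = t∈
    head-block (suc (suc m)) t∈ = ∈-++⁺ˡ t∈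
  ∈-bracketsFrom⁺ f (suc j) p m {a} {g} size-a g∈ =
    subst (λ z → bracket a g ∈ bracketsFrom f p z) (rearrange j m)
          (∈-++⁺ʳ (bracketBlock f p (suc (suc (j + j + m)))) (∈-bracketsFrom⁺ f j (suc p) m (trans size-a (ℕ.+-suc p j)) g∈))
    where
    rearrange : ∀ j m → suc (suc (j + j + m)) ≡ suc j + suc j + m
    rearrange = solve-∀

  ∈-involutions⁺ : ∀ f t → size t ≤ f → inverse t ≡ t → t ∈ involutions f (size t)
  ∈-involutions⁺ f leaf _ _ = here refl
  ∈-involutions⁺ (suc f) (node a b) (s≤s size≤f) t-selfInverse with selfInverse-shape a b t-selfInverse
  ... | inj₁ (refl , a-selfInverse) =
    subst (λ z → node a leaf ∈ involutions (suc f) (suc z)) (sym (ℕ.+-identityʳ (size a)))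
          (leaf-case (size a) (∈-involutions⁺ f a (ℕ.≤-trans (ℕ.m≤m+n (size a) 0) size≤f) a-selfInverse))
    where
    leaf-case : ∀ n → a ∈ involutions f n → node a leaf ∈ involutions (suc f) (suc n)
    leaf-case zero a∈ = ∈-map⁺ (λ a → node a leaf) a∈
    leaf-case (suc n) a∈ = ∈-++⁺ˡ (∈-map⁺ (λ a → node a leaf) a∈)
  ... | inj₂ (g , refl , g-selfInverse) =
    subst (λ z → bracket a g ∈ involutions (suc f) z) (sym (size-bracket a g))
          (∈-++⁺ʳ (map (λ a → node a leaf) (involutions f (suc (size a + size a + size g))))
                  (∈-bracketsFrom⁺ f (size a) 0 (size g) refl (∈-involutions⁺ f g size-g≤f g-selfInverse)))
    where
    size-g≤f : size g ≤ f
    size-g≤f = ℕ.≤-trans (ℕ.m≤n+m (size g) (suc (size a + size a)))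
                         (ℕ.≤-trans (ℕ.≤-reflexive (sym (ℕ.suc-injective (size-bracket a g)))) size≤f)

  leftChild-injective : ∀ {a a′} → node a leaf ≡ node a′ leaf → a ≡ a′
  leftChild-injective refl = refl

  involutions-unique : ∀ f n → Unique (involutions f n)
  bracketsFrom-unique : ∀ f p m → Unique (bracketsFrom f p m)
  bracketBlock-unique : ∀ f p m → Unique (bracketBlock f p m)

  bracketBlock-unique f p m = Unique.cartesianProductWith⁺ bracket bracket-injective (trees-unique p p) (involutions-unique f m)

  involutions-unique f zero = All.[] ∷ []
  involutions-unique zero (suc n) = []
  involutions-unique (suc f) (suc zero) = Unique.map⁺ leftChild-injective (involutions-unique f zero)
  involutions-unique (suc f) (suc (suc n)) =
    Unique.++⁺ (Unique.map⁺ leftChild-injective (involutions-unique f (suc n))) (bracketsFrom-unique f 0 n) disjoint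
    where
    disjoint : Disjoint (map (λ a → node a leaf) (involutions f (suc n))) (bracketsFrom f 0 n)
    disjoint (t∈₁ , t∈₂) with ∈-map⁻ (λ a → node a leaf) t∈₁ | ∈-bracketsFrom⁻ f 0 n t∈₂
    ... | a , _ , refl | _ , _ , (a′ , g , eq , _) = skewSum-nonleaf g (sym (proj₂ (node-injective eq)))
      where
      skewSum-nonleaf : ∀ g {x} → skewSum g (node x leaf) ≢ leaf
      skewSum-nonleaf leaf ()
      skewSum-nonleaf (node _ _) ()

  bracketsFrom-unique f p zero = bracketBlock-unique f p zero
  bracketsFrom-unique f p (suc zero) = bracketBlock-unique f p (suc zero)
  bracketsFrom-unique f p (suc (suc m)) = Unique.++⁺ (bracketBlock-unique f p (suc (suc m))) (bracketsFrom-unique f (suc p) m) disjoint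
    where
    disjoint : Disjoint (bracketBlock f p (suc (suc m))) (bracketsFrom f (suc p) m)
    disjoint (t∈₁ , t∈₂) with ∈-cartesianProductWith⁻ bracket (trees p p) (involutions f (suc (suc m))) t∈₁ | ∈-bracketsFrom⁻ f (suc p) m t∈₂
    ... | a , g , a∈ , _ , refl | _ , _ , (a′ , g′ , eq , p<a′) with node-injective eq
    ...   | refl , _ = ℕ.<-irrefl (sym (∈-trees⁻ p p a∈)) p<a′


module InvolutionCounts where

  open import Defs using (countᵇ; isEven; _==_)
  open Parity
  open BinaryTrees
  open TreeEnumeration
  open Counting
  open import Data.Nat using (ℕ; zero; suc; _+_; _*_; _∸_; _≤_)
  import Data.Nat.Properties as ℕ
  open import Data.Nat.ListAction using (sum)
  open import Data.Nat.Tactic.RingSolver using (solve-∀)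
  open import Data.Bool using (Bool; true; false; _∧_; not; if_then_else_)
  import Data.Bool.Properties as Bool
  open import Data.List using ([]; _∷_; map; _++_; upTo; cartesianProductWith)
  open import Data.List.Membership.Propositional using (_∈_)
  open import Data.List.Membership.Propositional.Properties using (∈-upTo⁻)
  open import Data.List.Relation.Unary.Any using (here; there)
  open import Data.Product using (_,_)
  open import Function using (_∘_)
  open import Relation.Binary.PropositionalEquality

  good : ℕ → Bool → Tree → Bool
  good k b t = lisBelow k t ∧ (isEven (inversionsᵗ t) == b)

  involutionCount : ℕ → Bool → ℕ → ℕ
  involutionCount k b n = countᵇ (good k b) (involutions n n)

  treeCount : ℕ → ℕ → ℕ
  treeCount k p = countᵇ (lisBelow k) (trees p p)

  involutions-fuel : ∀ (P : Tree → Bool) f n → n ≤ f → countᵇ P (involutions f n) ≡ countᵇ P (involutions n n)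
  involutions-fuel P f n n≤f = countᵇ-sameElements P (involutions f n) (involutions n n) (involutions-unique f n) (involutions-unique n n)
    (λ t∈ → let size-t , t-selfInverse = ∈-involutions⁻ f n t∈
            in subst (λ z → _ ∈ involutions n z) size-t (∈-involutions⁺ n _ (ℕ.≤-reflexive size-t) t-selfInverse))
    (λ t∈ → let size-t , t-selfInverse = ∈-involutions⁻ n n t∈
            in subst (λ z → _ ∈ involutions f z) size-t (∈-involutions⁺ f _ (ℕ.≤-trans (ℕ.≤-reflexive size-t) n≤f) t-selfInverse))

  trees-fuel : ∀ (P : Tree → Bool) f n → n ≤ f → countᵇ P (trees f n) ≡ countᵇ P (trees n n)
  trees-fuel P f n n≤f = countᵇ-sameElements P (trees f n) (trees n n) (trees-unique f n) (trees-unique n n)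
    (λ t∈ → let size-t = ∈-trees⁻ f n t∈ in subst (λ z → _ ∈ trees n z) size-t (∈-trees⁺ n _ (ℕ.≤-reflexive size-t)))
    (λ t∈ → let size-t = ∈-trees⁻ n n t∈ in subst (λ z → _ ∈ trees f z) size-t (∈-trees⁺ f _ (ℕ.≤-trans (ℕ.≤-reflexive size-t) n≤f)))

  good-node-leaf : ∀ k b a → good (suc k) b (node a leaf) ≡ good k b a
  good-node-leaf k b a = cong₂ (λ x y → x ∧ (isEven y == b)) (Bool.∧-identityʳ (lisBelow k a))
    (trans (cong₂ _+_ (ℕ.+-identityʳ (inversionsᵗ a)) (ℕ.*-zeroʳ (suc (size a)))) (ℕ.+-identityʳ (inversionsᵗ a)))

  -- The contributions of a and of its mirrored copy inverse a come in pairs.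
  inversionsᵗ-bracket : ∀ a g → let w = inversionsᵗ a + size g * suc (size a) in
    inversionsᵗ (bracket a g) ≡ inversionsᵗ g + (w + w) + suc (size a) * suc (size a)
  inversionsᵗ-bracket a g = begin
    inversionsᵗ a + inversionsᵗ (skewSum g (node (inverse a) leaf)) + suc (size a) * size (skewSum g (node (inverse a) leaf))
      ≡⟨ cong₂ (λ x y → inversionsᵗ a + x + suc (size a) * y) (inversionsᵗ-skewSum g (node (inverse a) leaf)) (size-skewSum g (node (inverse a) leaf)) ⟩
    inversionsᵗ a + (inversionsᵗ g + (inversionsᵗ (inverse a) + 0 + suc (size (inverse a)) * 0) + size g * suc (size (inverse a) + 0))
      + suc (size a) * (size g + suc (size (inverse a) + 0))
      ≡⟨ cong₂ (λ x y → inversionsᵗ a + (inversionsᵗ g + (x + 0 + suc y * 0) + size g * suc (y + 0)) + suc (size a) * (size g + suc (y + 0)))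
               (inversionsᵗ-inverse a) (size-inverse a) ⟩
    inversionsᵗ a + (inversionsᵗ g + (inversionsᵗ a + 0 + suc (size a) * 0) + size g * suc (size a + 0)) + suc (size a) * (size g + suc (size a + 0))
      ≡⟨ rearrange (inversionsᵗ a) (inversionsᵗ g) (size a) (size g) ⟩
    inversionsᵗ g + ((inversionsᵗ a + size g * suc (size a)) + (inversionsᵗ a + size g * suc (size a))) + suc (size a) * suc (size a) ∎
    where
    open ≡-Reasoning
    rearrange : ∀ ta tg sa sg → ta + (tg + (ta + 0 + suc sa * 0) + sg * suc (sa + 0)) + suc sa * (sg + suc (sa + 0))
                                ≡ tg + ((ta + sg * suc sa) + (ta + sg * suc sa)) + suc sa * suc sa
    rearrange = solve-∀

  isEven-inversionsᵗ-bracket : ∀ a g → isEven (inversionsᵗ (bracket a g)) ≡ (isEven (inversionsᵗ g) == not (isEven (size a)))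
  isEven-inversionsᵗ-bracket a g = begin
    isEven (inversionsᵗ (bracket a g))                                   ≡⟨ cong isEven (inversionsᵗ-bracket a g) ⟩
    isEven (inversionsᵗ g + (w + w) + suc (size a) * suc (size a))       ≡⟨ isEven-+ (inversionsᵗ g + (w + w)) _ ⟩
    (isEven (inversionsᵗ g + (w + w)) == isEven (suc (size a) * suc (size a)))
      ≡⟨ cong₂ _==_ (trans (isEven-+ (inversionsᵗ g) (w + w)) (trans (cong (isEven (inversionsᵗ g) ==_) (isEven-double w)) (==-true (isEven (inversionsᵗ g)))))
                    (trans (isEven-square (suc (size a))) (isEven-suc (size a))) ⟩
    (isEven (inversionsᵗ g) == not (isEven (size a)))                    ∎
    where
    open ≡-Reasoning
    w = inversionsᵗ a + size g * suc (size a)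

  flipIfEven : ℕ → Bool → Bool
  flipIfEven p b = if isEven p then not b else b

  good-bracket : ∀ k b a g → good (suc k) b (bracket a g) ≡ lisBelow k a ∧ good (suc k) (flipIfEven (size a) b) g
  good-bracket k b a g = begin
    (lisBelow k a ∧ lisBelow (suc k) (skewSum g (node (inverse a) leaf))) ∧ (isEven (inversionsᵗ (bracket a g)) == b)
      ≡⟨ cong₂ (λ x y → (lisBelow k a ∧ x) ∧ y)
               (trans (lisBelow-skewSum (suc k) g (node (inverse a) leaf)) (cong (λ z → lisBelow (suc k) g ∧ (z ∧ true)) (lisBelow-inverse k a)))
               (trans (cong (_== b) (isEven-inversionsᵗ-bracket a g)) (parity-flip (isEven (inversionsᵗ g)) (isEven (size a)) b)) ⟩
    (lisBelow k a ∧ (lisBelow (suc k) g ∧ (lisBelow k a ∧ true))) ∧ (isEven (inversionsᵗ g) == flipIfEven (size a) b)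
      ≡⟨ cong (_∧ (isEven (inversionsᵗ g) == flipIfEven (size a) b)) (absorb (lisBelow k a) (lisBelow (suc k) g)) ⟩
    (lisBelow k a ∧ lisBelow (suc k) g) ∧ (isEven (inversionsᵗ g) == flipIfEven (size a) b)
      ≡⟨ Bool.∧-assoc (lisBelow k a) (lisBelow (suc k) g) _ ⟩
    lisBelow k a ∧ good (suc k) (flipIfEven (size a) b) g ∎
    where
    open ≡-Reasoning
    parity-flip : ∀ x e b → ((x == not e) == b) ≡ (x == (if e then not b else b))
    parity-flip true true b = refl
    parity-flip true false b = refl
    parity-flip false true b = sym (Bool.not-involutive b)
    parity-flip false false b = refl
    absorb : ∀ x y → x ∧ (y ∧ (x ∧ true)) ≡ x ∧ y
    absorb true y = Bool.∧-identityʳ y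
    absorb false y = refl

  flipIfEven-suc : ∀ p b → flipIfEven (suc p) b ≡ not (flipIfEven p b)
  flipIfEven-suc p b rewrite isEven-suc p with isEven p
  ... | true = sym (Bool.not-involutive b)
  ... | false = refl

  bracketSum : (ℕ → ℕ) → (Bool → ℕ → ℕ) → ℕ → Bool → ℕ
  bracketSum c g zero b = c 0 * g b 0
  bracketSum c g (suc zero) b = c 0 * g b 1
  bracketSum c g (suc (suc m)) b = c 0 * g b (suc (suc m)) + bracketSum (c ∘ suc) g m (not b)

  bracketSum-cong : ∀ {c c′} g m b → (∀ j → c j ≡ c′ j) → bracketSum c g m b ≡ bracketSum c′ g m b
  bracketSum-cong g zero b c≗c′ = cong (_* g b 0) (c≗c′ 0)
  bracketSum-cong g (suc zero) b c≗c′ = cong (_* g b 1) (c≗c′ 0)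
  bracketSum-cong g (suc (suc m)) b c≗c′ = cong₂ _+_ (cong (_* g b (suc (suc m))) (c≗c′ 0)) (bracketSum-cong g m (not b) (c≗c′ ∘ suc))

  count-bracketBlock : ∀ k b f p m → m ≤ f →
    countᵇ (good (suc k) b) (bracketBlock f p m) ≡ treeCount k p * involutionCount (suc k) (flipIfEven p b) m
  count-bracketBlock k b f p m m≤f =
    trans (countᵇ-cartesianProductWith bracket (trees p p) (involutions f m)
            (λ {a} {g} a∈ _ → trans (good-bracket k b a g) (cong (λ z → lisBelow k a ∧ good (suc k) (flipIfEven z b) g) (∈-trees⁻ p p a∈))))
          (cong (treeCount k p *_) (involutions-fuel (good (suc k) (flipIfEven p b)) f m m≤f))

  count-bracketsFrom : ∀ k b f p m → m ≤ f →
    countᵇ (good (suc k) b) (bracketsFrom f p m) ≡ bracketSum (λ j → treeCount k (p + j)) (involutionCount (suc k)) m (flipIfEven p b)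
  count-bracketsFrom k b f p zero m≤f =
    trans (count-bracketBlock k b f p 0 m≤f) (cong (λ x → treeCount k x * involutionCount (suc k) (flipIfEven p b) 0) (sym (ℕ.+-identityʳ p)))
  count-bracketsFrom k b f p (suc zero) m≤f =
    trans (count-bracketBlock k b f p 1 m≤f) (cong (λ x → treeCount k x * involutionCount (suc k) (flipIfEven p b) 1) (sym (ℕ.+-identityʳ p)))
  count-bracketsFrom k b f p (suc (suc m)) m≤f = begin
    countᵇ (good (suc k) b) (bracketBlock f p (suc (suc m)) ++ bracketsFrom f (suc p) m)
      ≡⟨ countᵇ-++ (good (suc k) b) (bracketBlock f p (suc (suc m))) (bracketsFrom f (suc p) m) ⟩
    countᵇ (good (suc k) b) (bracketBlock f p (suc (suc m))) + countᵇ (good (suc k) b) (bracketsFrom f (suc p) m)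
      ≡⟨ cong₂ _+_ (count-bracketBlock k b f p (suc (suc m)) m≤f) (count-bracketsFrom k b f (suc p) m (ℕ.≤-trans (ℕ.m≤n+m m 2) m≤f)) ⟩
    treeCount k p * involutionCount (suc k) (flipIfEven p b) (suc (suc m))
      + bracketSum (λ j → treeCount k (suc p + j)) (involutionCount (suc k)) m (flipIfEven (suc p) b)
      ≡⟨ cong₂ _+_ (cong (λ x → treeCount k x * involutionCount (suc k) (flipIfEven p b) (suc (suc m))) (sym (ℕ.+-identityʳ p)))
                   (trans (cong (bracketSum (λ j → treeCount k (suc p + j)) (involutionCount (suc k)) m) (flipIfEven-suc p b))
                          (bracketSum-cong (involutionCount (suc k)) m (not (flipIfEven p b)) (λ j → cong (treeCount k) (sym (ℕ.+-suc p j))))) ⟩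
    bracketSum (λ j → treeCount k (p + j)) (involutionCount (suc k)) (suc (suc m)) (flipIfEven p b) ∎
    where open ≡-Reasoning

  involutionCount-zero : ∀ b n → involutionCount 0 b n ≡ 0
  involutionCount-zero b n = countᵇ-none (good 0 b) (involutions n n) (λ _ → refl)

  involutionCount-one : ∀ k b → involutionCount (suc k) b 1 ≡ involutionCount k b 0
  involutionCount-one k b =
    trans (countᵇ-map (good (suc k) b) (λ a → node a leaf) (involutions 0 0)) (countᵇ-cong (involutions 0 0) (λ {a} _ → good-node-leaf k b a))

  involutionCount-suc-suc : ∀ k b n → involutionCount (suc k) b (suc (suc n))
    ≡ involutionCount k b (suc n) + bracketSum (treeCount k) (involutionCount (suc k)) n (not b)
  involutionCount-suc-suc k b n =
    trans (countᵇ-++ (good (suc k) b) (map (λ a → node a leaf) (involutions (suc n) (suc n))) (bracketsFrom (suc n) 0 n))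
          (cong₂ _+_ (trans (countᵇ-map (good (suc k) b) (λ a → node a leaf) (involutions (suc n) (suc n)))
                            (countᵇ-cong (involutions (suc n) (suc n)) (λ {a} _ → good-node-leaf k b a)))
                     (count-bracketsFrom k b (suc n) 0 n (ℕ.n≤1+n n)))

  treeCount-zero : ∀ p → treeCount 0 p ≡ 0
  treeCount-zero p = countᵇ-none (lisBelow 0) (trees p p) (λ _ → refl)

  treeCount-suc : ∀ k p → treeCount (suc k) (suc p) ≡ sum (map (λ i → treeCount k i * treeCount (suc k) (p ∸ i)) (upTo (suc p)))
  treeCount-suc k p =
    trans (countᵇ-concatMap (lisBelow (suc k)) (λ i → cartesianProductWith node (trees p i) (trees p (p ∸ i))) (upTo (suc p)))
          (cong sum (map-cong-∈ (upTo (suc p)) λ {i} i∈ →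
            trans (countᵇ-cartesianProductWith node (trees p i) (trees p (p ∸ i)) (λ _ _ → refl))
                  (cong₂ _*_ (trees-fuel (lisBelow k) p i (ℕ.≤-pred (∈-upTo⁻ i∈))) (trees-fuel (lisBelow (suc k)) p (p ∸ i) (ℕ.m∸n≤m p i)))))
    where
    map-cong-∈ : ∀ {g h : ℕ → ℕ} l → (∀ {i} → i ∈ l → g i ≡ h i) → map g l ≡ map h l
    map-cong-∈ [] _ = refl
    map-cong-∈ (i ∷ l) g≗h = cong₂ _∷_ (g≗h (here refl)) (map-cong-∈ l (g≗h ∘ there))


module GeneratingFunctions where

  open import Defs
  open PowerSeries
  open InvolutionCounts
  open import Data.Nat as ℕ using (ℕ; zero; suc; _∸_)
  import Data.Nat.Properties as ℕ
  open import Data.Nat.ListAction using (sum)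
  open import Data.Integer using (ℤ; +_; -_; _+_; _*_)
  import Data.Integer.Properties as ℤ
  open import Data.Integer.Tactic.RingSolver using (solve-∀)
  open import Data.Bool using (Bool; true; false)
  open import Data.List using ([]; _∷_; _++_; _∷ʳ_; [_]; map; upTo)
  import Data.List.Properties as List
  open import Data.List.Membership.Propositional.Properties using (∈-upTo⁻)
  open import Function using (_∘_)
  open import Relation.Binary.PropositionalEquality hiding ([_])
  open import Algebra.Morphism.Structures using (IsRingHomomorphism)

  counts : (ℕ → ℕ) → Series
  counts c n = + c n

  private
    pos-*+* : ∀ a b c d → + (a ℕ.* b ℕ.+ c ℕ.* d) ≡ + a * + b + + c * + d
    pos-*+* a b c d = trans (ℤ.pos-+ (a ℕ.* b) (c ℕ.* d)) (cong₂ _+_ (ℤ.pos-* a b) (ℤ.pos-* c d))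

  bracketSum-total : ∀ c g m → + (bracketSum c g m true ℕ.+ bracketSum c g m false)
    ≡ (dil (counts c) ⊗ (counts (g true) ⊕ counts (g false))) m
  bracketSum-total c g zero = trans (pos-*+* (c 0) (g true 0) (c 0) (g false 0)) (factor₀ (+ c 0) (+ g true 0) (+ g false 0))
    where
    factor₀ : ∀ c t f → c * t + c * f ≡ c * (t + f) + + 0
    factor₀ = solve-∀
  bracketSum-total c g (suc zero) = trans (pos-*+* (c 0) (g true 1) (c 0) (g false 1)) (begin
    + c 0 * + g true 1 + + c 0 * + g false 1                 ≡⟨ factor₁ (+ c 0) (+ g true 1) (+ g false 1) (+ g true 0 + + g false 0) ⟩
    + c 0 * (+ g true 1 + + g false 1) + (+ 0 * (+ g true 0 + + g false 0) + + 0) ≡⟨ sym (⊗-suc (dil (counts c)) (counts (g true) ⊕ counts (g false)) 0) ⟩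
    (dil (counts c) ⊗ (counts (g true) ⊕ counts (g false))) 1 ∎)
    where
    open ≡-Reasoning
    factor₁ : ∀ c t f s → c * t + c * f ≡ c * (t + f) + (+ 0 * s + + 0)
    factor₁ = solve-∀
  bracketSum-total c g (suc (suc m)) = begin
    + (c 0 ℕ.* g true m+2 ℕ.+ bracketSum (c ∘ suc) g m false ℕ.+ (c 0 ℕ.* g false m+2 ℕ.+ bracketSum (c ∘ suc) g m true))
      ≡⟨ trans (ℤ.pos-+ (c 0 ℕ.* g true m+2 ℕ.+ _) _) (cong₂ _+_ (ℤ.pos-+ (c 0 ℕ.* g true m+2) _) (ℤ.pos-+ (c 0 ℕ.* g false m+2) _)) ⟩
    (+ (c 0 ℕ.* g true m+2) + + bracketSum (c ∘ suc) g m false) + (+ (c 0 ℕ.* g false m+2) + + bracketSum (c ∘ suc) g m true)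
      ≡⟨ cong₂ (λ x y → (x + + bracketSum (c ∘ suc) g m false) + (y + + bracketSum (c ∘ suc) g m true)) (ℤ.pos-* (c 0) _) (ℤ.pos-* (c 0) _) ⟩
    (+ c 0 * + g true m+2 + + bracketSum (c ∘ suc) g m false) + (+ c 0 * + g false m+2 + + bracketSum (c ∘ suc) g m true)
      ≡⟨ regroup (+ c 0) (+ g true m+2) (+ bracketSum (c ∘ suc) g m false) (+ g false m+2) (+ bracketSum (c ∘ suc) g m true) ⟩
    + c 0 * (+ g true m+2 + + g false m+2) + (+ bracketSum (c ∘ suc) g m true + + bracketSum (c ∘ suc) g m false)
      ≡⟨ cong (λ z → + c 0 * (+ g true m+2 + + g false m+2) + z) (trans (sym (ℤ.pos-+ (bracketSum (c ∘ suc) g m true) _)) (bracketSum-total (c ∘ suc) g m)) ⟩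
    + c 0 * (+ g true m+2 + + g false m+2) + (dil (counts (c ∘ suc)) ⊗ (counts (g true) ⊕ counts (g false))) m
      ≡⟨ sym (dil⊗-suc-suc (counts c) (counts (g true) ⊕ counts (g false)) m) ⟩
    (dil (counts c) ⊗ (counts (g true) ⊕ counts (g false))) m+2 ∎
    where
    open ≡-Reasoning
    m+2 = suc (suc m)
    regroup : ∀ c t s f s′ → (c * t + s) + (c * f + s′) ≡ c * (t + f) + (s′ + s)
    regroup = solve-∀

  bracketSum-signed : ∀ c g m → + bracketSum c g m true + - + bracketSum c g m false
    ≡ (dil (negArg (counts c)) ⊗ (counts (g true) ⊕ ⊖ counts (g false))) m
  bracketSum-signed c g zero =
    trans (cong₂ (λ x y → x + - y) (ℤ.pos-* (c 0) (g true 0)) (ℤ.pos-* (c 0) (g false 0))) (factor₀ (+ c 0) (+ g true 0) (+ g false 0))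
    where
    factor₀ : ∀ c t f → c * t + - (c * f) ≡ c * (t + - f) + + 0
    factor₀ = solve-∀
  bracketSum-signed c g (suc zero) =
    trans (cong₂ (λ x y → x + - y) (ℤ.pos-* (c 0) (g true 1)) (ℤ.pos-* (c 0) (g false 1))) (begin
    + c 0 * + g true 1 + - (+ c 0 * + g false 1)        ≡⟨ factor₁ (+ c 0) (+ g true 1) (+ g false 1) (+ g true 0 + - + g false 0) ⟩
    + c 0 * (+ g true 1 + - + g false 1) + (- + 0 * (+ g true 0 + - + g false 0) + + 0)
      ≡⟨ sym (⊗-suc (dil (negArg (counts c))) (counts (g true) ⊕ ⊖ counts (g false)) 0) ⟩
    (dil (negArg (counts c)) ⊗ (counts (g true) ⊕ ⊖ counts (g false))) 1 ∎)
    where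
    open ≡-Reasoning
    factor₁ : ∀ c t f s → c * t + - (c * f) ≡ c * (t + - f) + (- + 0 * s + + 0)
    factor₁ = solve-∀
  bracketSum-signed c g (suc (suc m)) = begin
    + (c 0 ℕ.* g true m+2 ℕ.+ bracketSum (c ∘ suc) g m false) + - + (c 0 ℕ.* g false m+2 ℕ.+ bracketSum (c ∘ suc) g m true)
      ≡⟨ cong₂ (λ x y → x + - y) (trans (ℤ.pos-+ (c 0 ℕ.* g true m+2) _) (cong (_+ + bracketSum (c ∘ suc) g m false) (ℤ.pos-* (c 0) _)))
                                 (trans (ℤ.pos-+ (c 0 ℕ.* g false m+2) _) (cong (_+ + bracketSum (c ∘ suc) g m true) (ℤ.pos-* (c 0) _))) ⟩
    (+ c 0 * + g true m+2 + + bracketSum (c ∘ suc) g m false) + - (+ c 0 * + g false m+2 + + bracketSum (c ∘ suc) g m true)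
      ≡⟨ regroup (+ c 0) (+ g true m+2) (+ bracketSum (c ∘ suc) g m false) (+ g false m+2) (+ bracketSum (c ∘ suc) g m true) ⟩
    + c 0 * (+ g true m+2 + - + g false m+2) + - (+ bracketSum (c ∘ suc) g m true + - + bracketSum (c ∘ suc) g m false)
      ≡⟨ cong (λ z → + c 0 * (+ g true m+2 + - + g false m+2) + - z) (bracketSum-signed (c ∘ suc) g m) ⟩
    + c 0 * (+ g true m+2 + - + g false m+2) + - (dil (negArg (counts (c ∘ suc))) ⊗ signed) m
      ≡⟨ cong (λ z → + c 0 * (+ g true m+2 + - + g false m+2) + z) (sym (coeff tail-step m)) ⟩
    + c 0 * (+ g true m+2 + - + g false m+2) + (dil (tail (negArg (counts c))) ⊗ signed) m
      ≡⟨ sym (dil⊗-suc-suc (negArg (counts c)) signed m) ⟩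
    (dil (negArg (counts c)) ⊗ signed) m+2 ∎
    where
    open ≡-Reasoning
    m+2 = suc (suc m)
    signed = counts (g true) ⊕ ⊖ counts (g false)
    regroup : ∀ c t s f s′ → (c * t + s) + - (c * f + s′) ≡ c * (t + - f) + - (s′ + - s)
    regroup = solve-∀
    tail-step : dil (tail (negArg (counts c))) ⊗ signed ≈ ⊖ (dil (negArg (counts (c ∘ suc))) ⊗ signed)
    tail-step = ≈-trans (⊗-congʳ signed (≈-trans (dil-cong (coeffwise (negArg-suc (counts c)))) (dil-⊖ _)))
                        (⊗-negˡ (dil (negArg (counts (c ∘ suc)))) signed)

  treeSeries evenSeries oddSeries : ℕ → Series
  treeSeries k = counts (treeCount k)
  evenSeries k = counts (involutionCount k true)
  oddSeries k = counts (involutionCount k false)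

  totalSeries signedSeries : ℕ → Series
  totalSeries k = evenSeries k ⊕ oddSeries k
  signedSeries k = evenSeries k ⊕ ⊖ oddSeries k

  treeSeries-zero : treeSeries 0 ≈ zeroS
  treeSeries-zero = coeffwise λ p → cong +_ (treeCount-zero p)

  treeSeries-suc : ∀ k → treeSeries (suc k) ≈ oneS ⊕ X ⊗ (treeSeries k ⊗ treeSeries (suc k))
  treeSeries-suc k = coeffwise λ
    { zero → sym (cong (_+_ (+ 1)) (X⊗-zero (treeSeries k ⊗ treeSeries (suc k))))
    ; (suc p) → begin
        + treeCount (suc k) (suc p)                                                  ≡⟨ cong +_ (treeCount-suc k p) ⟩
        + sum (map (λ i → treeCount k i ℕ.* treeCount (suc k) (p ∸ i)) (upTo (suc p))) ≡⟨ +-sum (upTo (suc p)) ⟩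
        (treeSeries k ⊗ treeSeries (suc k)) p                                        ≡⟨ sym (X⊗-suc (treeSeries k ⊗ treeSeries (suc k)) p) ⟩
        (X ⊗ (treeSeries k ⊗ treeSeries (suc k))) (suc p)                            ≡⟨ sym (ℤ.+-identityˡ _) ⟩
        (oneS ⊕ X ⊗ (treeSeries k ⊗ treeSeries (suc k))) (suc p)                     ∎ }
    where
    open ≡-Reasoning
    +-sum : ∀ {p} l → + sum (map (λ i → treeCount k i ℕ.* treeCount (suc k) (p ∸ i)) l)
                      ≡ sumℤ (map (λ i → treeSeries k i * treeSeries (suc k) (p ∸ i)) l)
    +-sum [] = refl
    +-sum {p} (i ∷ l) = trans (ℤ.pos-+ (treeCount k i ℕ.* treeCount (suc k) (p ∸ i)) _)
                              (cong₂ _+_ (ℤ.pos-* (treeCount k i) _) (+-sum l))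

  X⊗X⊗-zero : ∀ h → (X ⊗ (X ⊗ h)) 0 ≡ + 0
  X⊗X⊗-zero h = X⊗-zero (X ⊗ h)

  X⊗X⊗-one : ∀ h → (X ⊗ (X ⊗ h)) 1 ≡ + 0
  X⊗X⊗-one h = trans (X⊗-suc (X ⊗ h) 0) (X⊗-zero h)

  X⊗X⊗-suc-suc : ∀ h n → (X ⊗ (X ⊗ h)) (suc (suc n)) ≡ h n
  X⊗X⊗-suc-suc h n = trans (X⊗-suc (X ⊗ h) (suc n)) (X⊗-suc h n)

  -- bracket a g flips the inversion parity of g exactly when size a is even.
  totalSeries-suc : ∀ k → totalSeries (suc k) ≈ oneS ⊕ X ⊗ totalSeries k ⊕ X ⊗ (X ⊗ (dil (treeSeries k) ⊗ totalSeries (suc k)))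
  totalSeries-suc k = coeffwise λ
    { zero → sym (cong₂ (λ x y → (+ 1 + x) + y) (X⊗-zero (totalSeries k)) (X⊗X⊗-zero (dil (treeSeries k) ⊗ totalSeries (suc k))))
    ; (suc zero) → trans (cong₂ (λ x y → + x + + y) (involutionCount-one k true) (involutionCount-one k false))
        (sym (trans (cong₂ (λ x y → (+ 0 + x) + y) (X⊗-suc (totalSeries k) 0) (X⊗X⊗-one (dil (treeSeries k) ⊗ totalSeries (suc k))))
                    (trans (ℤ.+-identityʳ _) (ℤ.+-identityˡ _))))
    ; (suc (suc n)) → begin
        + involutionCount (suc k) true (suc (suc n)) + + involutionCount (suc k) false (suc (suc n))
          ≡⟨ cong₂ (λ x y → + x + + y) (involutionCount-suc-suc k true n) (involutionCount-suc-suc k false n) ⟩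
        + (involutionCount k true (suc n) ℕ.+ s n false) + + (involutionCount k false (suc n) ℕ.+ s n true)
          ≡⟨ cong₂ _+_ (ℤ.pos-+ (involutionCount k true (suc n)) (s n false)) (ℤ.pos-+ (involutionCount k false (suc n)) (s n true)) ⟩
        (evenSeries k (suc n) + + s n false) + (oddSeries k (suc n) + + s n true)
          ≡⟨ regroup (evenSeries k (suc n)) (+ s n false) (oddSeries k (suc n)) (+ s n true) ⟩
        (+ 0 + totalSeries k (suc n)) + + (s n true ℕ.+ s n false)
          ≡⟨ cong₂ (λ x y → (+ 0 + x) + y) (sym (X⊗-suc (totalSeries k) (suc n)))
                   (trans (bracketSum-total (treeCount k) (involutionCount (suc k)) n) (sym (X⊗X⊗-suc-suc (dil (treeSeries k) ⊗ totalSeries (suc k)) n))) ⟩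
        (oneS ⊕ X ⊗ totalSeries k ⊕ X ⊗ (X ⊗ (dil (treeSeries k) ⊗ totalSeries (suc k)))) (suc (suc n)) ∎ }
    where
    open ≡-Reasoning
    s : ℕ → Bool → ℕ
    s = bracketSum (treeCount k) (involutionCount (suc k))
    regroup : ∀ e s′ o s″ → (e + s′) + (o + s″) ≡ (+ 0 + (e + o)) + (s″ + s′)
    regroup = solve-∀

  signedSeries-suc : ∀ k → signedSeries (suc k)
    ≈ oneS ⊕ X ⊗ signedSeries k ⊕ ⊖ (X ⊗ (X ⊗ (dil (negArg (treeSeries k)) ⊗ signedSeries (suc k))))
  signedSeries-suc k = coeffwise λ
    { zero → sym (cong₂ (λ x y → (+ 1 + x) + - y) (X⊗-zero (signedSeries k)) (X⊗X⊗-zero (dil (negArg (treeSeries k)) ⊗ signedSeries (suc k))))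
    ; (suc zero) → trans (cong₂ (λ x y → + x + - + y) (involutionCount-one k true) (involutionCount-one k false))
        (sym (trans (cong₂ (λ x y → (+ 0 + x) + - y) (X⊗-suc (signedSeries k) 0) (X⊗X⊗-one (dil (negArg (treeSeries k)) ⊗ signedSeries (suc k))))
                    (trans (ℤ.+-identityʳ _) (ℤ.+-identityˡ _))))
    ; (suc (suc n)) → begin
        + involutionCount (suc k) true (suc (suc n)) + - + involutionCount (suc k) false (suc (suc n))
          ≡⟨ cong₂ (λ x y → + x + - + y) (involutionCount-suc-suc k true n) (involutionCount-suc-suc k false n) ⟩
        + (involutionCount k true (suc n) ℕ.+ s n false) + - + (involutionCount k false (suc n) ℕ.+ s n true)
          ≡⟨ cong₂ (λ x y → x + - y) (ℤ.pos-+ (involutionCount k true (suc n)) (s n false)) (ℤ.pos-+ (involutionCount k false (suc n)) (s n true)) ⟩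
        (evenSeries k (suc n) + + s n false) + - (oddSeries k (suc n) + + s n true)
          ≡⟨ regroup (evenSeries k (suc n)) (+ s n false) (oddSeries k (suc n)) (+ s n true) ⟩
        (+ 0 + signedSeries k (suc n)) + - (+ s n true + - + s n false)
          ≡⟨ cong₂ (λ x y → (+ 0 + x) + - y) (sym (X⊗-suc (signedSeries k) (suc n)))
                   (trans (bracketSum-signed (treeCount k) (involutionCount (suc k)) n) (sym (X⊗X⊗-suc-suc (dil (negArg (treeSeries k)) ⊗ signedSeries (suc k)) n))) ⟩
        (oneS ⊕ X ⊗ signedSeries k ⊕ ⊖ (X ⊗ (X ⊗ (dil (negArg (treeSeries k)) ⊗ signedSeries (suc k))))) (suc (suc n)) ∎ }
    where
    open ≡-Reasoning
    s : ℕ → Bool → ℕ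
    s = bracketSum (treeCount k) (involutionCount (suc k))
    regroup : ∀ e s′ o s″ → (e + s′) + - (o + s″) ≡ (+ 0 + (e + - o)) + - (s″ + - s′)
    regroup = solve-∀

  Q-zero : ∀ k → Q (suc k) 0 ≡ + 1
  Q-zero zero = refl
  Q-zero (suc k) = cong₂ (λ a b → a + - b) (Q-zero k) (X⊗-zero (Q k))

  -- Read off from the Chebyshev recurrence Q (j+2) = Q (j+1) - x Q j.
  R-suc : ∀ j → R (suc j) ⊗ (oneS ⊕ ⊖ (X ⊗ R j)) ≈ oneS
  R-suc j = begin
    (q₁ ⊗ i₂) ⊗ (oneS ⊕ ⊖ (X ⊗ (q₀ ⊗ i₁)))  ≈⟨ expand q₁ i₂ X q₀ i₁ ⟩
    i₂ ⊗ (q₁ ⊕ ⊖ (X ⊗ q₀ ⊗ (q₁ ⊗ i₁)))      ≈⟨ ⊗-congˡ i₂ (⊕-congˡ q₁ (⊖-cong (⊗-congˡ (X ⊗ q₀) (inv1-inverseʳ q₁ (Q-zero j))))) ⟩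
    i₂ ⊗ (q₁ ⊕ ⊖ (X ⊗ q₀ ⊗ oneS))           ≈⟨ ⊗-congˡ i₂ (⊕-congˡ q₁ (⊖-cong (⊗-identityʳ (X ⊗ q₀)))) ⟩
    i₂ ⊗ q₂                                  ≈⟨ ⊗-comm i₂ q₂ ⟩
    q₂ ⊗ i₂                                  ≈⟨ inv1-inverseʳ q₂ (Q-zero (suc j)) ⟩
    oneS                                     ∎
    where
    open import Relation.Binary.Reasoning.Setoid ≈-setoid
    q₀ = Q j
    q₁ = Q (suc j)
    q₂ = Q (suc (suc j))
    i₁ = inv1 q₁
    i₂ = inv1 q₂
    expand : ∀ q₁ i₂ x q₀ i₁ → (q₁ ⊗ i₂) ⊗ (oneS ⊕ ⊖ (x ⊗ (q₀ ⊗ i₁))) ≈ i₂ ⊗ (q₁ ⊕ ⊖ (x ⊗ q₀ ⊗ (q₁ ⊗ i₁)))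
    expand = solve 5 (λ q₁ i₂ x q₀ i₁ → (q₁ :* i₂) :* (con (+ 1) :- x :* (q₀ :* i₁)) := i₂ :* (q₁ :- x :* q₀ :* (q₁ :* i₁))) ≈-refl

  R-suc-image : ∀ {φ} → IsRingHomomorphism seriesRawRing seriesRawRing φ →
    ∀ j → φ (R (suc j)) ⊗ (oneS ⊕ ⊖ (φ X ⊗ φ (R j))) ≈ oneS
  R-suc-image {φ} φ-hom j = begin
    φ (R (suc j)) ⊗ (oneS ⊕ ⊖ (φ X ⊗ φ (R j)))      ≈⟨ ⊗-congˡ (φ (R (suc j))) (⊕-cong (≈-sym 1#-homo) (⊖-cong (≈-sym (*-homo X (R j))))) ⟩
    φ (R (suc j)) ⊗ (φ oneS ⊕ ⊖ φ (X ⊗ R j))        ≈⟨ ⊗-congˡ (φ (R (suc j))) (⊕-congˡ (φ oneS) (≈-sym (-‿homo (X ⊗ R j)))) ⟩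
    φ (R (suc j)) ⊗ (φ oneS ⊕ φ (⊖ (X ⊗ R j)))      ≈⟨ ⊗-congˡ (φ (R (suc j))) (≈-sym (+-homo oneS (⊖ (X ⊗ R j)))) ⟩
    φ (R (suc j)) ⊗ φ (oneS ⊕ ⊖ (X ⊗ R j))          ≈⟨ ≈-sym (*-homo (R (suc j)) (oneS ⊕ ⊖ (X ⊗ R j))) ⟩
    φ (R (suc j) ⊗ (oneS ⊕ ⊖ (X ⊗ R j)))            ≈⟨ ⟦⟧-cong (R-suc j) ⟩
    φ oneS                                          ≈⟨ 1#-homo ⟩
    oneS                                            ∎
    where
    open import Relation.Binary.Reasoning.Setoid ≈-setoid
    open IsRingHomomorphism φ-hom

  inverses-unique : ∀ {u f g} → u 0 ≡ + 1 → f ⊗ u ≈ oneS → g ⊗ u ≈ oneS → f ≈ g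
  inverses-unique {u} {f} {g} u₀ fu≈1 gu≈1 = ≈-trans (inv1-unique u f u₀ fu≈1) (≈-sym (inv1-unique u g u₀ gu≈1))

  treeSeries≈R : ∀ k → treeSeries k ≈ R k
  treeSeries≈R zero = ≈-trans treeSeries-zero (≈-sym (⊗-zeroˡ (inv1 (Q 1))))
  treeSeries≈R (suc k) = inverses-unique (cong (λ z → + 1 + - z) (X⊗-zero (R k))) C′⊗u≈1 (R-suc k)
    where
    open import Relation.Binary.Reasoning.Setoid ≈-setoid
    C = treeSeries k
    C′ = treeSeries (suc k)
    cancel : ∀ x c c′ → c′ ⊗ (oneS ⊕ ⊖ (x ⊗ c)) ≈ c′ ⊕ ⊖ (x ⊗ (c ⊗ c′))
    cancel = solve 3 (λ x c c′ → c′ :* (con (+ 1) :- x :* c) := c′ :- x :* (c :* c′)) ≈-refl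
    C′⊗u≈1 : C′ ⊗ (oneS ⊕ ⊖ (X ⊗ R k)) ≈ oneS
    C′⊗u≈1 = begin
      C′ ⊗ (oneS ⊕ ⊖ (X ⊗ R k))                          ≈⟨ ⊗-congˡ C′ (⊕-congˡ oneS (⊖-cong (⊗-congˡ X (≈-sym (treeSeries≈R k))))) ⟩
      C′ ⊗ (oneS ⊕ ⊖ (X ⊗ C))                            ≈⟨ cancel X C C′ ⟩
      C′ ⊕ ⊖ (X ⊗ (C ⊗ C′))                              ≈⟨ ⊕-cong (treeSeries-suc k) ≈-refl ⟩
      oneS ⊕ X ⊗ (C ⊗ C′) ⊕ ⊖ (X ⊗ (C ⊗ C′))             ≈⟨ solve 1 (λ y → con (+ 1) :+ y :- y := con (+ 1)) ≈-refl (X ⊗ (C ⊗ C′)) ⟩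
      oneS                                               ∎

  linear-solution : ∀ {Y A D w} → Y ≈ A ⊕ D ⊗ Y → w ⊗ (oneS ⊕ ⊖ D) ≈ oneS → Y ≈ w ⊗ A
  linear-solution {Y} {A} {D} {w} Y≈ w-inverse = ≈-sym (begin
    w ⊗ A                      ≈⟨ ⊗-congˡ w (solve 3 (λ y a d → a := (a :+ d :* y) :- d :* y) ≈-refl Y A D) ⟩
    w ⊗ (A ⊕ D ⊗ Y ⊕ ⊖ (D ⊗ Y)) ≈⟨ ⊗-congˡ w (⊕-cong (≈-sym Y≈) ≈-refl) ⟩
    w ⊗ (Y ⊕ ⊖ (D ⊗ Y))        ≈⟨ solve 3 (λ w y d → w :* (y :- d :* y) := y :* (w :* (con (+ 1) :- d))) ≈-refl w Y D ⟩
    Y ⊗ (w ⊗ (oneS ⊕ ⊖ D))     ≈⟨ ⊗-congˡ Y w-inverse ⟩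
    Y ⊗ oneS                   ≈⟨ ⊗-identityʳ Y ⟩
    Y                          ∎)
    where open import Relation.Binary.Reasoning.Setoid ≈-setoid

  totalSeries-closed : ∀ k → totalSeries (suc k) ≈ dil (R (suc k)) ⊗ (oneS ⊕ X ⊗ totalSeries k)
  totalSeries-closed k = linear-solution {D = dil X ⊗ dil (R k)} {w = dil (R (suc k))} equation (R-suc-image dil-isRingHomomorphism k)
    where
    open import Relation.Binary.Reasoning.Setoid ≈-setoid
    T = totalSeries k
    T′ = totalSeries (suc k)
    equation : T′ ≈ (oneS ⊕ X ⊗ T) ⊕ (dil X ⊗ dil (R k)) ⊗ T′
    equation = begin
      T′                                                   ≈⟨ totalSeries-suc k ⟩
      oneS ⊕ X ⊗ T ⊕ X ⊗ (X ⊗ (dil (treeSeries k) ⊗ T′))   ≈⟨ solve 4 (λ a x c t → a :+ x :* (x :* (c :* t)) := a :+ (x :* x :* c) :* t) ≈-refl (oneS ⊕ X ⊗ T) X (dil (treeSeries k)) T′ ⟩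
      oneS ⊕ X ⊗ T ⊕ (X ⊗ X ⊗ dil (treeSeries k)) ⊗ T′     ≈⟨ ⊕-congˡ (oneS ⊕ X ⊗ T) (⊗-congʳ T′ (⊗-cong (≈-sym dil-X) (dil-cong (treeSeries≈R k)))) ⟩
      oneS ⊕ X ⊗ T ⊕ (dil X ⊗ dil (R k)) ⊗ T′              ∎

  signedSeries-closed : ∀ k → signedSeries (suc k) ≈ atNegSq (R (suc k)) ⊗ (oneS ⊕ X ⊗ signedSeries k)
  signedSeries-closed k = linear-solution {D = atNegSq X ⊗ atNegSq (R k)} {w = atNegSq (R (suc k))} equation (R-suc-image atNegSq-isRingHomomorphism k)
    where
    open import Relation.Binary.Reasoning.Setoid ≈-setoid
    P = signedSeries k
    P′ = signedSeries (suc k)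
    equation : P′ ≈ (oneS ⊕ X ⊗ P) ⊕ (atNegSq X ⊗ atNegSq (R k)) ⊗ P′
    equation = begin
      P′                                                            ≈⟨ signedSeries-suc k ⟩
      oneS ⊕ X ⊗ P ⊕ ⊖ (X ⊗ (X ⊗ (atNegSq (treeSeries k) ⊗ P′)))    ≈⟨ solve 4 (λ a x c t → a :- x :* (x :* (c :* t)) := a :+ (:- (x :* x) :* c) :* t) ≈-refl (oneS ⊕ X ⊗ P) X (atNegSq (treeSeries k)) P′ ⟩
      oneS ⊕ X ⊗ P ⊕ (⊖ (X ⊗ X) ⊗ atNegSq (treeSeries k)) ⊗ P′      ≈⟨ ⊕-congˡ (oneS ⊕ X ⊗ P) (⊗-congʳ P′ (⊗-cong (≈-sym atNegSq-X) (dil-cong (negArg-cong (treeSeries≈R k))))) ⟩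
      oneS ⊕ X ⊗ P ⊕ (atNegSq X ⊗ atNegSq (R k)) ⊗ P′               ∎

  totalSeries-zero : totalSeries 0 ≈ zeroS
  totalSeries-zero = coeffwise λ n → cong₂ (λ x y → + x + + y) (involutionCount-zero true n) (involutionCount-zero false n)

  signedSeries-zero : signedSeries 0 ≈ zeroS
  signedSeries-zero = coeffwise λ n → cong₂ (λ x y → + x + - + y) (involutionCount-zero true n) (involutionCount-zero false n)

  R⊗Q : ∀ k → R k ⊗ Q (suc k) ≈ Q k
  R⊗Q k = ≈-trans (⊗-assoc (Q k) (inv1 (Q (suc k))) (Q (suc k)))
    (≈-trans (⊗-congˡ (Q k) (≈-trans (⊗-comm (inv1 (Q (suc k))) (Q (suc k))) (inv1-inverseʳ (Q (suc k)) (Q-zero k))))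
             (⊗-identityʳ (Q k)))

  Fnumerator : ℕ → Series
  Fnumerator m = sumOver (upTo m) (λ j → shiftS (m ∸ 1 ∸ j) (dil (Q (suc j))))

  Fnumerator-suc : ∀ m → Fnumerator (suc m) ≈ dil (Q (suc m)) ⊕ X ⊗ Fnumerator m
  Fnumerator-suc m = begin
    sumOver (upTo (suc m)) t                 ≈⟨ coeffwise (λ n → cong (λ l → sumOver l t n) (sym (List.upTo-∷ʳ m))) ⟩
    sumOver (upTo m ++ [ m ]) t              ≈⟨ sumOver-++ (upTo m) [ m ] t ⟩
    sumOver (upTo m) t ⊕ (t m ⊕ zeroS)       ≈⟨ ⊕-cong earlier-terms (coeffwise λ n → trans (ℤ.+-identityʳ (t m n)) (cong (λ r → shiftS r (dil (Q (suc m))) n) (ℕ.n∸n≡0 m))) ⟩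
    X ⊗ Fnumerator m ⊕ dil (Q (suc m))       ≈⟨ coeffwise (λ n → ℤ.+-comm ((X ⊗ Fnumerator m) n) (dil (Q (suc m)) n)) ⟩
    dil (Q (suc m)) ⊕ X ⊗ Fnumerator m       ∎
    where
    open import Relation.Binary.Reasoning.Setoid ≈-setoid
    t : ℕ → Series
    t j = shiftS (m ∸ j) (dil (Q (suc j)))
    earlier-terms : sumOver (upTo m) t ≈ X ⊗ Fnumerator m
    earlier-terms = ≈-trans (sumOver-cong (upTo m) λ {j} j∈ →
        ≈-trans (coeffwise λ n → cong (λ r → shiftS r (dil (Q (suc j))) n) (m∸j≡1+m∸1∸j (∈-upTo⁻ j∈))) (shiftS-suc (m ∸ 1 ∸ j) (dil (Q (suc j)))))
      (sumOver-⊗ˡ (upTo m) X (λ j → shiftS (m ∸ 1 ∸ j) (dil (Q (suc j)))))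
      where
      m∸j≡1+m∸1∸j : ∀ {m j} → j ℕ.< m → m ∸ j ≡ suc (m ∸ 1 ∸ j)
      m∸j≡1+m∸1∸j {suc m} (ℕ.s≤s j≤m) = ℕ.+-∸-assoc 1 j≤m

  totalSeries⊗denominator : ∀ m → totalSeries m ⊗ dil (Q (suc m)) ≈ Fnumerator m
  totalSeries⊗denominator zero = ≈-trans (⊗-congʳ (dil (Q 1)) totalSeries-zero) (⊗-zeroˡ (dil (Q 1)))
  totalSeries⊗denominator (suc m) = begin
    T′ ⊗ dil (Q (suc (suc m)))                            ≈⟨ ⊗-congʳ (dil (Q (suc (suc m)))) (totalSeries-closed m) ⟩
    dil (R (suc m)) ⊗ (oneS ⊕ X ⊗ T) ⊗ dil (Q (suc (suc m))) ≈⟨ solve 3 (λ r u q → r :* u :* q := r :* q :* u) ≈-refl (dil (R (suc m))) (oneS ⊕ X ⊗ T) (dil (Q (suc (suc m)))) ⟩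
    dil (R (suc m)) ⊗ dil (Q (suc (suc m))) ⊗ (oneS ⊕ X ⊗ T) ≈⟨ ⊗-congʳ (oneS ⊕ X ⊗ T) (≈-trans (≈-sym (dil-⊗ (R (suc m)) (Q (suc (suc m))))) (dil-cong (R⊗Q (suc m)))) ⟩
    dil (Q (suc m)) ⊗ (oneS ⊕ X ⊗ T)                     ≈⟨ solve 3 (λ q x t → q :* (con (+ 1) :+ x :* t) := q :+ x :* (t :* q)) ≈-refl (dil (Q (suc m))) X T ⟩
    dil (Q (suc m)) ⊕ X ⊗ (T ⊗ dil (Q (suc m)))          ≈⟨ ⊕-congˡ (dil (Q (suc m))) (⊗-congˡ X (totalSeries⊗denominator m)) ⟩
    dil (Q (suc m)) ⊕ X ⊗ Fnumerator m                   ≈⟨ ≈-sym (Fnumerator-suc m) ⟩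
    Fnumerator (suc m)                                   ∎
    where
    open import Relation.Binary.Reasoning.Setoid ≈-setoid
    T = totalSeries m
    T′ = totalSeries (suc m)

  F≈totalSeries : ∀ m → F m ≈ totalSeries m
  F≈totalSeries m = begin
    Fnumerator m ⊗ inv1 (dil (Q (suc m)))                      ≈⟨ ⊗-congʳ (inv1 (dil (Q (suc m)))) (≈-sym (totalSeries⊗denominator m)) ⟩
    totalSeries m ⊗ dil (Q (suc m)) ⊗ inv1 (dil (Q (suc m)))   ≈⟨ ⊗-assoc (totalSeries m) _ _ ⟩
    totalSeries m ⊗ (dil (Q (suc m)) ⊗ inv1 (dil (Q (suc m)))) ≈⟨ ⊗-congˡ (totalSeries m) (inv1-inverseʳ (dil (Q (suc m))) (Q-zero m)) ⟩
    totalSeries m ⊗ oneS                                       ≈⟨ ⊗-identityʳ (totalSeries m) ⟩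
    totalSeries m                                              ∎
    where open import Relation.Binary.Reasoning.Setoid ≈-setoid

  tailProduct : ℕ → ℕ → Series
  tailProduct k j = prodOver (map ((k ∸ j) ℕ.+_) (upTo (suc j))) (λ i → atNegSq (R i))

  tailProduct-zero : ∀ k → tailProduct k 0 ≈ atNegSq (R k)
  tailProduct-zero k = ≈-trans (⊗-identityʳ (atNegSq (R (k ℕ.+ 0)))) (coeffwise λ n → cong (λ i → atNegSq (R i) n) (ℕ.+-identityʳ k))

  tailProduct-suc : ∀ k j → j ℕ.≤ k → tailProduct (suc k) (suc j) ≈ tailProduct k j ⊗ atNegSq (R (suc k))
  tailProduct-suc k j j≤k = begin
    prodOver (map shift (upTo (suc (suc j)))) b            ≈⟨ coeffwise (λ n → cong (λ l → prodOver l b n) (trans (cong (map shift) (sym (List.upTo-∷ʳ (suc j)))) (List.map-++ shift (upTo (suc j)) [ suc j ]))) ⟩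
    prodOver (map shift (upTo (suc j)) ∷ʳ shift (suc j)) b ≈⟨ prodOver-∷ʳ (map shift (upTo (suc j))) (shift (suc j)) b ⟩
    tailProduct k j ⊗ b (shift (suc j))                     ≈⟨ coeffwise (λ n → cong (λ i → (tailProduct k j ⊗ b i) n) (trans (ℕ.+-suc (k ∸ j) j) (cong suc (ℕ.m∸n+n≡m j≤k)))) ⟩
    tailProduct k j ⊗ b (suc k)                             ∎
    where
    open import Relation.Binary.Reasoning.Setoid ≈-setoid
    shift = (k ∸ j) ℕ.+_
    b = λ i → atNegSq (R i)

  signedExpansion : ℕ → Series
  signedExpansion k = sumOver (upTo k) (λ j → X^ j ⊗ tailProduct k j)

  signedExpansion-suc : ∀ k → signedExpansion (suc k) ≈ atNegSq (R (suc k)) ⊗ (oneS ⊕ X ⊗ signedExpansion k)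
  signedExpansion-suc k = begin
    signedExpansion (suc k)                                           ≈⟨ sumOver-upTo-suc k (λ j → X^ j ⊗ tailProduct (suc k) j) ⟩
    oneS ⊗ tailProduct (suc k) 0 ⊕ sumOver (upTo k) (λ j → X^ suc j ⊗ tailProduct (suc k) (suc j))
      ≈⟨ ⊕-cong (⊗-congˡ oneS (tailProduct-zero (suc k))) (sumOver-cong (upTo k) λ {j} j∈ →
           ≈-trans (⊗-congˡ (X^ suc j) (tailProduct-suc k j (ℕ.<⇒≤ (∈-upTo⁻ j∈))))
                   (solve 4 (λ x p q b → (x :* p) :* (q :* b) := (b :* x) :* (p :* q)) ≈-refl X (X^ j) (tailProduct k j) b′)) ⟩
    oneS ⊗ b′ ⊕ sumOver (upTo k) (λ j → (b′ ⊗ X) ⊗ (X^ j ⊗ tailProduct k j)) ≈⟨ ⊕-congˡ (oneS ⊗ b′) (sumOver-⊗ˡ (upTo k) (b′ ⊗ X) (λ j → X^ j ⊗ tailProduct k j)) ⟩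
    oneS ⊗ b′ ⊕ (b′ ⊗ X) ⊗ signedExpansion k                           ≈⟨ solve 3 (λ b x s → con (+ 1) :* b :+ (b :* x) :* s := b :* (con (+ 1) :+ x :* s)) ≈-refl b′ X (signedExpansion k) ⟩
    b′ ⊗ (oneS ⊕ X ⊗ signedExpansion k)                                ∎
    where
    open import Relation.Binary.Reasoning.Setoid ≈-setoid
    b′ = atNegSq (R (suc k))

  signedSeries≈signedExpansion : ∀ k → signedSeries k ≈ signedExpansion k
  signedSeries≈signedExpansion zero = signedSeries-zero
  signedSeries≈signedExpansion (suc k) =
    ≈-trans (signedSeries-closed k)
            (≈-trans (⊗-congˡ (atNegSq (R (suc k))) (⊕-congˡ oneS (⊗-congˡ X (signedSeries≈signedExpansion k))))
                     (≈-sym (signedExpansion-suc k)))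

  -- totalSeries k - signedSeries k, i.e. twice the odd part, expanded like signedExpansion.
  correctionTerm : ℕ → ℕ → Series
  correctionTerm k j = X^ j ⊗ (X ⊗ X ⊗ ((dil (R i) ⊕ atNegSq (R i)) ⊗ (totalSeries (k ∸ j) ⊗ tailProduct k j)))
    where i = k ∸ 1 ∸ j

  correction : ℕ → Series
  correction k = sumOver (upTo k) (correctionTerm k)

  correction-suc : ∀ k → correction (suc k)
    ≈ X ⊗ X ⊗ ((dil (R k) ⊕ atNegSq (R k)) ⊗ (totalSeries (suc k) ⊗ atNegSq (R (suc k)))) ⊕ (atNegSq (R (suc k)) ⊗ X) ⊗ correction k
  correction-suc k = begin
    correction (suc k)                                                       ≈⟨ sumOver-upTo-suc k (correctionTerm (suc k)) ⟩
    correctionTerm (suc k) 0 ⊕ sumOver (upTo k) (correctionTerm (suc k) ∘ suc) ≈⟨ ⊕-cong first-term (sumOver-cong (upTo k) (λ j∈ → later-term (∈-upTo⁻ j∈))) ⟩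
    X ⊗ X ⊗ (ab k ⊗ (T′ ⊗ b′)) ⊕ sumOver (upTo k) (λ j → (b′ ⊗ X) ⊗ correctionTerm k j) ≈⟨ ⊕-congˡ (X ⊗ X ⊗ (ab k ⊗ (T′ ⊗ b′))) (sumOver-⊗ˡ (upTo k) (b′ ⊗ X) (correctionTerm k)) ⟩
    X ⊗ X ⊗ (ab k ⊗ (T′ ⊗ b′)) ⊕ (b′ ⊗ X) ⊗ correction k                      ∎
    where
    open import Relation.Binary.Reasoning.Setoid ≈-setoid
    ab : ℕ → Series
    ab i = dil (R i) ⊕ atNegSq (R i)
    T′ = totalSeries (suc k)
    b′ = atNegSq (R (suc k))
    first-term : correctionTerm (suc k) 0 ≈ X ⊗ X ⊗ (ab k ⊗ (T′ ⊗ b′))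
    first-term = ≈-trans (⊗-identityˡ _) (⊗-congˡ (X ⊗ X) (⊗-congˡ (ab k) (⊗-congˡ T′ (tailProduct-zero (suc k)))))
    later-term : ∀ {j} → j ℕ.< k → correctionTerm (suc k) (suc j) ≈ (b′ ⊗ X) ⊗ correctionTerm k j
    later-term {j} j<k = begin
      X^ suc j ⊗ (X ⊗ X ⊗ (ab (k ∸ suc j) ⊗ (totalSeries (k ∸ j) ⊗ tailProduct (suc k) (suc j))))
        ≈⟨ coeffwise (λ n → cong (λ i → (X^ suc j ⊗ (X ⊗ X ⊗ (ab i ⊗ (totalSeries (k ∸ j) ⊗ tailProduct (suc k) (suc j))))) n) (sym (ℕ.∸-+-assoc k 1 j))) ⟩
      X^ suc j ⊗ (X ⊗ X ⊗ (ab (k ∸ 1 ∸ j) ⊗ (totalSeries (k ∸ j) ⊗ tailProduct (suc k) (suc j))))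
        ≈⟨ ⊗-congˡ (X^ suc j) (⊗-congˡ (X ⊗ X) (⊗-congˡ (ab (k ∸ 1 ∸ j)) (⊗-congˡ (totalSeries (k ∸ j)) (tailProduct-suc k j (ℕ.<⇒≤ j<k))))) ⟩
      (X ⊗ X^ j) ⊗ (X ⊗ X ⊗ (ab (k ∸ 1 ∸ j) ⊗ (totalSeries (k ∸ j) ⊗ (tailProduct k j ⊗ b′))))
        ≈⟨ solve 6 (λ x p c t q b → (x :* p) :* (x :* x :* (c :* (t :* (q :* b)))) := (b :* x) :* (p :* (x :* x :* (c :* (t :* q))))) ≈-refl
                 X (X^ j) (ab (k ∸ 1 ∸ j)) (totalSeries (k ∸ j)) (tailProduct k j) b′ ⟩
      (b′ ⊗ X) ⊗ correctionTerm k j ∎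

  dilR-suc : ∀ k → dil (R (suc k)) ⊗ (oneS ⊕ ⊖ (X ⊗ X ⊗ dil (R k))) ≈ oneS
  dilR-suc k = ≈-trans (⊗-congˡ (dil (R (suc k))) (⊕-congˡ oneS (⊖-cong (⊗-congʳ (dil (R k)) (≈-sym dil-X)))))
                       (R-suc-image dil-isRingHomomorphism k)

  atNegSqR-suc : ∀ k → atNegSq (R (suc k)) ⊗ (oneS ⊕ X ⊗ X ⊗ atNegSq (R k)) ≈ oneS
  atNegSqR-suc k = ≈-trans (⊗-congˡ (atNegSq (R (suc k))) (begin
      oneS ⊕ X ⊗ X ⊗ atNegSq (R k)                ≈⟨ solve 2 (λ y b → con (+ 1) :+ y :* b := con (+ 1) :- (:- y) :* b) ≈-refl (X ⊗ X) (atNegSq (R k)) ⟩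
      oneS ⊕ ⊖ (⊖ (X ⊗ X) ⊗ atNegSq (R k))         ≈⟨ ⊕-congˡ oneS (⊖-cong (⊗-congʳ (atNegSq (R k)) (≈-sym atNegSq-X))) ⟩
      oneS ⊕ ⊖ (atNegSq X ⊗ atNegSq (R k))         ∎))
    (R-suc-image atNegSq-isRingHomomorphism k)
    where open import Relation.Binary.Reasoning.Setoid ≈-setoid

  totalSeries≈signedSeries⊕correction : ∀ k → totalSeries k ≈ signedSeries k ⊕ correction k
  totalSeries≈signedSeries⊕correction zero = ≈-trans totalSeries-zero (≈-sym (≈-trans (⊕-cong signedSeries-zero ≈-refl) (coeffwise λ _ → refl)))
  totalSeries≈signedSeries⊕correction (suc k) = ≈-sym (begin
    P′ ⊕ correction (suc k)                                          ≈⟨ ⊕-cong (signedSeries-closed k) (correction-suc k) ⟩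
    b′ ⊗ (oneS ⊕ X ⊗ P) ⊕ (X ⊗ X ⊗ (ab ⊗ (T′ ⊗ b′)) ⊕ (b′ ⊗ X) ⊗ correction k)
      ≈⟨ solve 6 (λ b x p t c s → b :* (con (+ 1) :+ x :* p) :+ (x :* x :* (c :* (t :* b)) :+ (b :* x) :* s)
                               := b :* (con (+ 1) :+ x :* (p :+ s)) :+ x :* x :* (c :* (t :* b))) ≈-refl b′ X P T′ ab (correction k) ⟩
    b′ ⊗ (oneS ⊕ X ⊗ (P ⊕ correction k)) ⊕ X ⊗ X ⊗ (ab ⊗ (T′ ⊗ b′))
      ≈⟨ ⊕-cong (⊗-congˡ b′ (⊕-congˡ oneS (⊗-congˡ X (≈-sym (totalSeries≈signedSeries⊕correction k)))))
                (⊗-congˡ (X ⊗ X) (⊗-congˡ ab (⊗-congʳ b′ (totalSeries-closed k)))) ⟩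
    b′ ⊗ U ⊕ X ⊗ X ⊗ (ab ⊗ ((a′ ⊗ U) ⊗ b′))
      ≈⟨ ⊕-cong (⊗-congʳ U (≈-trans (≈-sym (⊗-identityʳ b′)) (⊗-congˡ b′ (≈-sym (dilR-suc k))))) ≈-refl ⟩
    (b′ ⊗ (a′ ⊗ (oneS ⊕ ⊖ (X ⊗ X ⊗ a)))) ⊗ U ⊕ X ⊗ X ⊗ ((a ⊕ b) ⊗ ((a′ ⊗ U) ⊗ b′))
      ≈⟨ solve 6 (λ b′ a′ x a b u → (b′ :* (a′ :* (con (+ 1) :- x :* x :* a))) :* u :+ x :* x :* ((a :+ b) :* ((a′ :* u) :* b′))
                                  := (a′ :* (b′ :* (con (+ 1) :+ x :* x :* b))) :* u) ≈-refl b′ a′ X a b U ⟩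
    (a′ ⊗ (b′ ⊗ (oneS ⊕ X ⊗ X ⊗ b))) ⊗ U                          ≈⟨ ⊗-congʳ U (≈-trans (⊗-congˡ a′ (atNegSqR-suc k)) (⊗-identityʳ a′)) ⟩
    a′ ⊗ U                                                        ≈⟨ ≈-sym (totalSeries-closed k) ⟩
    totalSeries (suc k)                                           ∎)
    where
    open import Relation.Binary.Reasoning.Setoid ≈-setoid
    P = signedSeries k
    P′ = signedSeries (suc k)
    T′ = totalSeries (suc k)
    a = dil (R k)
    b = atNegSq (R k)
    ab = a ⊕ b
    a′ = dil (R (suc k))
    b′ = atNegSq (R (suc k))
    U = oneS ⊕ X ⊗ totalSeries k

  private
    rhsTerm : ℕ → ℕ → Series
    rhsTerm k j = shiftS j ((oneS ⊕ shiftS 2 (dil (Re (k ∸ 1 ∸ j)) ⊗ F (k ∸ j))) ⊗ tailProduct k j)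

  -- Doubling clears the ½ in Re: 2 Re i (x²) = R i (x²) + R i (-x²).
  rhsTerm-double : ∀ k j → rhsTerm k j ⊕ rhsTerm k j ≈ (X^ j ⊗ tailProduct k j ⊕ X^ j ⊗ tailProduct k j) ⊕ correctionTerm k j
  rhsTerm-double k j = begin
    rhsTerm k j ⊕ rhsTerm k j                                       ≈⟨ ⊕-cong term≈ term≈ ⟩
    W ⊕ W                                                           ≈⟨ solve 5 (λ p x d t q → p :* ((con (+ 1) :+ x :* x :* (d :* t)) :* q) :+ p :* ((con (+ 1) :+ x :* x :* (d :* t)) :* q)
                                                                                := (p :* q :+ p :* q) :+ p :* (x :* x :* ((d :+ d) :* (t :* q)))) ≈-refl (X^ j) X d (totalSeries m) π ⟩
    (X^ j ⊗ π ⊕ X^ j ⊗ π) ⊕ X^ j ⊗ (X ⊗ X ⊗ ((d ⊕ d) ⊗ (totalSeries m ⊗ π)))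
      ≈⟨ ⊕-congˡ (X^ j ⊗ π ⊕ X^ j ⊗ π) (⊗-congˡ (X^ j) (⊗-congˡ (X ⊗ X) (⊗-congʳ (totalSeries m ⊗ π) d⊕d≈))) ⟩
    (X^ j ⊗ π ⊕ X^ j ⊗ π) ⊕ correctionTerm k j                      ∎
    where
    open import Relation.Binary.Reasoning.Setoid ≈-setoid
    i = k ∸ 1 ∸ j
    m = k ∸ j
    π = tailProduct k j
    d = dil (Re i)
    W = X^ j ⊗ ((oneS ⊕ X ⊗ X ⊗ (d ⊗ totalSeries m)) ⊗ π)
    shift₂ : ∀ f → shiftS 2 f ≈ X ⊗ X ⊗ f
    shift₂ f = ≈-trans (shiftS≈X^⊗ 2 f) (solve 2 (λ x f → x :* (x :* con (+ 1)) :* f := x :* x :* f) ≈-refl X f)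
    term≈ : rhsTerm k j ≈ W
    term≈ = ≈-trans (shiftS≈X^⊗ j _) (⊗-congˡ (X^ j) (⊗-congʳ π (⊕-congˡ oneS
              (≈-trans (shift₂ (d ⊗ F m)) (⊗-congˡ (X ⊗ X) (⊗-congˡ d (F≈totalSeries m)))))))
    d⊕d≈ : d ⊕ d ≈ dil (R i) ⊕ atNegSq (R i)
    d⊕d≈ = ≈-trans (≈-sym (dil-⊕ (Re i) (Re i))) (≈-trans (dil-cong (evenPart-double (R i))) (dil-⊕ (R i) (negArg (R i))))

  rhs-double : ∀ k → rhs k ⊕ rhs k ≈ (signedExpansion k ⊕ signedExpansion k) ⊕ correction k
  rhs-double k = begin
    rhs k ⊕ rhs k                                                                       ≈⟨ ≈-sym (sumOver-⊕ (upTo k) (rhsTerm k) (rhsTerm k)) ⟩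
    sumOver (upTo k) (λ j → rhsTerm k j ⊕ rhsTerm k j)                                  ≈⟨ sumOver-cong (upTo k) (λ {j} _ → rhsTerm-double k j) ⟩
    sumOver (upTo k) (λ j → (X^ j ⊗ tailProduct k j ⊕ X^ j ⊗ tailProduct k j) ⊕ correctionTerm k j)
      ≈⟨ sumOver-⊕ (upTo k) (λ j → X^ j ⊗ tailProduct k j ⊕ X^ j ⊗ tailProduct k j) (correctionTerm k) ⟩
    sumOver (upTo k) (λ j → X^ j ⊗ tailProduct k j ⊕ X^ j ⊗ tailProduct k j) ⊕ correction k
      ≈⟨ ⊕-cong (sumOver-⊕ (upTo k) (λ j → X^ j ⊗ tailProduct k j) (λ j → X^ j ⊗ tailProduct k j)) ≈-refl ⟩
    (signedExpansion k ⊕ signedExpansion k) ⊕ correction k                              ∎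
    where open import Relation.Binary.Reasoning.Setoid ≈-setoid

  rhs≈evenSeries : ∀ k → rhs k ≈ evenSeries k
  rhs≈evenSeries k = coeffwise λ n → cancel-double (rhs k n) (evenSeries k n) (coeff double n)
    where
    open import Relation.Binary.Reasoning.Setoid ≈-setoid
    P = signedSeries k
    double : rhs k ⊕ rhs k ≈ evenSeries k ⊕ evenSeries k
    double = begin
      rhs k ⊕ rhs k                                     ≈⟨ rhs-double k ⟩
      (signedExpansion k ⊕ signedExpansion k) ⊕ correction k
        ≈⟨ ⊕-cong (⊕-cong (≈-sym (signedSeries≈signedExpansion k)) (≈-sym (signedSeries≈signedExpansion k))) ≈-refl ⟩
      (P ⊕ P) ⊕ correction k                            ≈⟨ solve 2 (λ p c → (p :+ p) :+ c := p :+ (p :+ c)) ≈-refl P (correction k) ⟩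
      P ⊕ (P ⊕ correction k)                            ≈⟨ ⊕-congˡ P (≈-sym (totalSeries≈signedSeries⊕correction k)) ⟩
      P ⊕ totalSeries k                                 ≈⟨ solve 2 (λ e o → (e :- o) :+ (e :+ o) := e :+ e) ≈-refl (evenSeries k) (oddSeries k) ⟩
      evenSeries k ⊕ evenSeries k                       ∎
    cancel-double : ∀ (x y : ℤ) → x + x ≡ y + y → x ≡ y
    cancel-double x y x+x≡y+y = ℤ.*-cancelˡ-≡ (+ 2) x y (trans (twice x) (trans x+x≡y+y (sym (twice y))))
      where
      twice : ∀ z → + 2 * z ≡ z + z
      twice = solve-∀


module PatternContainment where

  open import Defs using (subseqs; orderIso; contains; pat132; idPat; _==_)
  open import Data.Nat using (ℕ; zero; suc; _<_; _≤_; _<ᵇ_; _≡ᵇ_)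
  import Data.Nat.Properties as ℕ
  open import Data.Bool using (Bool; true; false; _∧_; not; T)
  import Data.Bool.Properties as Bool
  open import Data.Bool.ListAction using (all; any)
  open import Data.List using (List; []; _∷_; map; _++_; length; zip; upTo; applyUpTo)
  import Data.List.Properties as List
  open import Data.List.Membership.Propositional using (_∈_; find)
  open import Data.List.Membership.Propositional.Properties using (∈-++⁻; ∈-++⁺ˡ; ∈-++⁺ʳ; ∈-map⁻; ∈-map⁺)
  open import Data.List.Relation.Unary.Any using (here; there)
  import Data.List.Relation.Unary.Any.Properties as Any
  open import Data.List.Relation.Unary.All using (All; []; _∷_)
  open import Data.List.Relation.Unary.AllPairs using (AllPairs; []; _∷_)
  open import Data.List.Relation.Binary.Sublist.Propositional using (_⊆_; []; _∷_; _∷ʳ_)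
  open import Data.Product using (_×_; _,_; proj₁; proj₂; ∃; ∃₂)
  open import Data.Sum using (inj₁; inj₂)
  open import Function using (_∘_; id; _⇔_)
  open import Function.Bundles using (Equivalence)
  open import Relation.Binary.PropositionalEquality

  <ᵇ⇒< : ∀ {m n} → (m <ᵇ n) ≡ true → m < n
  <ᵇ⇒< {m} {n} m<ᵇn = ℕ.<ᵇ⇒< m n (subst T (sym m<ᵇn) _)

  <⇒<ᵇ : ∀ {m n} → m < n → (m <ᵇ n) ≡ true
  <⇒<ᵇ m<n = Equivalence.to Bool.T-≡ (ℕ.<⇒<ᵇ m<n)

  ≤⇒≮ᵇ : ∀ {m n} → n ≤ m → (m <ᵇ n) ≡ false
  ≤⇒≮ᵇ {m} {n} n≤m with m <ᵇ n in m<ᵇn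
  ... | true = ⊥-elim (ℕ.<⇒≱ (<ᵇ⇒< m<ᵇn) n≤m)
    where open import Data.Empty using (⊥-elim)
  ... | false = refl

  ∧-intro : ∀ {a b} → a ≡ true → b ≡ true → a ∧ b ≡ true
  ∧-intro refl refl = refl

  ∧-elim : ∀ {a b} → a ∧ b ≡ true → a ≡ true × b ≡ true
  ∧-elim {true} b≡true = refl , b≡true

  any≡true⁻ : ∀ {A : Set} (p : A → Bool) xs → any p xs ≡ true → ∃ λ x → x ∈ xs × p x ≡ true
  any≡true⁻ p xs any-p with find (Any.any⁻ p xs (Equivalence.from Bool.T-≡ any-p))
  ... | x , x∈ , px = x , x∈ , Equivalence.to Bool.T-≡ px

  any≡true⁺ : ∀ {A : Set} (p : A → Bool) {xs x} → x ∈ xs → p x ≡ true → any p xs ≡ true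
  any≡true⁺ p x∈ px = Equivalence.to Bool.T-≡ (Any.any⁺ p (Data.List.Relation.Unary.Any.map (λ { refl → Equivalence.from Bool.T-≡ px }) x∈))
    where import Data.List.Relation.Unary.Any

  all≡true⁻ : ∀ {A : Set} (p : A → Bool) xs → all p xs ≡ true → ∀ {x} → x ∈ xs → p x ≡ true
  all≡true⁻ p (y ∷ xs) all-p (here refl) = Bool.∧-conicalˡ (p y) _ all-p
  all≡true⁻ p (y ∷ xs) all-p (there x∈) = all≡true⁻ p xs (Bool.∧-conicalʳ (p y) _ all-p) x∈

  ∈-subseqs⁻ : ∀ l {s} → s ∈ subseqs l → s ⊆ l
  ∈-subseqs⁻ [] (here refl) = []
  ∈-subseqs⁻ (x ∷ l) s∈ with ∈-++⁻ (map (x ∷_) (subseqs l)) s∈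
  ... | inj₁ s∈₁ with ∈-map⁻ (x ∷_) s∈₁
  ...   | s′ , s′∈ , refl = refl ∷ ∈-subseqs⁻ l s′∈
  ∈-subseqs⁻ (x ∷ l) s∈ | inj₂ s∈₂ = x ∷ʳ ∈-subseqs⁻ l s∈₂

  ∈-subseqs⁺ : ∀ {l s} → s ⊆ l → s ∈ subseqs l
  ∈-subseqs⁺ [] = here refl
  ∈-subseqs⁺ (_∷ʳ_ {xs = s} {ys = l} x s⊆l) = ∈-++⁺ʳ (map (x ∷_) (subseqs l)) (∈-subseqs⁺ s⊆l)
  ∈-subseqs⁺ (refl ∷ s⊆l) = ∈-++⁺ˡ (∈-map⁺ (_ ∷_) (∈-subseqs⁺ s⊆l))

  contains⁻ : ∀ l τ → contains l τ ≡ true → ∃ λ s → s ⊆ l × orderIso τ s ≡ true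
  contains⁻ l τ l∋τ with any≡true⁻ (orderIso τ) (subseqs l) l∋τ
  ... | s , s∈ , τ≅s = s , ∈-subseqs⁻ l s∈ , τ≅s

  contains⁺ : ∀ {l} τ {s} → s ⊆ l → orderIso τ s ≡ true → contains l τ ≡ true
  contains⁺ τ s⊆l τ≅s = any≡true⁺ (orderIso τ) (∈-subseqs⁺ s⊆l) τ≅s

  sameOrder : ℕ × ℕ → ℕ × ℕ → Bool
  sameOrder p q = (proj₁ p <ᵇ proj₁ q) == (proj₂ p <ᵇ proj₂ q)

  orderIso⇒sameOrder : ∀ τ s → orderIso τ s ≡ true → ∀ {p q} → p ∈ zip τ s → q ∈ zip τ s → sameOrder p q ≡ true
  orderIso⇒sameOrder τ s τ≅s {p} p∈ q∈ =
    all≡true⁻ (sameOrder p) (zip τ s) (all≡true⁻ (λ p → all (sameOrder p) (zip τ s)) (zip τ s) (Bool.∧-conicalʳ _ _ τ≅s) p∈) q∈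

  Has132 : List ℕ → Set
  Has132 l = ∃ λ x → ∃₂ λ y z → x ∷ y ∷ z ∷ [] ⊆ l × x < z × z < y

  orderIso-132⁻ : ∀ s → orderIso pat132 s ≡ true → ∃ λ x → ∃₂ λ y z → s ≡ x ∷ y ∷ z ∷ [] × x < z × z < y
  orderIso-132⁻ (x ∷ y ∷ z ∷ []) 132≅s = x , y , z , refl ,
    <ᵇ⇒< (orderIso⇒sameOrder pat132 (x ∷ y ∷ z ∷ []) 132≅s {0 , x} {1 , z} (here refl) (there (there (here refl)))) ,
    <ᵇ⇒< (orderIso⇒sameOrder pat132 (x ∷ y ∷ z ∷ []) 132≅s {1 , z} {2 , y} (there (there (here refl))) (there (here refl)))

  orderIso-132⁺ : ∀ {x y z} → x < z → z < y → orderIso pat132 (x ∷ y ∷ z ∷ []) ≡ true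
  orderIso-132⁺ {x} {y} {z} x<z z<y
    rewrite ≤⇒≮ᵇ (ℕ.≤-refl {x}) | ≤⇒≮ᵇ (ℕ.≤-refl {y}) | ≤⇒≮ᵇ (ℕ.≤-refl {z})
          | <⇒<ᵇ x<z | <⇒<ᵇ z<y | <⇒<ᵇ (ℕ.<-trans x<z z<y)
          | ≤⇒≮ᵇ (ℕ.<⇒≤ (ℕ.<-trans x<z z<y)) | ≤⇒≮ᵇ (ℕ.<⇒≤ x<z) | ≤⇒≮ᵇ (ℕ.<⇒≤ z<y) = refl

  contains-132⇔Has132 : ∀ l → contains l pat132 ≡ true ⇔ Has132 l
  contains-132⇔Has132 l = mk⇔ to from
    where
    open Function using (mk⇔)
    to : contains l pat132 ≡ true → Has132 l
    to l∋132 with contains⁻ l pat132 l∋132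
    ... | s , s⊆l , 132≅s with orderIso-132⁻ s 132≅s
    ...   | x , y , z , refl , x<z , z<y = x , y , z , s⊆l , x<z , z<y
    from : Has132 l → contains l pat132 ≡ true
    from (x , y , z , s⊆l , x<z , z<y) = contains⁺ pat132 s⊆l (orderIso-132⁺ x<z z<y)

  allSameOrder : List (ℕ × ℕ) → Bool
  allSameOrder Z = all (λ p → all (sameOrder p) Z) Z

  all-∧ : ∀ {A : Set} (p q : A → Bool) xs → all (λ x → p x ∧ q x) xs ≡ all p xs ∧ all q xs
  all-∧ p q [] = refl
  all-∧ p q (x ∷ xs) with p x | q x
  ... | true | true = all-∧ p q xs
  ... | true | false = sym (Bool.∧-zeroʳ (all p xs))
  ... | false | _ = refl

  all-map : ∀ {A B : Set} (p : B → Bool) (f : A → B) xs → all p (map f xs) ≡ all (p ∘ f) xs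
  all-map p f [] = refl
  all-map p f (x ∷ xs) = cong (p (f x) ∧_) (all-map p f xs)

  all-cong : ∀ {A : Set} {p q : A → Bool} xs → (∀ x → p x ≡ q x) → all p xs ≡ all q xs
  all-cong [] p≗q = refl
  all-cong (x ∷ xs) p≗q = cong₂ _∧_ (p≗q x) (all-cong xs p≗q)

  allSameOrder-∷ : ∀ z Z → allSameOrder (z ∷ Z) ≡ (sameOrder z z ∧ all (sameOrder z) Z) ∧ (all (λ p → sameOrder p z) Z ∧ allSameOrder Z)
  allSameOrder-∷ z Z = cong ((sameOrder z z ∧ all (sameOrder z) Z) ∧_) (all-∧ (λ p → sameOrder p z) (λ p → all (sameOrder p) Z) Z)

  shiftIndex : ℕ × ℕ → ℕ × ℕ
  shiftIndex (i , x) = suc i , x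

  allSameOrder-shift : ∀ Z → allSameOrder (map shiftIndex Z) ≡ allSameOrder Z
  allSameOrder-shift Z = trans (all-map (λ p → all (sameOrder p) (map shiftIndex Z)) shiftIndex Z)
                               (all-cong Z (λ p → all-map (sameOrder (shiftIndex p)) shiftIndex Z))

  zip-upTo-suc : ∀ k (s : List ℕ) → zip (applyUpTo suc k) s ≡ map shiftIndex (zip (upTo k) s)
  zip-upTo-suc k s = go id k s
    where
    go : ∀ (f : ℕ → ℕ) k (s : List ℕ) → zip (applyUpTo (suc ∘ f) k) s ≡ map shiftIndex (zip (applyUpTo f k) s)
    go f zero s = refl
    go f (suc k) [] = refl
    go f (suc k) (x ∷ s) = cong ((suc (f 0) , x) ∷_) (go (f ∘ suc) k s)

  all-proj₂-zip : ∀ (p : ℕ → Bool) (τ s : List ℕ) → length s ≡ length τ → all (p ∘ proj₂) (zip τ s) ≡ all p s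
  all-proj₂-zip p [] [] _ = refl
  all-proj₂-zip p (t ∷ τ) (x ∷ s) e = cong (p x ∧_) (all-proj₂-zip p τ s (ℕ.suc-injective e))

  ≡ᵇ-refl : ∀ n → (n ≡ᵇ n) ≡ true
  ≡ᵇ-refl zero = refl
  ≡ᵇ-refl (suc n) = ≡ᵇ-refl n

  orderIso-upTo-∷ : ∀ k x s → length s ≡ k →
    orderIso (upTo (suc k)) (x ∷ s) ≡ (all (x <ᵇ_) s ∧ all (λ y → not (y <ᵇ x)) s) ∧ orderIso (upTo k) s
  orderIso-upTo-∷ k x s |s|≡k = begin
    (length (applyUpTo suc k) ≡ᵇ length s) ∧ allSameOrder ((0 , x) ∷ zip (applyUpTo suc k) s)
      ≡⟨ cong₂ (λ b Z → b ∧ allSameOrder ((0 , x) ∷ Z)) (lengths-match (List.length-applyUpTo suc k)) (zip-upTo-suc k s) ⟩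
    allSameOrder ((0 , x) ∷ map shiftIndex Z)
      ≡⟨ allSameOrder-∷ (0 , x) (map shiftIndex Z) ⟩
    (sameOrder (0 , x) (0 , x) ∧ all (sameOrder (0 , x)) (map shiftIndex Z)) ∧ (all (λ p → sameOrder p (0 , x)) (map shiftIndex Z) ∧ allSameOrder (map shiftIndex Z))
      ≡⟨ cong₂ (λ u v → (u ∧ all (sameOrder (0 , x)) (map shiftIndex Z)) ∧ v)
               (cong not (≤⇒≮ᵇ (ℕ.≤-refl {x}))) (cong (all (λ p → sameOrder p (0 , x)) (map shiftIndex Z) ∧_) (allSameOrder-shift Z)) ⟩
    all (sameOrder (0 , x)) (map shiftIndex Z) ∧ (all (λ p → sameOrder p (0 , x)) (map shiftIndex Z) ∧ allSameOrder Z)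
      ≡⟨ cong₂ (λ u v → u ∧ (v ∧ allSameOrder Z))
               (trans (all-map (sameOrder (0 , x)) shiftIndex Z) (all-proj₂-zip (x <ᵇ_) (upTo k) s |s|≡|upTo|))
               (trans (all-map (λ p → sameOrder p (0 , x)) shiftIndex Z) (all-proj₂-zip (λ y → not (y <ᵇ x)) (upTo k) s |s|≡|upTo|)) ⟩
    all (x <ᵇ_) s ∧ (all (λ y → not (y <ᵇ x)) s ∧ allSameOrder Z)
      ≡⟨ sym (Bool.∧-assoc (all (x <ᵇ_) s) _ _) ⟩
    (all (x <ᵇ_) s ∧ all (λ y → not (y <ᵇ x)) s) ∧ allSameOrder Z
      ≡⟨ cong (λ b → (all (x <ᵇ_) s ∧ all (λ y → not (y <ᵇ x)) s) ∧ (b ∧ allSameOrder Z)) (sym (lengths-match (List.length-upTo k))) ⟩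
    (all (x <ᵇ_) s ∧ all (λ y → not (y <ᵇ x)) s) ∧ orderIso (upTo k) s ∎
    where
    open ≡-Reasoning
    Z = zip (upTo k) s
    |s|≡|upTo| : length s ≡ length (upTo k)
    |s|≡|upTo| = trans |s|≡k (sym (List.length-upTo k))
    lengths-match : ∀ {l} → l ≡ k → (l ≡ᵇ length s) ≡ true
    lengths-match refl = subst (λ z → (k ≡ᵇ z) ≡ true) (sym |s|≡k) (≡ᵇ-refl k)

  Increasing : List ℕ → Set
  Increasing = AllPairs _<_

  orderIso-upTo⁻ : ∀ k s → orderIso (upTo k) s ≡ true → length s ≡ k × Increasing s
  orderIso-upTo⁻ zero [] _ = refl , []
  orderIso-upTo⁻ (suc k) (x ∷ s) k+1≅x∷s = cong suc |s|≡k , all-above x s (Bool.∧-conicalˡ _ _ (Bool.∧-conicalˡ _ _ decomposed)) ∷ proj₂ rest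
    where
    x-first = all (x <ᵇ_) s ∧ all (λ y → not (y <ᵇ x)) s
    |s|≡k : length s ≡ k
    |s|≡k = sym (trans (sym (List.length-applyUpTo suc k)) (ℕ.≡ᵇ⇒≡ _ _ (subst T (sym (Bool.∧-conicalˡ _ _ k+1≅x∷s)) _)))
    decomposed = trans (sym (orderIso-upTo-∷ k x s |s|≡k)) k+1≅x∷s
    rest = orderIso-upTo⁻ k s (Bool.∧-conicalʳ x-first _ decomposed)
    all-above : ∀ x s → all (x <ᵇ_) s ≡ true → All (x <_) s
    all-above x [] _ = []
    all-above x (y ∷ s) h = <ᵇ⇒< (Bool.∧-conicalˡ _ _ h) ∷ all-above x s (Bool.∧-conicalʳ _ _ h)

  orderIso-upTo⁺ : ∀ s → Increasing s → orderIso (upTo (length s)) s ≡ true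
  orderIso-upTo⁺ [] [] = refl
  orderIso-upTo⁺ (x ∷ s) (x<s ∷ s↑) = trans (orderIso-upTo-∷ (length s) x s refl)
    (∧-intro (∧-intro (all-above x<s) (all-not-below x<s)) (orderIso-upTo⁺ s s↑))
    where
    all-above : ∀ {s} → All (x <_) s → all (x <ᵇ_) s ≡ true
    all-above [] = refl
    all-above (x<y ∷ x<s) = ∧-intro (<⇒<ᵇ x<y) (all-above x<s)
    all-not-below : ∀ {s} → All (x <_) s → all (λ y → not (y <ᵇ x)) s ≡ true
    all-not-below [] = refl
    all-not-below (x<y ∷ x<s) = ∧-intro (cong not (≤⇒≮ᵇ (ℕ.<⇒≤ x<y))) (all-not-below x<s)

  HasIncreasing : ℕ → List ℕ → Set
  HasIncreasing k l = ∃ λ s → s ⊆ l × length s ≡ k × Increasing s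

  contains-idPat⇔HasIncreasing : ∀ k l → contains l (idPat k) ≡ true ⇔ HasIncreasing k l
  contains-idPat⇔HasIncreasing k l = mk⇔ to from
    where
    open Function using (mk⇔)
    to : contains l (idPat k) ≡ true → HasIncreasing k l
    to l∋k with contains⁻ l (upTo k) l∋k
    ... | s , s⊆l , k≅s = s , s⊆l , orderIso-upTo⁻ k s k≅s
    from : HasIncreasing k l → contains l (idPat k) ≡ true
    from (s , s⊆l , refl , s↑) = contains⁺ (upTo (length s)) s⊆l (orderIso-upTo⁺ s s↑)

  ⊆-++⁻ : ∀ {s : List ℕ} l₁ l₂ → s ⊆ l₁ ++ l₂ → ∃₂ λ s₁ s₂ → s ≡ s₁ ++ s₂ × s₁ ⊆ l₁ × s₂ ⊆ l₂
  ⊆-++⁻ [] l₂ s⊆ = [] , _ , refl , [] , s⊆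
  ⊆-++⁻ (x ∷ l₁) l₂ (.x ∷ʳ s⊆) with ⊆-++⁻ l₁ l₂ s⊆
  ... | s₁ , s₂ , refl , s₁⊆ , s₂⊆ = s₁ , s₂ , refl , x ∷ʳ s₁⊆ , s₂⊆
  ⊆-++⁻ (x ∷ l₁) l₂ (refl ∷ s⊆) with ⊆-++⁻ l₁ l₂ s⊆
  ... | s₁ , s₂ , refl , s₁⊆ , s₂⊆ = x ∷ s₁ , s₂ , refl , refl ∷ s₁⊆ , s₂⊆

  ⊆-map⁻ : ∀ (f : ℕ → ℕ) {s} l → s ⊆ map f l → ∃ λ s′ → s ≡ map f s′ × s′ ⊆ l
  ⊆-map⁻ f [] [] = [] , refl , []
  ⊆-map⁻ f (x ∷ l) (_ ∷ʳ s⊆) with ⊆-map⁻ f l s⊆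
  ... | s′ , refl , s′⊆ = s′ , refl , x ∷ʳ s′⊆
  ⊆-map⁻ f (x ∷ l) (refl ∷ s⊆) with ⊆-map⁻ f l s⊆
  ... | s′ , refl , s′⊆ = x ∷ s′ , refl , refl ∷ s′⊆


module TreeWords where

  open import Defs using (inversions; contains; idPat; pat132)
  open BinaryTrees
  open PatternContainment
  open import Data.Nat using (ℕ; zero; suc; _+_; _*_; _<_; _≤_; _<ᵇ_)
  import Data.Nat.Properties as ℕ
  open import Data.Nat.Tactic.RingSolver using (solve-∀)
  open import Data.Bool using (Bool; true; false; not)
  import Data.Bool.Properties as Bool
  open import Data.List using (List; []; _∷_; map; _++_; length; filterᵇ)
  import Data.List.Properties as List
  open import Data.List.Membership.Propositional using (_∈_)
  open import Data.List.Membership.Propositional.Properties using (∈-map⁻; ∈-map⁺)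
  open import Data.List.Relation.Unary.Any using (here; there)
  open import Data.List.Relation.Unary.All using (All; []; _∷_)
  import Data.List.Relation.Unary.All as All
  import Data.List.Relation.Unary.All.Properties as All
  open import Data.List.Relation.Unary.AllPairs using (AllPairs; []; _∷_)
  import Data.List.Relation.Unary.AllPairs as AllPairs
  import Data.List.Relation.Unary.AllPairs.Properties as AllPairs
  open import Data.List.Relation.Binary.Sublist.Propositional using (_⊆_; []; _∷_; _∷ʳ_; lookup; minimum)
  import Data.List.Relation.Binary.Sublist.Propositional.Properties as Sublist
  open import Data.Empty using (⊥; ⊥-elim)
  open import Data.Product using (_×_; _,_; proj₁; proj₂)
  open import Data.Sum using (_⊎_; inj₁; inj₂)
  open import Function using (_∘_; Equivalence)
  open import Relation.Nullary using (¬_)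
  open import Relation.Binary.PropositionalEquality hiding ([_])

  ∈-left⇒bounds : ∀ a b {x} → x ∈ map (size b +_) (word a) → size b ≤ x × x < size a + size b
  ∈-left⇒bounds a b x∈ with ∈-map⁻ (size b +_) x∈
  ... | y , y∈ , refl = ℕ.m≤m+n (size b) y , ℕ.≤-trans (ℕ.+-monoʳ-< (size b) (word-bound a y∈)) (ℕ.≤-reflexive (ℕ.+-comm (size b) (size a)))

  ∈-right⇒below-max : ∀ a b {y} → y ∈ word b → y < size a + size b
  ∈-right⇒below-max a b y∈ = ℕ.<-≤-trans (word-bound b y∈) (ℕ.m≤n+m (size b) (size a))

  word-avoids-132 : ∀ t → ¬ Has132 (word t)
  word-avoids-132 (node a b) (x , y , z , xyz⊆ , x<z , z<y) with ⊆-++⁻ (map (size b +_) (word a)) ((size a + size b) ∷ word b) xyz⊆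
  ... | [] , _ , refl , _ , xyz⊆right = none-left xyz⊆right
    where
    none-left : x ∷ y ∷ z ∷ [] ⊆ (size a + size b) ∷ word b → ⊥
    none-left (_ ∷ʳ xyz⊆b) = word-avoids-132 b (x , y , z , xyz⊆b , x<z , z<y)
    none-left (refl ∷ yz⊆b) = ℕ.<-asym x<z (∈-right⇒below-max a b (lookup yz⊆b (there (here refl))))
  ... | _ ∷ [] , _ , refl , x⊆left , yz⊆right =
    ℕ.<-asym x<z (ℕ.<-≤-trans (word-bound b (second yz⊆right)) (proj₁ (∈-left⇒bounds a b (lookup x⊆left (here refl)))))
    where
    second : y ∷ z ∷ [] ⊆ (size a + size b) ∷ word b → z ∈ word b
    second (_ ∷ʳ yz⊆b) = lookup yz⊆b (there (here refl))
    second (refl ∷ z⊆b) = lookup z⊆b (here refl)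
  ... | _ ∷ _ ∷ [] , _ , refl , xy⊆left , z⊆right = last-right z⊆right
    where
    last-right : z ∷ [] ⊆ (size a + size b) ∷ word b → ⊥
    last-right (_ ∷ʳ z⊆b) = ℕ.<-asym x<z (ℕ.<-≤-trans (word-bound b (lookup z⊆b (here refl))) (proj₁ (∈-left⇒bounds a b (lookup xy⊆left (here refl)))))
    last-right (refl ∷ _) = ℕ.<-asym z<y (proj₂ (∈-left⇒bounds a b (lookup xy⊆left (there (here refl)))))
  ... | _ ∷ _ ∷ _ ∷ [] , [] , refl , xyz⊆left , _ with ⊆-map⁻ (size b +_) (word a) xyz⊆left
  ...   | x′ ∷ y′ ∷ z′ ∷ [] , refl , xyz′⊆a =
    word-avoids-132 a (x′ , y′ , z′ , xyz′⊆a , ℕ.+-cancelˡ-< (size b) x′ z′ x<z , ℕ.+-cancelˡ-< (size b) z′ y′ z<y)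

  hasIncreasing-pred : ∀ {k l} → HasIncreasing (suc k) l → HasIncreasing k l
  hasIncreasing-pred (x ∷ s , xs⊆l , |xs|≡1+k , _ ∷ s↑) = s , Sublist.∷ˡ⁻ xs⊆l , ℕ.suc-injective |xs|≡1+k , s↑

  hasIncreasing-map⁻ : ∀ {k} c l → HasIncreasing k (map (c +_) l) → HasIncreasing k l
  hasIncreasing-map⁻ c l (s , s⊆ , |s|≡k , s↑) with ⊆-map⁻ (c +_) l s⊆
  ... | s′ , refl , s′⊆l = s′ , s′⊆l , trans (sym (List.length-map (c +_) s′)) |s|≡k ,
                           AllPairs.map (ℕ.+-cancelˡ-< c _ _) (AllPairs.map⁻ s↑)

  AllPairs-++⁻ˡ : ∀ {R : ℕ → ℕ → Set} xs {ys} → AllPairs R (xs ++ ys) → AllPairs R xs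
  AllPairs-++⁻ˡ [] _ = []
  AllPairs-++⁻ˡ (x ∷ xs) (x~xs ∷ xs~) = All.++⁻ˡ xs x~xs ∷ AllPairs-++⁻ˡ xs xs~

  AllPairs-++⁻ʳ : ∀ {R : ℕ → ℕ → Set} xs {ys} → AllPairs R (xs ++ ys) → AllPairs R ys
  AllPairs-++⁻ʳ [] ys~ = ys~
  AllPairs-++⁻ʳ (x ∷ xs) (_ ∷ xs~) = AllPairs-++⁻ʳ xs xs~

  hasIncreasing-node⁻ : ∀ k a b → HasIncreasing (suc k) (word (node a b)) → HasIncreasing k (word a) ⊎ HasIncreasing (suc k) (word b)
  hasIncreasing-node⁻ k a b (s , s⊆ , |s|≡1+k , s↑) with ⊆-++⁻ (map (size b +_) (word a)) ((size a + size b) ∷ word b) s⊆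
  ... | s₁ , [] , refl , s₁⊆left , _ =
    inj₁ (hasIncreasing-map⁻ (size b) (word a)
           (hasIncreasing-pred (s₁ , s₁⊆left , trans (cong length (sym (List.++-identityʳ s₁))) |s|≡1+k , subst Increasing (List.++-identityʳ s₁) s↑)))
  ... | [] , y ∷ s₂ , refl , _ , _ ∷ʳ s₂⊆b = inj₂ (y ∷ s₂ , s₂⊆b , |s|≡1+k , s↑)
  ... | [] , y ∷ [] , refl , _ , refl ∷ _ = inj₁ ([] , minimum (word a) , ℕ.suc-injective |s|≡1+k , [])
  ... | [] , y ∷ z ∷ s₂ , refl , _ , refl ∷ z∷s₂⊆b with s↑
  ...   | (y<z ∷ _) ∷ _ = ⊥-elim (ℕ.<-asym y<z (∈-right⇒below-max a b (lookup z∷s₂⊆b (here refl))))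
  hasIncreasing-node⁻ k a b (s , s⊆ , |s|≡1+k , s↑) | u ∷ s₁ , y ∷ s₂ , refl , us₁⊆left , ys₂⊆right =
    inj₁ (hasIncreasing-map⁻ (size b) (word a) (u ∷ s₁ , us₁⊆left , |us₁|≡k (only-max ys₂↑ ys₂⊆right) , AllPairs-++⁻ˡ (u ∷ s₁) s↑))
    where
    u-bounds = ∈-left⇒bounds a b (lookup us₁⊆left (here refl))
    u<y : u < y
    u<y = All.lookup (All.++⁻ʳ s₁ (head s↑)) (here refl)
      where
      head : ∀ {x xs} → Increasing (x ∷ xs) → All (x <_) xs
      head (x<xs ∷ _) = x<xs
    ys₂↑ : Increasing (y ∷ s₂)
    ys₂↑ = AllPairs-++⁻ʳ (u ∷ s₁) s↑
    only-max : ∀ {s₂} → Increasing (y ∷ s₂) → y ∷ s₂ ⊆ (size a + size b) ∷ word b → s₂ ≡ []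
    only-max _ (_ ∷ʳ ys₂⊆b) = ⊥-elim (ℕ.<-asym u<y (ℕ.<-≤-trans (word-bound b (lookup ys₂⊆b (here refl))) (proj₁ u-bounds)))
    only-max {[]} _ (refl ∷ _) = refl
    only-max {z ∷ _} ((y<z ∷ _) ∷ _) (refl ∷ z∷⊆b) = ⊥-elim (ℕ.<-asym y<z (∈-right⇒below-max a b (lookup z∷⊆b (here refl))))
    |us₁|≡k : s₂ ≡ [] → length (u ∷ s₁) ≡ k
    |us₁|≡k refl = ℕ.suc-injective (trans (trans (ℕ.+-comm 1 (length (u ∷ s₁))) (sym (List.length-++ (u ∷ s₁)))) |s|≡1+k)

  hasIncreasing⇒¬lisBelow : ∀ k t → HasIncreasing k (word t) → lisBelow k t ≡ false
  hasIncreasing⇒¬lisBelow zero t _ = refl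
  hasIncreasing⇒¬lisBelow (suc k) leaf (_ ∷ _ , () , _)
  hasIncreasing⇒¬lisBelow (suc k) leaf ([] , _ , () , _)
  hasIncreasing⇒¬lisBelow (suc k) (node a b) inc with hasIncreasing-node⁻ k a b inc
  ... | inj₁ inc-a rewrite hasIncreasing⇒¬lisBelow k a inc-a = refl
  ... | inj₂ inc-b rewrite hasIncreasing⇒¬lisBelow (suc k) b inc-b = Bool.∧-zeroʳ (lisBelow k a)

  ¬lisBelow⇒hasIncreasing : ∀ k t → lisBelow k t ≡ false → HasIncreasing k (word t)
  ¬lisBelow⇒hasIncreasing zero t _ = [] , minimum (word t) , refl , []
  ¬lisBelow⇒hasIncreasing (suc k) (node a b) ¬lis with lisBelow k a in lis-a
  ... | false with ¬lisBelow⇒hasIncreasing k a lis-a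
  ...   | s , s⊆a , |s|≡k , s↑ =
    map (size b +_) s ++ (size a + size b) ∷ [] ,
    Sublist.++⁺ (Sublist.map⁺ (size b +_) s⊆a) (refl ∷ minimum (word b)) ,
    trans (List.length-++ (map (size b +_) s)) (trans (cong (_+ 1) (trans (List.length-map (size b +_) s) |s|≡k)) (ℕ.+-comm k 1)) ,
    AllPairs.++⁺ (AllPairs.map⁺ (AllPairs.map (ℕ.+-monoʳ-< (size b)) s↑)) (All.[] ∷ [])
                  (All.map⁺ (All.tabulate (λ x∈ → proj₂ (∈-left⇒bounds a b (∈-map⁺ (size b +_) (lookup s⊆a x∈))) ∷ [])))
  ¬lisBelow⇒hasIncreasing (suc k) (node a b) ¬lis | true with ¬lisBelow⇒hasIncreasing (suc k) b ¬lis
  ... | s , s⊆b , |s|≡k , s↑ = s , Sublist.++⁺ˡ (map (size b +_) (word a)) ((size a + size b) ∷ʳ s⊆b) , |s|≡k , s↑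

  contains-word-idPat : ∀ k t → contains (word t) (idPat k) ≡ not (lisBelow k t)
  contains-word-idPat k t with lisBelow k t in lis
  ... | false = Equivalence.from (contains-idPat⇔HasIncreasing k (word t)) (¬lisBelow⇒hasIncreasing k t lis)
  ... | true with contains (word t) (idPat k) in t∋k
  ...   | false = refl
  ...   | true with () ← trans (sym lis) (hasIncreasing⇒¬lisBelow k t (Equivalence.to (contains-idPat⇔HasIncreasing k (word t)) t∋k))

  contains-word-132 : ∀ t → contains (word t) pat132 ≡ false
  contains-word-132 t with contains (word t) pat132 in t∋132
  ... | false = refl
  ... | true = ⊥-elim (word-avoids-132 t (Equivalence.to (contains-132⇔Has132 (word t)) t∋132))

  crossInversions : List ℕ → List ℕ → ℕ
  crossInversions [] ys = 0
  crossInversions (x ∷ xs) ys = length (filterᵇ (_<ᵇ x) ys) + crossInversions xs ys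

  inversions-++ : ∀ xs ys → inversions (xs ++ ys) ≡ inversions xs + inversions ys + crossInversions xs ys
  inversions-++ [] ys = sym (ℕ.+-identityʳ (inversions ys))
  inversions-++ (x ∷ xs) ys =
    trans (cong₂ _+_ (trans (cong length (List.filter-++ (Data.Bool.T? ∘ (_<ᵇ x)) xs ys)) (List.length-++ (filterᵇ (_<ᵇ x) xs)))
                     (inversions-++ xs ys))
          (rearrange (length (filterᵇ (_<ᵇ x) xs)) (length (filterᵇ (_<ᵇ x) ys)) (inversions xs) (inversions ys) (crossInversions xs ys))
    where
    import Data.Bool
    rearrange : ∀ a b c d e → a + b + (c + d + e) ≡ a + c + d + (b + e)
    rearrange = solve-∀

  inversions-shift : ∀ c l → inversions (map (c +_) l) ≡ inversions l
  inversions-shift c [] = refl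
  inversions-shift c (x ∷ l) = cong₂ _+_ (length-filter-shift l) (inversions-shift c l)
    where
    <ᵇ-shift : ∀ c y → (c + y <ᵇ c + x) ≡ (y <ᵇ x)
    <ᵇ-shift zero y = refl
    <ᵇ-shift (suc c) y = <ᵇ-shift c y
    length-filter-shift : ∀ l → length (filterᵇ (_<ᵇ c + x) (map (c +_) l)) ≡ length (filterᵇ (_<ᵇ x) l)
    length-filter-shift [] = refl
    length-filter-shift (y ∷ l) rewrite <ᵇ-shift c y with y <ᵇ x
    ... | true = cong suc (length-filter-shift l)
    ... | false = length-filter-shift l

  length-filterᵇ-all : ∀ (p : ℕ → Bool) l → (∀ {y} → y ∈ l → p y ≡ true) → length (filterᵇ p l) ≡ length l
  length-filterᵇ-all p [] _ = refl
  length-filterᵇ-all p (y ∷ l) all-p rewrite all-p (here refl) = cong suc (length-filterᵇ-all p l (all-p ∘ there))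

  inversions-word : ∀ t → inversions (word t) ≡ inversionsᵗ t
  inversions-word leaf = refl
  inversions-word (node a b) = begin
    inversions (left ++ M ∷ word b)                                              ≡⟨ inversions-++ left (M ∷ word b) ⟩
    inversions left + (length (filterᵇ (_<ᵇ M) (word b)) + inversions (word b)) + crossInversions left (M ∷ word b)
      ≡⟨ cong₂ (λ u v → u + (length (filterᵇ (_<ᵇ M) (word b)) + v) + crossInversions left (M ∷ word b))
               (trans (inversions-shift (size b) (word a)) (inversions-word a)) (inversions-word b) ⟩
    inversionsᵗ a + (length (filterᵇ (_<ᵇ M) (word b)) + inversionsᵗ b) + crossInversions left (M ∷ word b)
      ≡⟨ cong₂ (λ u v → inversionsᵗ a + (u + inversionsᵗ b) + v)
               (trans (length-filterᵇ-all (_<ᵇ M) (word b) (<⇒<ᵇ ∘ ∈-right⇒below-max a b)) (length-word b))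
               (trans (cross-left left (∈-left⇒bounds a b)) (cong (_* size b) (trans (List.length-map (size b +_) (word a)) (length-word a)))) ⟩
    inversionsᵗ a + (size b + inversionsᵗ b) + size a * size b                     ≡⟨ rearrange (inversionsᵗ a) (inversionsᵗ b) (size a) (size b) ⟩
    inversionsᵗ a + inversionsᵗ b + suc (size a) * size b                          ∎
    where
    open ≡-Reasoning
    left = map (size b +_) (word a)
    M = size a + size b
    cross-left : ∀ xs → (∀ {x} → x ∈ xs → size b ≤ x × x < M) → crossInversions xs (M ∷ word b) ≡ length xs * size b
    cross-left [] _ = refl
    cross-left (x ∷ xs) bounds rewrite ≤⇒≮ᵇ (ℕ.<⇒≤ (proj₂ (bounds (here refl)))) =
      cong₂ _+_ (trans (length-filterᵇ-all (_<ᵇ x) (word b) (λ y∈ → <⇒<ᵇ (ℕ.<-≤-trans (word-bound b y∈) (proj₁ (bounds (here refl))))))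
                       (length-word b))
                (cross-left xs (bounds ∘ there))
    rearrange : ∀ ta tb sa sb → ta + (sb + tb) + sa * sb ≡ ta + tb + suc sa * sb
    rearrange = solve-∀


module WordIndexing where

  open BinaryTrees
  open TreeWords using (∈-left⇒bounds)
  open import Data.Nat using (ℕ; zero; suc; _+_; _∸_; _<_; z≤n; s≤s)
  import Data.Nat.Properties as ℕ
  open import Data.List using (List; []; _∷_; map; _++_; length)
  import Data.List.Properties as List
  open import Data.List.Membership.Propositional using (_∈_; _∉_)
  open import Data.List.Relation.Unary.Any using (here; there)
  open import Data.Empty using (⊥-elim)
  open import Data.Product using (_×_; _,_; proj₁; proj₂; ∃)
  open import Relation.Binary.PropositionalEquality
  open import Relation.Binary.Definitions using (tri<; tri≈; tri>)
  open import Function using (_∘_)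

  -- Out of range the junk value 0 is returned; it is never used.
  at : List ℕ → ℕ → ℕ
  at [] i = 0
  at (x ∷ l) zero = x
  at (x ∷ l) (suc i) = at l i

  at-++ˡ : ∀ xs ys {i} → i < length xs → at (xs ++ ys) i ≡ at xs i
  at-++ˡ (x ∷ xs) ys {zero} _ = refl
  at-++ˡ (x ∷ xs) ys {suc i} (s≤s i<) = at-++ˡ xs ys i<

  at-++ʳ : ∀ xs ys j → at (xs ++ ys) (length xs + j) ≡ at ys j
  at-++ʳ [] ys j = refl
  at-++ʳ (x ∷ xs) ys j = at-++ʳ xs ys j

  at-map : ∀ (f : ℕ → ℕ) xs {i} → i < length xs → at (map f xs) i ≡ f (at xs i)
  at-map f (x ∷ xs) {zero} _ = refl
  at-map f (x ∷ xs) {suc i} (s≤s i<) = at-map f xs i<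

  at-∈ : ∀ xs {i} → i < length xs → at xs i ∈ xs
  at-∈ (x ∷ xs) {zero} _ = here refl
  at-∈ (x ∷ xs) {suc i} (s≤s i<) = there (at-∈ xs i<)

  ∈⇒at : ∀ {y} xs → y ∈ xs → ∃ λ j → j < length xs × at xs j ≡ y
  ∈⇒at (x ∷ xs) (here refl) = 0 , s≤s z≤n , refl
  ∈⇒at (x ∷ xs) (there y∈) with ∈⇒at xs y∈
  ... | j , j< , at≡y = suc j , s≤s j< , at≡y

  at-extensionality : ∀ xs ys → length xs ≡ length ys → (∀ {i} → i < length xs → at xs i ≡ at ys i) → xs ≡ ys
  at-extensionality [] [] _ _ = refl
  at-extensionality (x ∷ xs) (y ∷ ys) |xs|≡|ys| same =
    cong₂ _∷_ (same (s≤s z≤n)) (at-extensionality xs ys (ℕ.suc-injective |xs|≡|ys|) (same ∘ s≤s))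

  at-word-bound : ∀ t {i} → i < size t → at (word t) i < size t
  at-word-bound t i< = word-bound t (at-∈ (word t) (subst (_ <_) (sym (length-word t)) i<))

  private
    length-left : ∀ a b → length (map (size b +_) (word a)) ≡ size a
    length-left a b = trans (List.length-map (size b +_) (word a)) (length-word a)

  at-word-left : ∀ a b {i} → i < size a → at (word (node a b)) i ≡ size b + at (word a) i
  at-word-left a b {i} i<a = trans (at-++ˡ (map (size b +_) (word a)) _ (subst (i <_) (sym (length-left a b)) i<a))
                                   (at-map (size b +_) (word a) (subst (i <_) (sym (length-word a)) i<a))

  at-word-root : ∀ a b → at (word (node a b)) (size a) ≡ size a + size b
  at-word-root a b = trans (cong (at (word (node a b))) (trans (sym (ℕ.+-identityʳ (size a))) (cong (_+ 0) (sym (length-left a b)))))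
                           (at-++ʳ (map (size b +_) (word a)) _ 0)

  at-word-right : ∀ a b j → at (word (node a b)) (suc (size a + j)) ≡ at (word b) j
  at-word-right a b j = trans (cong (at (word (node a b))) (trans (sym (ℕ.+-suc (size a) j)) (cong (_+ suc j) (sym (length-left a b)))))
                              (at-++ʳ (map (size b +_) (word a)) _ (suc j))

  word-inverse-node : ∀ a b → word (inverse (node a b)) ≡ map (suc (size a) +_) (word (inverse b)) ++ (word (inverse a) ++ size a ∷ [])
  word-inverse-node a b = trans (word-skewSum (inverse b) (node (inverse a) leaf))
    (cong₂ (λ u v → map (suc u +_) (word (inverse b)) ++ v) (trans (ℕ.+-identityʳ (size (inverse a))) (size-inverse a))
           (cong₂ (λ u v → u ++ v ∷ []) (List.map-id (word (inverse a))) (trans (ℕ.+-identityʳ (size (inverse a))) (size-inverse a))))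

  private
    module InverseNode (a b : Tree) where
      Vb = map (suc (size a) +_) (word (inverse b))
      Va = word (inverse a) ++ size a ∷ []
      length-Vb : length Vb ≡ size b
      length-Vb = trans (List.length-map (suc (size a) +_) (word (inverse b))) (trans (length-word (inverse b)) (size-inverse b))
      length-inverse-a : length (word (inverse a)) ≡ size a
      length-inverse-a = trans (length-word (inverse a)) (size-inverse a)

  at-word-inverse-right : ∀ a b {v} → v < size b → at (word (inverse (node a b))) v ≡ suc (size a) + at (word (inverse b)) v
  at-word-inverse-right a b {v} v<b rewrite word-inverse-node a b =
    trans (at-++ˡ Vb Va (subst (v <_) (sym length-Vb) v<b))
          (at-map (suc (size a) +_) (word (inverse b)) (subst (v <_) (sym (trans (length-word (inverse b)) (size-inverse b))) v<b))
    where open InverseNode a b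

  at-word-inverse-left : ∀ a b {v} → v < size a → at (word (inverse (node a b))) (size b + v) ≡ at (word (inverse a)) v
  at-word-inverse-left a b {v} v<a rewrite word-inverse-node a b =
    trans (cong (λ z → at (Vb ++ Va) (z + v)) (sym length-Vb))
          (trans (at-++ʳ Vb Va v) (at-++ˡ (word (inverse a)) (size a ∷ []) (subst (v <_) (sym length-inverse-a) v<a)))
    where open InverseNode a b

  at-word-inverse-root : ∀ a b → at (word (inverse (node a b))) (size b + size a) ≡ size a
  at-word-inverse-root a b rewrite word-inverse-node a b =
    trans (cong (λ z → at (Vb ++ Va) (z + size a)) (sym length-Vb))
          (trans (at-++ʳ Vb Va (size a))
                 (trans (cong (at Va) (sym (trans (ℕ.+-identityʳ _) length-inverse-a))) (at-++ʳ (word (inverse a)) (size a ∷ []) 0)))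
    where open InverseNode a b

  at-word-inverse : ∀ t {i} → i < size t → at (word (inverse t)) (at (word t) i) ≡ i
  at-word-inverse (node a b) {i} i< with ℕ.<-cmp i (size a)
  ... | tri< i<a _ _ = begin
    at (word (inverse (node a b))) (at (word (node a b)) i)   ≡⟨ cong (at (word (inverse (node a b)))) (at-word-left a b i<a) ⟩
    at (word (inverse (node a b))) (size b + at (word a) i)   ≡⟨ at-word-inverse-left a b (at-word-bound a i<a) ⟩
    at (word (inverse a)) (at (word a) i)                     ≡⟨ at-word-inverse a i<a ⟩
    i                                                         ∎
    where open ≡-Reasoning
  ... | tri≈ _ refl _ = begin
    at (word (inverse (node a b))) (at (word (node a b)) (size a)) ≡⟨ cong (at (word (inverse (node a b)))) (trans (at-word-root a b) (ℕ.+-comm (size a) (size b))) ⟩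
    at (word (inverse (node a b))) (size b + size a)              ≡⟨ at-word-inverse-root a b ⟩
    size a                                                        ∎
    where open ≡-Reasoning
  ... | tri> _ _ a<i = begin
    at (word (inverse (node a b))) (at (word (node a b)) i)       ≡⟨ cong (λ z → at (word (inverse (node a b))) (at (word (node a b)) z)) i≡ ⟩
    at (word (inverse (node a b))) (at (word (node a b)) (suc (size a + j))) ≡⟨ cong (at (word (inverse (node a b)))) (at-word-right a b j) ⟩
    at (word (inverse (node a b))) (at (word b) j)                ≡⟨ at-word-inverse-right a b (at-word-bound b j<b) ⟩
    suc (size a) + at (word (inverse b)) (at (word b) j)          ≡⟨ cong (suc (size a) +_) (at-word-inverse b j<b) ⟩
    suc (size a + j)                                              ≡⟨ sym i≡ ⟩
    i                                                             ∎
    where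
    open ≡-Reasoning
    j = i ∸ suc (size a)
    i≡ : i ≡ suc (size a + j)
    i≡ = sym (ℕ.m+[n∸m]≡n a<i)
    j<b : j < size b
    j<b = ℕ.+-cancelˡ-< (suc (size a)) j (size b) (subst (_< suc (size a + size b)) i≡ i<)

  ++-∷-cancel : ∀ {m : ℕ} xs xs′ {ys ys′} → m ∉ xs → m ∉ xs′ → xs ++ m ∷ ys ≡ xs′ ++ m ∷ ys′ → xs ≡ xs′ × ys ≡ ys′
  ++-∷-cancel [] [] m∉ m∉′ refl = refl , refl
  ++-∷-cancel [] (x ∷ xs′) m∉ m∉′ refl = ⊥-elim (m∉′ (here refl))
  ++-∷-cancel (x ∷ xs) [] m∉ m∉′ refl = ⊥-elim (m∉ (here refl))
  ++-∷-cancel (x ∷ xs) (x′ ∷ xs′) m∉ m∉′ eq with List.∷-injective eq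
  ... | refl , eq′ with ++-∷-cancel xs xs′ (m∉ ∘ there) (m∉′ ∘ there) eq′
  ...   | refl , refl = refl , refl

  word-injective : ∀ s t → word s ≡ word t → s ≡ t
  word-injective leaf leaf _ = refl
  word-injective leaf (node a b) eq with () ← trans (sym (length-word leaf)) (trans (cong length eq) (length-word (node a b)))
  word-injective (node a b) leaf eq with () ← trans (sym (length-word leaf)) (trans (cong length (sym eq)) (length-word (node a b)))
  word-injective (node a b) (node a′ b′) eq = cong₂ node (word-injective a a′ word-a≡) (word-injective b b′ (proj₂ parts))
    where
    size≡ : size a + size b ≡ size a′ + size b′
    size≡ = ℕ.suc-injective (trans (sym (length-word (node a b))) (trans (cong length eq) (length-word (node a′ b′))))
    parts = ++-∷-cancel (map (size b +_) (word a)) (map (size b′ +_) (word a′))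
              (λ m∈ → ℕ.<-irrefl refl (proj₂ (∈-left⇒bounds a b m∈)))
              (λ m∈ → ℕ.<-irrefl size≡ (proj₂ (∈-left⇒bounds a′ b′ m∈)))
              (trans eq (cong (λ z → map (size b′ +_) (word a′) ++ z ∷ word b′) (sym size≡)))
    size-a≡ : size a ≡ size a′
    size-a≡ = trans (sym (trans (List.length-map (size b +_) (word a)) (length-word a)))
                    (trans (cong length (proj₁ parts)) (trans (List.length-map (size b′ +_) (word a′)) (length-word a′)))
    size-b≡ : size b ≡ size b′
    size-b≡ = ℕ.+-cancelˡ-≡ (size a) (size b) (size b′) (trans size≡ (cong (_+ size b′) (sym size-a≡)))
    word-a≡ : word a ≡ word a′
    word-a≡ = List.map-injective (ℕ.+-cancelˡ-≡ (size b) _ _) (trans (proj₁ parts) (cong (λ z → map (z +_) (word a′)) (sym size-b≡)))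

  Involutive : ℕ → List ℕ → Set
  Involutive n l = ∀ {i} → i < n → at l (at l i) ≡ i

  selfInverse⇒involutive : ∀ t → inverse t ≡ t → Involutive (size t) (word t)
  selfInverse⇒involutive t t-selfInverse {i} i< = subst (λ z → at (word z) (at (word t) i) ≡ i) t-selfInverse (at-word-inverse t i<)

  involutive⇒selfInverse : ∀ t → Involutive (size t) (word t) → inverse t ≡ t
  involutive⇒selfInverse t involutive = word-injective (inverse t) t (at-extensionality (word (inverse t)) (word t)
    (trans length-inverse (sym (length-word t)))
    (λ {j} j< → let j<t = subst (j <_) length-inverse j< in
       trans (cong (at (word (inverse t))) (sym (involutive j<t))) (at-word-inverse t (at-word-bound t j<t))))
    where
    length-inverse : length (word (inverse t)) ≡ size t
    length-inverse = trans (length-word (inverse t)) (size-inverse t)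


module Decoding where

  open BinaryTrees
  open PatternContainment using (Has132)
  open Counting using (Unique⇒length≤; Unique-map⁺)
  open TreeWords using (AllPairs-++⁻ˡ; AllPairs-++⁻ʳ)
  open import Data.Nat using (ℕ; suc; _+_; _∸_; _<_; _≤_; z≤n; s≤s)
  import Data.Nat.Properties as ℕ
  open import Data.List using (List; []; _∷_; map; _++_; length; applyUpTo)
  import Data.List.Properties as List
  open import Data.List.Membership.Propositional using (_∈_)
  open import Data.List.Membership.Propositional.Properties using (∈-∃++; ∈-map⁻; ∈-++⁺ˡ; ∈-++⁺ʳ; ∈-applyUpTo⁺)
  open import Data.List.Relation.Unary.Any using (here; there)
  import Data.List.Relation.Unary.Any as Any
  open import Data.List.Relation.Unary.All using (All; []; _∷_)
  import Data.List.Relation.Unary.All as All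
  import Data.List.Relation.Unary.All.Properties as All
  open import Data.List.Relation.Unary.Unique.Propositional using (Unique; _∷_)
  open import Data.List.Relation.Binary.Sublist.Propositional using (_⊆_; _∷_; _∷ʳ_; from∈; ⊆-trans; ⊆-refl)
  import Data.List.Relation.Binary.Sublist.Propositional.Properties as Sublist
  open import Data.Empty using (⊥-elim)
  open import Data.Product using (_×_; _,_; proj₁; proj₂; ∃)
  open import Function using (_∘_)
  open import Relation.Nullary using (¬_; yes; no)
  open import Relation.Binary.Definitions using (tri<; tri≈; tri>)
  open import Relation.Binary.PropositionalEquality

  Has132-⊆ : ∀ {l l′} → l ⊆ l′ → Has132 l → Has132 l′
  Has132-⊆ l⊆l′ (x , y , z , xyz⊆l , x<z , z<y) = x , y , z , ⊆-trans xyz⊆l l⊆l′ , x<z , z<y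

  Has132-shift : ∀ c {s} → Has132 s → Has132 (map (c +_) s)
  Has132-shift c (x , y , z , xyz⊆s , x<z , z<y) = c + x , c + y , c + z , Sublist.map⁺ (c +_) xyz⊆s , ℕ.+-monoʳ-< c x<z , ℕ.+-monoʳ-< c z<y

  Unique⇒length≤range : ∀ (xs : List ℕ) c r → Unique xs → (∀ {x} → x ∈ xs → c ≤ x × x < c + r) → length xs ≤ r
  Unique⇒length≤range xs c r xs! in-range = ℕ.≤-trans
    (Unique⇒length≤ xs (applyUpTo (c +_) r) xs! (λ x∈ → in-applyUpTo (proj₁ (in-range x∈)) (proj₂ (in-range x∈))))
    (ℕ.≤-reflexive (List.length-applyUpTo (c +_) r))
    where
    in-applyUpTo : ∀ {x} → c ≤ x → x < c + r → x ∈ applyUpTo (c +_) r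
    in-applyUpTo {x} c≤x x<c+r = subst (_∈ applyUpTo (c +_) r) (ℕ.m+[n∸m]≡n c≤x)
      (∈-applyUpTo⁺ (c +_) (ℕ.+-cancelˡ-< c (x ∸ c) r (subst (_< c + r) (sym (ℕ.m+[n∸m]≡n c≤x)) x<c+r)))

  max-∈ : ∀ m l → length l ≡ suc m → All (_< suc m) l → Unique l → m ∈ l
  max-∈ m l |l|≡1+m l<1+m l! with Any.any? (ℕ._≟ m) l
  ... | yes m∈ = Any.map sym m∈
  ... | no m∉ = ⊥-elim (ℕ.<-irrefl refl (ℕ.≤-trans (ℕ.≤-reflexive (sym |l|≡1+m))
                  (Unique⇒length≤range l 0 m l! (λ x∈ → z≤n , ℕ.≤∧≢⇒< (ℕ.≤-pred (All.lookup l<1+m x∈)) (λ x≡m → m∉ (Any.map (λ { refl → x≡m }) x∈))))))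

  Unique-++-distinct : ∀ xs {ys : List ℕ} → Unique (xs ++ ys) → ∀ {x y} → x ∈ xs → y ∈ ys → x ≢ y
  Unique-++-distinct (_ ∷ xs) (x≢ ∷ _) (here refl) y∈ = All.lookup (All.++⁻ʳ xs x≢) y∈
  Unique-++-distinct (_ ∷ xs) (_ ∷ xs!) (there x∈) y∈ = Unique-++-distinct xs xs! x∈ y∈

  Decodable : List ℕ → Set
  Decodable l = All (_< length l) l × Unique l × ¬ Has132 l

  -- The fuel f ≥ length l only makes the recursion structural.
  decode : ∀ f l → length l ≤ f → Decodable l → ∃ λ t → word t ≡ l
  decode-at-max : ∀ f m U V → length U + length V ≡ m → length U + length V ≤ f →
    All (_< suc m) (U ++ m ∷ V) → Unique (U ++ m ∷ V) → ¬ Has132 (U ++ m ∷ V) → ∃ λ t → word t ≡ U ++ m ∷ V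

  decode f [] _ _ = leaf , refl
  decode (suc f) (x ∷ l) (s≤s |l|≤f) (l<n , l! , l-avoids) with ∈-∃++ (max-∈ (length l) (x ∷ l) refl l<n l!)
  ... | U , V , x∷l≡ = subst (λ z → ∃ λ t → word t ≡ z) (sym x∷l≡)
    (decode-at-max f (length l) U V |U|+|V| (subst (_≤ f) (sym |U|+|V|) |l|≤f)
                   (subst (All (_< suc (length l))) x∷l≡ l<n) (subst Unique x∷l≡ l!) (l-avoids ∘ subst Has132 (sym x∷l≡)))
    where
    |U|+|V| : length U + length V ≡ length l
    |U|+|V| = ℕ.suc-injective (trans (sym (ℕ.+-suc (length U) (length V))) (trans (sym (List.length-++ U)) (sym (cong length x∷l≡))))

  decode-at-max f m U V |U|+|V|≡m |U|+|V|≤f l<1+m l! l-avoids = node ta tb , word-node≡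
    where
    ∈U⇒<m : ∀ {x} → x ∈ U → x < m
    ∈U⇒<m x∈ = ℕ.≤∧≢⇒< (ℕ.≤-pred (All.lookup l<1+m (∈-++⁺ˡ x∈))) (Unique-++-distinct U l! x∈ (here refl))
    V! : Unique V
    V! with AllPairs-++⁻ʳ U l!
    ... | _ ∷ V! = V!
    ∈V⇒<m : ∀ {y} → y ∈ V → y < m
    ∈V⇒<m y∈ with AllPairs-++⁻ʳ U l!
    ... | m∉V ∷ _ = ℕ.≤∧≢⇒< (ℕ.≤-pred (All.lookup l<1+m (∈-++⁺ʳ U (there y∈)))) (λ y≡m → All.lookup m∉V y∈ (sym y≡m))
    right-below-left : ∀ {x y} → x ∈ U → y ∈ V → y < x
    right-below-left {x} {y} x∈ y∈ with ℕ.<-cmp x y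
    ... | tri< x<y _ _ = ⊥-elim (l-avoids (x , m , y , Sublist.++⁺ (from∈ x∈) (refl ∷ from∈ y∈) , x<y , ∈V⇒<m y∈))
    ... | tri≈ _ x≡y _ = ⊥-elim (Unique-++-distinct U l! x∈ (there y∈) x≡y)
    ... | tri> _ _ y<x = y<x
    |V|≤ : ∀ {x} → x ∈ U → length V ≤ x
    |V|≤ x∈ = Unique⇒length≤range V 0 _ V! (λ y∈ → z≤n , right-below-left x∈ y∈)
    <|V| : ∀ {y} → y ∈ V → y < length V
    <|V| {y} y∈ = ℕ.+-cancelˡ-≤ (length U) (suc y) (length V)
      (subst (length U + suc y ≤_) (sym |U|+|V|≡m) (ℕ.≤-trans (ℕ.+-monoˡ-≤ (suc y) |U|≤) (ℕ.≤-reflexive (ℕ.m∸n+n≡m (∈V⇒<m y∈)))))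
      where
      |U|≤ : length U ≤ m ∸ suc y
      |U|≤ = Unique⇒length≤range U (suc y) (m ∸ suc y) (AllPairs-++⁻ˡ U l!)
        (λ x∈ → right-below-left x∈ y∈ , subst (_ <_) (sym (ℕ.m+[n∸m]≡n (∈V⇒<m y∈))) (∈U⇒<m x∈))
    U′ = map (_∸ length V) U
    |U′| : length U′ ≡ length U
    |U′| = List.length-map (_∸ length V) U
    shift-U′ : map (length V +_) U′ ≡ U
    shift-U′ = trans (sym (List.map-∘ U)) (trans (List.map-cong-local (All.tabulate (ℕ.m+[n∸m]≡n ∘ |V|≤))) (List.map-id U))
    U′-below : ∀ {z} → z ∈ U′ → z < length U′
    U′-below z∈ with ∈-map⁻ (_∸ length V) z∈
    ... | x , x∈ , refl = subst (x ∸ length V <_) (sym |U′|)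
      (ℕ.+-cancelˡ-< (length V) (x ∸ length V) (length U)
        (subst₂ _<_ (sym (ℕ.m+[n∸m]≡n (|V|≤ x∈))) (trans (sym |U|+|V|≡m) (ℕ.+-comm (length U) (length V))) (∈U⇒<m x∈)))
    recA = decode f U′ (subst (_≤ f) (sym |U′|) (ℕ.≤-trans (ℕ.m≤m+n (length U) (length V)) |U|+|V|≤f))
             (All.tabulate U′-below , Unique-map⁺ (_∸ length V) (λ x∈ y∈ e → trans (sym (ℕ.m+[n∸m]≡n (|V|≤ x∈))) (trans (cong (length V +_) e) (ℕ.m+[n∸m]≡n (|V|≤ y∈)))) (AllPairs-++⁻ˡ U l!) ,
              λ h → l-avoids (Has132-⊆ (Sublist.++⁺ʳ (m ∷ V) ⊆-refl) (subst Has132 shift-U′ (Has132-shift (length V) h))))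
    recB = decode f V (ℕ.≤-trans (ℕ.m≤n+m (length V) (length U)) |U|+|V|≤f)
             (All.tabulate <|V| , V! , λ h → l-avoids (Has132-⊆ (Sublist.++⁺ˡ U (m ∷ʳ ⊆-refl)) h))
    ta = proj₁ recA
    tb = proj₁ recB
    size-ta : size ta ≡ length U
    size-ta = trans (sym (length-word ta)) (trans (cong length (proj₂ recA)) |U′|)
    size-tb : size tb ≡ length V
    size-tb = trans (sym (length-word tb)) (cong length (proj₂ recB))
    word-node≡ : word (node ta tb) ≡ U ++ m ∷ V
    word-node≡ = trans (cong₂ (λ z w → map (z +_) (word ta) ++ w ∷ word tb) size-tb (trans (cong₂ _+_ size-ta size-tb) |U|+|V|≡m))
                       (trans (cong₂ (λ z w → map (length V +_) z ++ m ∷ w) (proj₂ recA) (proj₂ recB)) (cong (_++ m ∷ V) shift-U′))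


module Involutions where

  open import Defs
  open BinaryTrees
  open TreeEnumeration
  open Counting
  open Parity using (==-true)
  open InvolutionCounts
  open PatternContainment using (Has132; contains-132⇔Has132; ≡ᵇ-refl; all≡true⁻; all-cong; all-map; ∧-intro; ∧-elim)
  open TreeWords
  open WordIndexing
  open Decoding
  open import Data.Nat using (ℕ; zero; suc; _<_; z≤n; s≤s; _≡ᵇ_)
  import Data.Nat.Properties as ℕ
  open import Data.Fin as Fin using (Fin; toℕ)
  open import Data.Bool using (Bool; true; _∧_; not)
  import Data.Bool.Properties as Bool
  open import Data.Bool.ListAction using (all)
  open import Data.List using (List; []; _∷_; [_]; map; length; upTo; applyUpTo; concatMap; tabulate; allFin)
  import Data.List.Properties as List
  open import Data.Vec as Vec using (Vec)
  open import Data.List.Membership.Propositional using (_∈_; find; lose)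
  open import Data.List.Membership.Propositional.Properties using (∈-concatMap⁻; ∈-concatMap⁺; ∈-map⁻; ∈-map⁺; ∈-upTo⁻; ∈-upTo⁺)
  open import Data.List.Relation.Unary.Any using (here; there)
  open import Data.List.Relation.Unary.All using (All; []; _∷_)
  import Data.List.Relation.Unary.All as All
  import Data.List.Relation.Unary.All.Properties as All
  open import Data.List.Relation.Unary.AllPairs using (AllPairs)
  import Data.List.Relation.Unary.AllPairs.Properties as AllPairs
  open import Data.List.Relation.Unary.Unique.Propositional using (Unique; []; _∷_)
  import Data.List.Relation.Unary.Unique.Propositional.Properties as Unique
  open import Data.List.Relation.Binary.Disjoint.Propositional using (Disjoint)
  open import Data.Product using (_×_; _,_; proj₁; proj₂; ∃)
  open import Function using (_∘_; id; Equivalence)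
  open import Relation.Nullary using (¬_)
  open import Relation.Binary.PropositionalEquality hiding ([_])

  toWord : ∀ {m n} → Vec (Fin n) m → List ℕ
  toWord w = Vec.toList (Vec.map toℕ w)

  words : ℕ → ℕ → List (List ℕ)
  words zero n = [ [] ]
  words (suc m) n = concatMap (λ i → map (i ∷_) (words m n)) (upTo n)

  map-toℕ-allFin : ∀ n → map toℕ (allFin n) ≡ upTo n
  map-toℕ-allFin n = trans (List.map-tabulate id toℕ) (tabulate-toℕ n id)
    where
    tabulate-toℕ : ∀ n (f : ℕ → ℕ) → tabulate {n = n} (f ∘ toℕ) ≡ applyUpTo f n
    tabulate-toℕ zero f = refl
    tabulate-toℕ (suc n) f = cong (f 0 ∷_) (tabulate-toℕ n (f ∘ suc))

  map-toWord-allVecs : ∀ m n → map toWord (allVecs m n) ≡ words m n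
  map-toWord-allVecs zero n = refl
  map-toWord-allVecs (suc m) n = begin
    map toWord (concatMap (λ i → map (i Vec.∷_) (allVecs m n)) (allFin n))
      ≡⟨ List.map-concatMap toWord (λ i → map (i Vec.∷_) (allVecs m n)) (allFin n) ⟩
    concatMap (λ i → map toWord (map (i Vec.∷_) (allVecs m n))) (allFin n)
      ≡⟨ List.concatMap-cong (λ i → trans (sym (List.map-∘ (allVecs m n))) (trans (List.map-∘ (allVecs m n)) (cong (map (toℕ i ∷_)) (map-toWord-allVecs m n)))) (allFin n) ⟩
    concatMap (λ i → map (toℕ i ∷_) (words m n)) (allFin n)
      ≡⟨ sym (List.concatMap-map (λ j → map (j ∷_) (words m n)) toℕ (allFin n)) ⟩
    concatMap (λ j → map (j ∷_) (words m n)) (map toℕ (allFin n))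
      ≡⟨ cong (concatMap (λ j → map (j ∷_) (words m n))) (map-toℕ-allFin n) ⟩
    words (suc m) n ∎
    where open ≡-Reasoning

  ∈-words⁻ : ∀ m n {l} → l ∈ words m n → length l ≡ m × All (_< n) l
  ∈-words⁻ zero n (here refl) = refl , []
  ∈-words⁻ (suc m) n l∈ with find (∈-concatMap⁻ (λ i → map (i ∷_) (words m n)) {xs = upTo n} l∈)
  ... | i , i∈ , l∈′ with ∈-map⁻ (i ∷_) l∈′
  ...   | l′ , l′∈ , refl with ∈-words⁻ m n l′∈
  ...     | |l′|≡m , l′<n = cong suc |l′|≡m , ∈-upTo⁻ i∈ ∷ l′<n

  ∈-words⁺ : ∀ m n {l} → length l ≡ m → All (_< n) l → l ∈ words m n
  ∈-words⁺ zero n {[]} _ [] = here refl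
  ∈-words⁺ (suc m) n {x ∷ l} |l|≡ (x<n ∷ l<n) =
    ∈-concatMap⁺ (λ i → map (i ∷_) (words m n)) {xs = upTo n} (lose (∈-upTo⁺ x<n) (∈-map⁺ (x ∷_) (∈-words⁺ m n (ℕ.suc-injective |l|≡) l<n)))

  words-unique : ∀ m n → Unique (words m n)
  words-unique zero n = All.[] ∷ []
  words-unique (suc m) n = Unique.concat⁺
    (All.map⁺ (All.applyUpTo⁺₂ id n (λ i → Unique.map⁺ (λ eq → proj₂ (List.∷-injective eq)) (words-unique m n))))
    (subst (AllPairs Disjoint) (sym (List.map-upTo block n)) (AllPairs.applyUpTo⁺₁ block n blocks-disjoint))
    where
    block : ℕ → List (List ℕ)
    block i = map (i ∷_) (words m n)
    blocks-disjoint : ∀ {i j} → i < j → j < n → Disjoint (block i) (block j)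
    blocks-disjoint {i} {j} i<j _ (l∈i , l∈j) with ∈-map⁻ (i ∷_) l∈i | ∈-map⁻ (j ∷_) l∈j
    ... | _ , _ , refl | _ , _ , eq = ℕ.<-irrefl (proj₁ (List.∷-injective eq)) i<j

  involutiveᵇ : ℕ → List ℕ → Bool
  involutiveᵇ n l = all (λ i → at l (at l i) ≡ᵇ i) (upTo n)

  involutiveᵇ⁻ : ∀ n l → involutiveᵇ n l ≡ true → Involutive n l
  involutiveᵇ⁻ n l inv i<n = ℕ.≡ᵇ⇒≡ _ _ (subst Data.Bool.T (sym (all≡true⁻ (λ i → at l (at l i) ≡ᵇ i) (upTo n) inv (∈-upTo⁺ i<n))) _)
    where import Data.Bool

  involutiveᵇ⁺ : ∀ n l → Involutive n l → involutiveᵇ n l ≡ true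
  involutiveᵇ⁺ n l inv = all-true (upTo n) (λ {i} i∈ → subst (λ z → (z ≡ᵇ i) ≡ true) (sym (inv (∈-upTo⁻ i∈))) (≡ᵇ-refl i))
    where
    all-true : ∀ is → (∀ {i} → i ∈ is → (at l (at l i) ≡ᵇ i) ≡ true) → all (λ i → at l (at l i) ≡ᵇ i) is ≡ true
    all-true [] _ = refl
    all-true (i ∷ is) h = ∧-intro (h (here refl)) (all-true is (h ∘ there))

  toℕ-lookup : ∀ {m n} (w : Vec (Fin n) m) (i : Fin m) → toℕ (Vec.lookup w i) ≡ at (toWord w) (toℕ i)
  toℕ-lookup (x Vec.∷ w) Fin.zero = refl
  toℕ-lookup (x Vec.∷ w) (Fin.suc i) = toℕ-lookup w i

  isInvolution≡involutiveᵇ : ∀ {n} (w : Vec (Fin n) n) → isInvolution w ≡ involutiveᵇ n (toWord w)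
  isInvolution≡involutiveᵇ {n} w = begin
    all (λ i → toℕ (Vec.lookup w (Vec.lookup w i)) ≡ᵇ toℕ i) (allFin n)
      ≡⟨ all-cong (allFin n) (λ i → cong (_≡ᵇ toℕ i) (trans (toℕ-lookup w (Vec.lookup w i)) (cong (at l) (toℕ-lookup w i)))) ⟩
    all ((λ j → at l (at l j) ≡ᵇ j) ∘ toℕ) (allFin n)
      ≡⟨ sym (all-map (λ j → at l (at l j) ≡ᵇ j) toℕ (allFin n)) ⟩
    all (λ j → at l (at l j) ≡ᵇ j) (map toℕ (allFin n))
      ≡⟨ cong (all (λ j → at l (at l j) ≡ᵇ j)) (map-toℕ-allFin n) ⟩
    involutiveᵇ n l ∎
    where
    open ≡-Reasoning
    l = toWord w

  goodWord : List ℕ → ℕ → List ℕ → Bool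
  goodWord τ n l = involutiveᵇ n l ∧ isEven (inversions l) ∧ not (contains l pat132) ∧ not (contains l τ)

  Ie≡countᵇ-words : ∀ τ n → Ie τ n ≡ countᵇ (goodWord τ n) (words n n)
  Ie≡countᵇ-words τ n = begin
    Ie τ n                                     ≡⟨ countᵇ-cong (allVecs n n) (λ {w} _ → cong (_∧ rest w) (isInvolution≡involutiveᵇ w)) ⟩
    countᵇ (goodWord τ n ∘ toWord) (allVecs n n) ≡⟨ sym (countᵇ-map (goodWord τ n) toWord (allVecs n n)) ⟩
    countᵇ (goodWord τ n) (map toWord (allVecs n n)) ≡⟨ cong (countᵇ (goodWord τ n)) (map-toWord-allVecs n n) ⟩
    countᵇ (goodWord τ n) (words n n)          ∎
    where
    open ≡-Reasoning
    rest : Vec (Fin n) n → Bool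
    rest w = isEven (inversions (toWord w)) ∧ not (contains (toWord w) pat132) ∧ not (contains (toWord w) τ)

  at-injective⇒unique : ∀ l → (∀ {i j} → i < length l → j < length l → at l i ≡ at l j → i ≡ j) → Unique l
  at-injective⇒unique [] _ = []
  at-injective⇒unique (x ∷ l) at-injective =
    All.tabulate (λ y∈ x≡y → let j , j< , at≡y = ∈⇒at l y∈ in 0≢1+ (at-injective (s≤s z≤n) (s≤s j<) (trans x≡y (sym at≡y))))
    ∷ at-injective⇒unique l (λ i< j< eq → ℕ.suc-injective (at-injective (s≤s i<) (s≤s j<) eq))
    where
    0≢1+ : ∀ {j} → 0 ≢ suc j
    0≢1+ ()

  involutive⇒unique : ∀ l → Involutive (length l) l → Unique l
  involutive⇒unique l involutive = at-injective⇒unique l (λ i< j< eq → trans (sym (involutive i<)) (trans (cong (at l) eq) (involutive j<)))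

  involutionCount≡Ie : ∀ k n → involutionCount k true n ≡ Ie (idPat k) n
  involutionCount≡Ie k n = trans
    (countᵇ-bijection word (involutions n n) (words n n) (involutions-unique n n) (words-unique n n) (word-injective _ _) into onto)
    (sym (Ie≡countᵇ-words (idPat k) n))
    where
    into : ∀ {t} → t ∈ involutions n n → good k true t ≡ true → word t ∈ words n n × goodWord (idPat k) n (word t) ≡ true
    into {t} t∈ t-good with ∈-involutions⁻ n n t∈ | ∧-elim {lisBelow k t} t-good
    ... | refl , t-selfInverse | lis , even =
      ∈-words⁺ (size t) (size t) (length-word t) (All.tabulate (word-bound t)) ,
      ∧-intro (involutiveᵇ⁺ (size t) (word t) (selfInverse⇒involutive t t-selfInverse))
       (∧-intro (trans (cong isEven (inversions-word t)) (trans (sym (==-true _)) even))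
        (∧-intro (cong not (contains-word-132 t))
                 (trans (cong not (contains-word-idPat k t)) (trans (Bool.not-involutive (lisBelow k t)) lis))))
    onto : ∀ {l} → l ∈ words n n → goodWord (idPat k) n l ≡ true → ∃ λ t → t ∈ involutions n n × good k true t ≡ true × word t ≡ l
    onto {l} l∈ l-good with ∈-words⁻ n n l∈ | ∧-elim {involutiveᵇ n l} l-good
    ... | refl , l<n | inv , rest with ∧-elim {isEven (inversions l)} rest
    ...   | even , rest′ with ∧-elim {not (contains l pat132)} rest′
    ...     | ¬132 , ¬k = t , t∈ , ∧-intro lis (trans (==-true _) (trans (cong isEven (sym inversions-l)) even)) , word-t≡l
      where
      involutive = involutiveᵇ⁻ (length l) l inv
      avoids-132 : ¬ Has132 l
      avoids-132 has132 with () ← trans (sym ¬132) (cong not (Equivalence.from (contains-132⇔Has132 l) has132))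
      decoded = decode (length l) l ℕ.≤-refl (l<n , involutive⇒unique l involutive , avoids-132)
      t = proj₁ decoded
      word-t≡l = proj₂ decoded
      size-t : size t ≡ length l
      size-t = trans (sym (length-word t)) (cong length word-t≡l)
      t∈ : t ∈ involutions (length l) (length l)
      t∈ = subst (λ z → t ∈ involutions (length l) z) size-t
        (∈-involutions⁺ (length l) t (ℕ.≤-reflexive size-t)
          (involutive⇒selfInverse t (λ i< → subst (λ z → at z (at z _) ≡ _) (sym word-t≡l) (involutive (subst (_ <_) size-t i<)))))
      lis : lisBelow k t ≡ true
      lis = trans (sym (Bool.not-involutive (lisBelow k t)))
                  (trans (cong not (sym (contains-word-idPat k t))) (subst (λ z → not (contains z (idPat k)) ≡ true) (sym word-t≡l) ¬k))
      inversions-l : inversions l ≡ inversionsᵗ t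
      inversions-l = trans (cong inversions (sym word-t≡l)) (inversions-word t)


open import Data.Integer using (+_)
open import Relation.Binary.PropositionalEquality using (cong; sym; module ≡-Reasoning)
open PowerSeries using (coeff)
open GeneratingFunctions using (evenSeries; rhs≈evenSeries)
open Involutions using (involutionCount≡Ie)

theorem3p5 : (k : ℕ) → 1 ≤ k → (n : ℕ) → genFun k n ≡ rhs k n
theorem3p5 k _ n = begin
  genFun k n     ≡⟨ cong +_ (sym (involutionCount≡Ie k n)) ⟩
  evenSeries k n ≡⟨ sym (coeff (rhs≈evenSeries k) n) ⟩
  rhs k n        ∎
  where open ≡-Reasoning
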